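{- Suppose that $M$ and $N$ are $3$-connected matroids such that $|E(N)| \geq 4$, and $C$ is a circuit of $M$ with the property that $M \backslash x_{0}$ has an $N$-minor for some $x_{0} \in C$. Then at least one of the following holds: (i) there is an element $x \in C$ such that $\operatorname{co}(M \backslash x)$ is $3$-connected and has an $N$-minor; (ii) there is an element $x \in C$ such that $\operatorname{si}(\operatorname{co}(M \backslash x))$ is $3$-connected and has an $N$-minor; or (iii) there is a four-element fan $(x_{1}, x_{2}, x_{3}, x_{4})$ in $M$ such that $x_{2}, x_{4} \in C$, and $\operatorname{co}(M \backslash x_{3})$ is $3$-connected with an $N$-minor.
   Context: All matroids are finite. For a matroid $M$ with ground set $E$ and rank function $r$, the connectivity function is $\lambda_M(X) = r(X) + r(E - X) - r(M)$ for $X \subseteq E$. A $k$-separation of $M$ is a partition $(X, E-X)$ of $E$ with $\lambda_M(X) < k$ and $|X|, |E-X| \geq k$. $M$ is $n$-connected if it has no $k$-separation for any $k < n$ ($k$ a positive integer). $\operatorname{si}(M)$ is the simple matroid associated with $M$ (delete all loops and all but one element of each parallel class), and $\operatorname{co}(M) = (\operatorname{si}(M^*))^*$ is the cosimple matroid associated with $M$. A matroid has an $N$-minor if it has a minor isomorphic to $N$. A triangle is a three-element circuit and a triad is a three-element cocircuit. A four-element fan of $M$ is a sequence $(x_1,x_2,x_3,x_4)$ of distinct elements of $E(M)$ such that $\{x_1,x_2,x_3\}$ is a triangle and $\{x_2,x_3,x_4\}$ is a triad. -}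

module Defs where

open import Data.Bool.Base using (true; false)
open import Data.Fin.Base using (Fin; _<_)
open import Data.Fin.Properties using (any?; _<?_; _≟_)
open import Data.Fin.Subset
open import Data.Fin.Subset.Properties
open import Data.Nat.Base as ℕ using (ℕ; suc; _+_; _∸_; _≤_)
import Data.Nat.Properties as ℕ
open import Data.Nat.Tactic.RingSolver using (solve-∀)
open import Data.Product.Base using (∃; ∃-syntax; _×_; _,_; proj₁; proj₂)
open import Data.Sum.Base using (_⊎_; [_,_]′; inj₁; inj₂)
open import Data.Vec.Base using ([]; _∷_; tabulate)
open import Function.Bundles using (_↔_; _⇔_; Inverse)
open import Relation.Binary.PropositionalEquality
open import Relation.Nullary
open import Relation.Nullary.Decidable using (decidable-stable; map′)
open import Relation.Unary using (Decidable)

private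
  variable
    m n : ℕ

-- The rank function of a matroid on E ⊆ Fin n is extended from subsets of E
-- to all subsets of Fin n by r X = r (X ∩ E).  By `rank-ground` elements
-- outside E carry no information, and the other axioms are then equivalent
-- to the usual rank axioms for subsets of E.  Minors and duals live on the
-- same Fin n.
record Matroid (n : ℕ) : Set where
  field
    E           : Subset n
    r           : Subset n → ℕ
    rank-ground : ∀ X → r (X ∩ E) ≡ r X
    rank-card   : ∀ X → r X ≤ ∣ X ∣
    rank-mono   : ∀ {X Y} → X ⊆ Y → r X ≤ r Y
    rank-submod : ∀ X Y → r (X ∪ Y) + r (X ∩ Y) ≤ r X + r Y

open Matroid public

private
  ∣∪∣+∣∩∣ : (X Y : Subset n) → ∣ X ∪ Y ∣ + ∣ X ∩ Y ∣ ≡ ∣ X ∣ + ∣ Y ∣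
  ∣∪∣+∣∩∣ []          []          = refl
  ∣∪∣+∣∩∣ (true ∷ X)  (true ∷ Y)  =
    cong suc (trans (ℕ.+-suc _ _) (trans (cong suc (∣∪∣+∣∩∣ X Y)) (sym (ℕ.+-suc _ _))))
  ∣∪∣+∣∩∣ (true ∷ X)  (false ∷ Y) = cong suc (∣∪∣+∣∩∣ X Y)
  ∣∪∣+∣∩∣ (false ∷ X) (true ∷ Y)  = trans (cong suc (∣∪∣+∣∩∣ X Y)) (sym (ℕ.+-suc _ _))
  ∣∪∣+∣∩∣ (false ∷ X) (false ∷ Y) = ∣∪∣+∣∩∣ X Y

  E─[X∩E] : (E X : Subset n) → E ─ (X ∩ E) ≡ E ─ X
  E─[X∩E] []          []          = refl
  E─[X∩E] (true ∷ E)  (true ∷ X)  = cong (false ∷_) (E─[X∩E] E X)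
  E─[X∩E] (true ∷ E)  (false ∷ X) = cong (true ∷_) (E─[X∩E] E X)
  E─[X∩E] (false ∷ E) (true ∷ X)  = cong (false ∷_) (E─[X∩E] E X)
  E─[X∩E] (false ∷ E) (false ∷ X) = cong (false ∷_) (E─[X∩E] E X)

  E─[X∪Y] : (E X Y : Subset n) → E ─ (X ∪ Y) ≡ (E ─ X) ∩ (E ─ Y)
  E─[X∪Y] []      []          []          = refl
  E─[X∪Y] (e ∷ E) (true ∷ X)  (y ∷ Y)     = cong (false ∷_) (E─[X∪Y] E X Y)
  E─[X∪Y] (true ∷ E) (false ∷ X) (true ∷ Y)   = cong (false ∷_) (E─[X∪Y] E X Y)
  E─[X∪Y] (false ∷ E) (false ∷ X) (true ∷ Y)  = cong (false ∷_) (E─[X∪Y] E X Y)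
  E─[X∪Y] (true ∷ E) (false ∷ X) (false ∷ Y)  = cong (true ∷_) (E─[X∪Y] E X Y)
  E─[X∪Y] (false ∷ E) (false ∷ X) (false ∷ Y) = cong (false ∷_) (E─[X∪Y] E X Y)

  E─[X∩Y] : (E X Y : Subset n) → E ─ (X ∩ Y) ≡ (E ─ X) ∪ (E ─ Y)
  E─[X∩Y] []      []          []          = refl
  E─[X∩Y] (e ∷ E) (true ∷ X)  (true ∷ Y)  = cong (false ∷_) (E─[X∩Y] E X Y)
  E─[X∩Y] (e ∷ E) (true ∷ X)  (false ∷ Y) = cong (e ∷_) (E─[X∩Y] E X Y)
  E─[X∩Y] (true ∷ E) (false ∷ X) (y ∷ Y)      = cong (true ∷_) (E─[X∩Y] E X Y)
  E─[X∩Y] (false ∷ E) (false ∷ X) (true ∷ Y)  = cong (false ∷_) (E─[X∩Y] E X Y)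
  E─[X∩Y] (false ∷ E) (false ∷ X) (false ∷ Y) = cong (false ∷_) (E─[X∩Y] E X Y)

  x∈p─q⁻ : ∀ {x} (p q : Subset n) → x ∈ p ─ q → x ∈ p × x ∉ q
  x∈p─q⁻ p q x∈ = p─q⊆p p q x∈ , λ x∈q → ∉⊥ (subst (_ ∈_) (lem p q) (x∈p∩q⁺ (x∈ , x∈q)))
    where
    lem : ∀ {n} (p q : Subset n) → (p ─ q) ∩ q ≡ ⊥
    lem []          []          = refl
    lem (x ∷ p)     (true ∷ q)  = cong (false ∷_) (lem p q)
    lem (true ∷ p)  (false ∷ q) = cong (false ∷_) (lem p q)
    lem (false ∷ p) (false ∷ q) = cong (false ∷_) (lem p q)

  [X∪T]∩E : (X T E : Subset n) → ((X ∩ (E ─ T)) ∪ T) ∩ E ≡ (X ∪ T) ∩ E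
  [X∪T]∩E X T E = ⊆-antisym
    (λ x∈ → let a , b = x∈p∩q⁻ _ E x∈ in
       x∈p∩q⁺ (x∈p∪q⁺ ([ (λ u → inj₁ (proj₁ (x∈p∩q⁻ X _ u))) , inj₂ ]′ (x∈p∪q⁻ _ T a)) , b))
    (λ {x} x∈ → let a , b = x∈p∩q⁻ _ E x∈ in
       x∈p∩q⁺ (x∈p∪q⁺ ([ (λ u → case′ u b) , inj₂ ]′ (x∈p∪q⁻ X T a)) , b))
    where
    case′ : ∀ {x} → x ∈ X → x ∈ E → x ∈ X ∩ (E ─ T) ⊎ x ∈ T
    case′ {x} u b with x ∈? T
    ... | yes t = inj₂ t
    ... | no ¬t = inj₁ (x∈p∩q⁺ (u , x∈p∧x∉q⇒x∈p─q b ¬t))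

  ∩-monoˡ : (Z : Subset n) {X Y : Subset n} → X ⊆ Y → X ∩ Z ⊆ Y ∩ Z
  ∩-monoˡ Z {X} X⊆Y x∈ = let a , b = x∈p∩q⁻ X Z x∈ in x∈p∩q⁺ (X⊆Y a , b)

  ∪-monoˡ : (Z : Subset n) {X Y : Subset n} → X ⊆ Y → X ∪ Z ⊆ Y ∪ Z
  ∪-monoˡ Z {X} X⊆Y x∈ = x∈p∪q⁺ ([ (λ a → inj₁ (X⊆Y a)) , inj₂ ]′ (x∈p∪q⁻ X Z x∈))

  [X∪Y]∩Z : (X Y Z : Subset n) → (X ∪ Y) ∩ Z ≡ (X ∩ Z) ∪ (Y ∩ Z)
  [X∪Y]∩Z X Y Z = ∩-distribʳ-∪ Z X Y

  [X∩Y]∩Z : (X Y Z : Subset n) → (X ∩ Y) ∩ Z ≡ (X ∩ Z) ∩ (Y ∩ Z)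
  [X∩Y]∩Z []      []      []          = refl
  [X∩Y]∩Z (true ∷ X) (y ∷ Y) (true ∷ Z)  = cong (_ ∷_) ([X∩Y]∩Z X Y Z)
  [X∩Y]∩Z (false ∷ X) (y ∷ Y) (z ∷ Z)     = cong (_ ∷_) ([X∩Y]∩Z X Y Z)
  [X∩Y]∩Z (true ∷ X) (true ∷ Y) (false ∷ Z)  = cong (_ ∷_) ([X∩Y]∩Z X Y Z)
  [X∩Y]∩Z (true ∷ X) (false ∷ Y) (false ∷ Z) = cong (_ ∷_) ([X∩Y]∩Z X Y Z)

  [X∪Y]∪Z : (X Y Z : Subset n) → (X ∪ Y) ∪ Z ≡ (X ∪ Z) ∪ (Y ∪ Z)
  [X∪Y]∪Z []      []      []          = refl
  [X∪Y]∪Z (true ∷ X) (y ∷ Y) (z ∷ Z)  = cong (_ ∷_) ([X∪Y]∪Z X Y Z)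
  [X∪Y]∪Z (false ∷ X) (true ∷ Y) (true ∷ Z)  = cong (_ ∷_) ([X∪Y]∪Z X Y Z)
  [X∪Y]∪Z (false ∷ X) (true ∷ Y) (false ∷ Z)  = cong (_ ∷_) ([X∪Y]∪Z X Y Z)
  [X∪Y]∪Z (false ∷ X) (false ∷ Y) (true ∷ Z)  = cong (_ ∷_) ([X∪Y]∪Z X Y Z)
  [X∪Y]∪Z (false ∷ X) (false ∷ Y) (false ∷ Z)  = cong (_ ∷_) ([X∪Y]∪Z X Y Z)

  rank-subadd : (M : Matroid n) (X Y : Subset n) → r M (X ∪ Y) ≤ r M X + r M Y
  rank-subadd M X Y = ℕ.≤-trans (ℕ.m≤m+n _ _) (rank-submod M X Y)

  ∸-sum : ∀ {a b c d t} → t ≤ a → t ≤ b → t ≤ c → t ≤ d →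
          a + b ≤ c + d → (a ∸ t) + (b ∸ t) ≤ (c ∸ t) + (d ∸ t)
  ∸-sum {a} {b} {c} {d} {t} ta tb tc td le =
    ℕ.+-cancelʳ-≤ (t + t) _ _
      (subst₂ _≤_ (split ta tb) (split tc td) le)
    where
    shuffle : ∀ x y t → (x + t) + (y + t) ≡ (x + y) + (t + t)
    shuffle = solve-∀

    split : ∀ {x y} → t ≤ x → t ≤ y → x + y ≡ ((x ∸ t) + (y ∸ t)) + (t + t)
    split {x} {y} tx ty =
      trans (cong₂ _+_ (sym (ℕ.m∸n+n≡m tx)) (sym (ℕ.m∸n+n≡m ty)))
            (shuffle (x ∸ t) (y ∸ t) t)

-- In M ＼ D and M ／ T, elements of D and T outside E M have no effect.

infixl 6 _＼_ _／_

_＼_ : Matroid n → Subset n → Matroid n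
M ＼ D = record
  { E           = E′
  ; r           = λ X → r M (X ∩ E′)
  ; rank-ground = λ X → cong (r M) (trans (∩-assoc X E′ E′) (cong (X ∩_) (∩-idem E′)))
  ; rank-card   = λ X → ℕ.≤-trans (rank-card M (X ∩ E′)) (∣p∩q∣≤∣p∣ X E′)
  ; rank-mono   = λ X⊆Y → rank-mono M (∩-monoˡ E′ X⊆Y)
  ; rank-submod = λ X Y →
      subst₂ (λ U V → r M U + r M V ≤ r M (X ∩ E′) + r M (Y ∩ E′))
        (sym ([X∪Y]∩Z X Y E′)) (sym ([X∩Y]∩Z X Y E′))
        (rank-submod M (X ∩ E′) (Y ∩ E′))
  }
  where E′ = E M ─ D

_／_ : Matroid n → Subset n → Matroid n
M ／ T = record
  { E           = E′
  ; r           = λ X → r M (X ∪ T) ∸ r M T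
  ; rank-ground = λ X → cong (_∸ r M T)
      (trans (sym (rank-ground M _))
        (trans (cong (r M) ([X∪T]∩E X T (E M))) (rank-ground M _)))
  ; rank-card   = λ X → ℕ.m≤n+o⇒m∸n≤o _ (r M T)
      (ℕ.≤-trans (rank-subadd M X T)
        (ℕ.≤-trans (ℕ.+-monoˡ-≤ (r M T) (rank-card M X))
          (ℕ.≤-reflexive (ℕ.+-comm (∣ X ∣) (r M T)))))
  ; rank-mono   = λ X⊆Y → ℕ.∸-monoˡ-≤ (r M T) (rank-mono M (∪-monoˡ T X⊆Y))
  ; rank-submod = λ X Y → ∸-sum (T≤ _) (T≤ _) (T≤ _) (T≤ _)
      (subst₂ (λ U V → r M U + r M V ≤ r M (X ∪ T) + r M (Y ∪ T))
        (sym ([X∪Y]∪Z X Y T)) (sym (∪-distribʳ-∩ T X Y))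
        (rank-submod M (X ∪ T) (Y ∪ T)))
  }
  where
  E′ = E M ─ T
  T≤ : ∀ X → r M T ≤ r M (X ∪ T)
  T≤ X = rank-mono M (q⊆p∪q X T)

-- r*(X) = |X| + r(E - X) - r(E) for X ⊆ E.
dual : Matroid n → Matroid n
dual {n} M = record
  { E           = E₀
  ; r           = λ X → t X ∸ ρ
  ; rank-ground = λ X → cong (_∸ ρ) (cong₂ _+_
      (cong ∣_∣ (trans (∩-assoc X E₀ E₀) (cong (X ∩_) (∩-idem E₀))))
      (cong (r M) (E─[X∩E] E₀ X)))
  ; rank-card   = λ X → ℕ.m≤n+o⇒m∸n≤o _ ρ
      (ℕ.≤-trans (ℕ.+-mono-≤ (∣p∩q∣≤∣p∣ X E₀) (rank-mono M (p─q⊆p E₀ X)))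
        (ℕ.≤-reflexive (ℕ.+-comm (∣ X ∣) ρ)))
  ; rank-mono   = λ {X} {Y} X⊆Y → ℕ.∸-monoˡ-≤ ρ (mono X Y X⊆Y)
  ; rank-submod = λ X Y → ∸-sum (ρ≤ _) (ρ≤ _) (ρ≤ _) (ρ≤ _) (submod X Y)
  }
  where
  open ℕ.≤-Reasoning

  E₀ = E M
  ρ  = r M E₀

  t : Subset n → ℕ
  t X = ∣ X ∩ E₀ ∣ + r M (E₀ ─ X)

  ρ≤ : ∀ X → ρ ≤ t X
  ρ≤ X = begin
    r M E₀                        ≤⟨ rank-mono M cover ⟩
    r M ((X ∩ E₀) ∪ (E₀ ─ X))     ≤⟨ rank-subadd M _ _ ⟩
    r M (X ∩ E₀) + r M (E₀ ─ X)   ≤⟨ ℕ.+-monoˡ-≤ _ (rank-card M _) ⟩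
    t X                           ∎
    where
    cover : E₀ ⊆ (X ∩ E₀) ∪ (E₀ ─ X)
    cover {x} x∈E with x ∈? X
    ... | yes x∈X = x∈p∪q⁺ (inj₁ (x∈p∩q⁺ (x∈X , x∈E)))
    ... | no  x∉X = x∈p∪q⁺ (inj₂ (x∈p∧x∉q⇒x∈p─q x∈E x∉X))

  mono : ∀ X Y → X ⊆ Y → t X ≤ t Y
  mono X Y X⊆Y = begin
    ∣ X ∩ E₀ ∣ + r M (E₀ ─ X)            ≤⟨ ℕ.+-monoʳ-≤ (∣ X ∩ E₀ ∣) (rank-mono M cover) ⟩
    ∣ X ∩ E₀ ∣ + r M (Z ∪ (E₀ ─ Y))      ≤⟨ ℕ.+-monoʳ-≤ (∣ X ∩ E₀ ∣) (rank-subadd M Z _) ⟩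
    ∣ X ∩ E₀ ∣ + (r M Z + r M (E₀ ─ Y))  ≡⟨ ℕ.+-assoc (∣ X ∩ E₀ ∣) (r M Z) _ ⟨
    ∣ X ∩ E₀ ∣ + r M Z + r M (E₀ ─ Y)    ≤⟨ ℕ.+-monoˡ-≤ _ (ℕ.+-monoʳ-≤ (∣ X ∩ E₀ ∣) (rank-card M Z)) ⟩
    ∣ X ∩ E₀ ∣ + ∣ Z ∣ + r M (E₀ ─ Y)    ≤⟨ ℕ.+-monoˡ-≤ _ count-≤ ⟩
    ∣ Y ∩ E₀ ∣ + r M (E₀ ─ Y)            ∎
    where
    Z = (Y ∩ E₀) ─ X

    cover : E₀ ─ X ⊆ Z ∪ (E₀ ─ Y)
    cover {x} x∈ with x ∈? Y | x∈p─q⁻ E₀ X x∈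
    ... | yes x∈Y | x∈E , x∉X = x∈p∪q⁺ (inj₁ (x∈p∧x∉q⇒x∈p─q (x∈p∩q⁺ (x∈Y , x∈E)) x∉X))
    ... | no  x∉Y | x∈E , x∉X = x∈p∪q⁺ (inj₂ (x∈p∧x∉q⇒x∈p─q x∈E x∉Y))

    disjoint : (X ∩ E₀) ∩ Z ⊆ ⊥
    disjoint x∈ =
      let a , b = x∈p∩q⁻ (X ∩ E₀) Z x∈
      in contradiction (proj₁ (x∈p∩q⁻ X E₀ a)) (proj₂ (x∈p─q⁻ (Y ∩ E₀) X b))

    union : (X ∩ E₀) ∪ Z ⊆ Y ∩ E₀
    union x∈ = [ ∩-monoˡ E₀ X⊆Y , p─q⊆p (Y ∩ E₀) X ]′ (x∈p∪q⁻ (X ∩ E₀) Z x∈)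

    count-≤ : ∣ X ∩ E₀ ∣ + ∣ Z ∣ ≤ ∣ Y ∩ E₀ ∣
    count-≤ = begin
      ∣ X ∩ E₀ ∣ + ∣ Z ∣                     ≡⟨ ∣∪∣+∣∩∣ (X ∩ E₀) Z ⟨
      ∣ (X ∩ E₀) ∪ Z ∣ + ∣ (X ∩ E₀) ∩ Z ∣    ≤⟨ ℕ.+-mono-≤ (p⊆q⇒∣p∣≤∣q∣ union) (p⊆q⇒∣p∣≤∣q∣ disjoint) ⟩
      ∣ Y ∩ E₀ ∣ + ∣ ⊥ {n} ∣                 ≡⟨ cong (∣ Y ∩ E₀ ∣ +_) (∣⊥∣≡0 n) ⟩
      ∣ Y ∩ E₀ ∣ + 0                         ≡⟨ ℕ.+-identityʳ _ ⟩
      ∣ Y ∩ E₀ ∣                             ∎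

  interchange : ∀ a b c d → (a + b) + (c + d) ≡ (a + c) + (d + b)
  interchange = solve-∀

  interchange′ : ∀ a b c d → (a + c) + (b + d) ≡ (a + b) + (c + d)
  interchange′ = solve-∀

  submod : ∀ X Y → t (X ∪ Y) + t (X ∩ Y) ≤ t X + t Y
  submod X Y = begin
    t (X ∪ Y) + t (X ∩ Y)
      ≡⟨ interchange (∣ (X ∪ Y) ∩ E₀ ∣) _ (∣ (X ∩ Y) ∩ E₀ ∣) _ ⟩
    (∣ (X ∪ Y) ∩ E₀ ∣ + ∣ (X ∩ Y) ∩ E₀ ∣) + (r M (E₀ ─ (X ∩ Y)) + r M (E₀ ─ (X ∪ Y)))
      ≡⟨ cong₂ _+_
           (cong₂ (λ U V → ∣ U ∣ + ∣ V ∣) ([X∪Y]∩Z X Y E₀) ([X∩Y]∩Z X Y E₀))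
           (cong₂ (λ U V → r M U + r M V) (E─[X∩Y] E₀ X Y) (E─[X∪Y] E₀ X Y)) ⟩
    (∣ (X ∩ E₀) ∪ (Y ∩ E₀) ∣ + ∣ (X ∩ E₀) ∩ (Y ∩ E₀) ∣)
      + (r M ((E₀ ─ X) ∪ (E₀ ─ Y)) + r M ((E₀ ─ X) ∩ (E₀ ─ Y)))
      ≤⟨ ℕ.+-mono-≤ (ℕ.≤-reflexive (∣∪∣+∣∩∣ (X ∩ E₀) (Y ∩ E₀)))
                    (rank-submod M (E₀ ─ X) (E₀ ─ Y)) ⟩
    (∣ X ∩ E₀ ∣ + ∣ Y ∩ E₀ ∣) + (r M (E₀ ─ X) + r M (E₀ ─ Y))
      ≡⟨ interchange′ (∣ X ∩ E₀ ∣) (∣ Y ∩ E₀ ∣) (r M (E₀ ─ X)) _ ⟨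
    t X + t Y ∎

Independent : Matroid n → Subset n → Set
Independent M X = X ⊆ E M × r M X ≡ ∣ X ∣

Circuit : Matroid n → Subset n → Set
Circuit M C = C ⊆ E M × ¬ Independent M C × (∀ D → D ⊂ C → Independent M D)

Cocircuit : Matroid n → Subset n → Set
Cocircuit M = Circuit (dual M)

Triangle : Matroid n → Subset n → Set
Triangle M X = Circuit M X × ∣ X ∣ ≡ 3

Triad : Matroid n → Subset n → Set
Triad M X = Cocircuit M X × ∣ X ∣ ≡ 3

FourFan : Matroid n → (x₁ x₂ x₃ x₄ : Fin n) → Set
FourFan M x₁ x₂ x₃ x₄ =
  (x₁ ≢ x₂ × x₁ ≢ x₃ × x₁ ≢ x₄ × x₂ ≢ x₃ × x₂ ≢ x₄ × x₃ ≢ x₄) ×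
  Triangle M (⁅ x₁ ⁆ ∪ ⁅ x₂ ⁆ ∪ ⁅ x₃ ⁆) ×
  Triad    M (⁅ x₂ ⁆ ∪ ⁅ x₃ ⁆ ∪ ⁅ x₄ ⁆)

Loop : Matroid n → Fin n → Set
Loop M e = Circuit M ⁅ e ⁆

Parallel : Matroid n → Fin n → Fin n → Set
Parallel M e f = e ≢ f × Circuit M (⁅ e ⁆ ∪ ⁅ f ⁆)

independent? : (M : Matroid n) → Decidable (Independent M)
independent? M X = (X ⊆? E M) ×-dec (r M X ℕ.≟ ∣ X ∣)

circuit? : (M : Matroid n) → Decidable (Circuit M)
circuit? M C = (C ⊆? E M) ×-dec ¬? (independent? M C) ×-dec
  map′ (λ ¬∃ D D⊂C → decidable-stable (independent? M D) (λ ¬i → ¬∃ (D , D⊂C , ¬i)))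
       (λ all (D , D⊂C , ¬i) → ¬i (all D D⊂C))
       (¬? (anySubset? (λ D → (D ⊂? C) ×-dec ¬? (independent? M D))))

-- The representative kept from each parallel class is its least element;
-- any other choice gives an isomorphic matroid.
Redundant : Matroid n → Fin n → Set
Redundant M e = Loop M e ⊎ (∃[ f ] f < e × Parallel M f e)

redundant? : (M : Matroid n) → Decidable (Redundant M)
redundant? M e = circuit? M ⁅ e ⁆ ⊎-dec
  any? (λ f → (f <? e) ×-dec ¬? (f ≟ e) ×-dec circuit? M (⁅ f ⁆ ∪ ⁅ e ⁆))

si : Matroid n → Matroid n
si M = M ＼ tabulate (λ e → does (redundant? M e))

co : Matroid n → Matroid n
co M = dual (si (dual M))

infix 4 _≅_

-- A bijection E M → E N such that r M X ≡ r N Y whenever Y is the image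
-- of X.
record _≅_ (M : Matroid m) (N : Matroid n) : Set where
  field
    bijection : (∃[ x ] x ∈ E M) ↔ (∃[ y ] y ∈ E N)
    rank-≡    : ∀ {X Y} → X ⊆ E M → Y ⊆ E N →
                (∀ e → proj₁ e ∈ X ⇔ proj₁ (Inverse.to bijection e) ∈ Y) →
                r M X ≡ r N Y

-- T and D need not be disjoint subsets of E M: the effect is that of
-- T ∩ E M and (D ─ T) ∩ E M.
HasMinor : Matroid m → Matroid n → Set
HasMinor M N = ∃[ T ] ∃[ D ] (M ／ T ＼ D) ≅ N

-- The truncated subtraction is exact, by submodularity.
connectivity : Matroid n → Subset n → ℕ
connectivity M X = (r M X + r M (E M ─ X)) ∸ r M (E M)

Separation : ℕ → Matroid n → Subset n → Set
Separation k M X =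
  X ⊆ E M × connectivity M X ℕ.< k × k ≤ ∣ X ∣ × k ≤ ∣ E M ─ X ∣

Connected : ℕ → Matroid n → Set
Connected c M = ∀ k → 1 ≤ k → k ℕ.< c → ∀ X → ¬ Separation k M X

-- Dually, C is a cocircuit of a 3-connected matroid M and M ／ x₀ has an N-minor
-- for some x₀ ∈ C.  If si (M ／ x₀) is not 3-connected, then M has a vertical
-- 3-separation (X , x₀ , Y) with at most one element of the N-minor in X.  Since
-- M ／ x₀ is a 2-sum along (X , Y), M ／ e has an N-minor for every e in X that is
-- not spanned by Y.  Take such a separation with |X| minimal.  As x₀ ∈ cl (X), the
-- cocircuit C contains some x in X.  If M has a vertical 3-separation (P , x , Q),
-- then uncrossing it with (X , x₀ , Y) shows, by minimality, that X is a cocircuit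
-- of rank 3.  Neither P nor Q spans X, so the plane spanned by X is covered by two
-- lines through x.  Hence either some element of C on these lines is as in (i), or
-- X ∪ x₀ consists of a line L through x₀ and x and of a point c off L.  Let a be
-- a third element of L, in C if possible.  If si (M ／ a) is 3-connected, then a ∈ C
-- as in (i), or (c , x , a , x₀) is the fan of (iii).  Otherwise, uncrossing the
-- vertical 3-separations at x with one at a shows that the side containing L ─ x
-- has just one further element.  After simplifying M ／ x this side is a series
-- pair, and so co (si (M ／ x)) is 3-connected.

module Submission where

open import Defs
open import Data.Bool.Base using (Bool; true; false; not; _∧_; _∨_; _xor_)
open import Data.Bool.Properties using (T-∧; T-≡)
open import Data.Empty using (⊥-elim) renaming (⊥ to Absurd)
open import Data.Fin.Base as Fin using (Fin; zero; suc)
import Data.Fin.Induction as Fin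
import Data.Fin.Properties as Fin
open import Data.Fin.Subset
open import Data.Fin.Subset.Properties
open import Data.Nat.Base as ℕ using (ℕ; zero; suc; _+_; _*_; _∸_; _≤_; z≤n; s≤s)
import Data.Nat.Properties as ℕ
open import Data.Nat.Tactic.RingSolver using (solve-∀)
open import Data.Product.Base using (∃-syntax; _×_; _,_; proj₁; proj₂)
open import Data.Sum.Base using (_⊎_; [_,_]′; inj₁; inj₂)
open import Data.Unit.Base using (tt)
open import Data.Vec.Base
  using (Vec; []; _∷_; here; there; lookup; map; replicate; zipWith; allFin; tabulate)
open import Data.Vec.N-ary using (N-ary; curryⁿ; _$ⁿ_; ∀ⁿ; ∀ⁿʰ)
open import Data.Vec.Properties
  using (lookup-map; lookup-replicate; lookup-zipWith; lookup∘tabulate; lookup⇒[]=; []=⇒lookup)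
open import Data.Vec.Properties.WithK using ([]=-irrelevant)
open import Function.Base using (_∘_; id)
open import Function.Bundles using (_⇔_; Inverse; Equivalence; mk↔ₛ′; mk⇔)
open import Function.Construct.Composition using (_↔-∘_)
open import Induction.WellFounded using (Acc; acc)
open import Relation.Binary.Definitions using (Tri; tri<; tri≈; tri>)
open import Relation.Binary.PropositionalEquality
  using (_≡_; _≢_; refl; sym; trans; cong; cong₂; subst; subst₂; module ≡-Reasoning)
open import Relation.Nullary
open import Relation.Nullary.Decidable using (dec-true)

private
  variable
    l m n : ℕ

introⁿ : ∀ {A : Set} k {P : Vec A k → Set} → (∀ ρ → P ρ) → ∀ⁿʰ k (curryⁿ P)
introⁿ zero    p = p []
introⁿ (suc k) p = introⁿ k (λ ρ → p (_ ∷ ρ))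

introⁿᵉ : ∀ {A : Set} k {P : Vec A k → Set} → (∀ ρ → P ρ) → ∀ⁿ k (curryⁿ P)
introⁿᵉ zero    p = p []
introⁿᵉ (suc k) p = λ x → introⁿᵉ k (λ ρ → p (x ∷ ρ))

-- A record, so that the two sets can be inferred from a proof.
infix 4 _⊑_

record _⊑_ {n} (X Y : Subset n) : Set where
  constructor ⊆⇒⊑
  field
    ⊑⇒⊆ : X ⊆ Y

open _⊑_ public

⊑-antisym : {X Y : Subset n} → X ⊑ Y → Y ⊑ X → X ≡ Y
⊑-antisym p q = ⊆-antisym (⊑⇒⊆ p) (⊑⇒⊆ q)

-- A decision procedure for inclusions between Boolean combinations of sets:
-- membership of a single element is checked under all valuations.
module SetSolver where

  open import Data.Bool.Base using (T)

  private
    variable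
      k : ℕ
      b : Bool

  infixr 7 _:∩_
  infixr 6 _:∪_
  infixl 5 _:─_
  infix  4 _:⊑_ _:≡_
  infixr 3 _⇒_

  data Expr (k : ℕ) : Set where
    var            : Fin k → Expr k
    :⊥             : Expr k
    _:∩_ _:∪_ _:─_ : Expr k → Expr k → Expr k

  data Form (k : ℕ) : Bool → Set where
    _:⊑_ _:≡_ : Expr k → Expr k → Form k false
    _⇒_       : Form k false → Form k b → Form k true

  ⟦_⟧ᵉ : Expr k → Vec (Subset n) k → Subset n
  ⟦ var i  ⟧ᵉ ρ = lookup ρ i
  ⟦ :⊥     ⟧ᵉ ρ = ⊥
  ⟦ s :∩ t ⟧ᵉ ρ = ⟦ s ⟧ᵉ ρ ∩ ⟦ t ⟧ᵉ ρ
  ⟦ s :∪ t ⟧ᵉ ρ = ⟦ s ⟧ᵉ ρ ∪ ⟦ t ⟧ᵉ ρ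
  ⟦ s :─ t ⟧ᵉ ρ = ⟦ s ⟧ᵉ ρ ─ ⟦ t ⟧ᵉ ρ

  ⟦_⟧ : Form k b → Vec (Subset n) k → Set
  ⟦ s :⊑ t ⟧ ρ = ⟦ s ⟧ᵉ ρ ⊑ ⟦ t ⟧ᵉ ρ
  ⟦ s :≡ t ⟧ ρ = ⟦ s ⟧ᵉ ρ ≡ ⟦ t ⟧ᵉ ρ
  ⟦ h ⇒ f  ⟧ ρ = ⟦ h ⟧ ρ → ⟦ f ⟧ ρ

  evalᵉ : Expr k → Vec Bool k → Bool
  evalᵉ (var i)  v = lookup v i
  evalᵉ :⊥       v = false
  evalᵉ (s :∩ t) v = evalᵉ s v ∧ evalᵉ t v
  evalᵉ (s :∪ t) v = evalᵉ s v ∨ evalᵉ t v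
  evalᵉ (s :─ t) v = evalᵉ s v ∧ not (evalᵉ t v)

  eval : Form k b → Vec Bool k → Bool
  eval (s :⊑ t) v = not (evalᵉ s v) ∨ evalᵉ t v
  eval (s :≡ t) v = not (evalᵉ s v xor evalᵉ t v)
  eval (h ⇒ f)  v = not (eval h v) ∨ eval f v

  everywhere : ∀ k → (Vec Bool k → Bool) → Bool
  everywhere zero    p = p []
  everywhere (suc k) p = everywhere k (p ∘ (true ∷_)) ∧ everywhere k (p ∘ (false ∷_))

  everywhere-sound : ∀ k p → T (everywhere k p) → ∀ v → T (p v)
  everywhere-sound zero    p t []          = t
  everywhere-sound (suc k) p t (true  ∷ v) =
    everywhere-sound k _ (proj₁ (Equivalence.to T-∧ t)) v
  everywhere-sound (suc k) p t (false ∷ v) =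
    everywhere-sound k _ (proj₂ (Equivalence.to (T-∧ {everywhere k (p ∘ (true ∷_))}) t)) v

  lookup-⟦⟧ : ∀ (s : Expr k) (ρ : Vec (Subset n) k) z →
              lookup (⟦ s ⟧ᵉ ρ) z ≡ evalᵉ s (map (λ X → lookup X z) ρ)
  lookup-⟦⟧ (var i)  ρ z = sym (lookup-map i (λ X → lookup X z) ρ)
  lookup-⟦⟧ :⊥       ρ z = lookup-replicate z false
  lookup-⟦⟧ (s :∩ t) ρ z =
    trans (lookup-zipWith _ z (⟦ s ⟧ᵉ ρ) _) (cong₂ _∧_ (lookup-⟦⟧ s ρ z) (lookup-⟦⟧ t ρ z))
  lookup-⟦⟧ (s :∪ t) ρ z =
    trans (lookup-zipWith _ z (⟦ s ⟧ᵉ ρ) _) (cong₂ _∨_ (lookup-⟦⟧ s ρ z) (lookup-⟦⟧ t ρ z))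
  lookup-⟦⟧ (s :─ t) ρ z =
    trans (─-lookup (⟦ s ⟧ᵉ ρ) _ z)
      (cong₂ (λ x y → x ∧ not y) (lookup-⟦⟧ s ρ z) (lookup-⟦⟧ t ρ z))
    where
    ─-lookup : ∀ {n} (X Y : Subset n) z → lookup (X ─ Y) z ≡ lookup X z ∧ not (lookup Y z)
    ─-lookup (true  ∷ X) (true  ∷ Y) zero    = refl
    ─-lookup (true  ∷ X) (false ∷ Y) zero    = refl
    ─-lookup (false ∷ X) (true  ∷ Y) zero    = refl
    ─-lookup (false ∷ X) (false ∷ Y) zero    = refl
    ─-lookup (_     ∷ X) (_     ∷ Y) (suc z) = ─-lookup X Y z

  ⊑⇔ : (X Y : Subset n) → (X ⊑ Y → ∀ z → T (not (lookup X z) ∨ lookup Y z)) ×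
                          ((∀ z → T (not (lookup X z) ∨ lookup Y z)) → X ⊑ Y)
  ⊑⇔ X Y = to , from
    where
    to : X ⊑ Y → ∀ z → T (not (lookup X z) ∨ lookup Y z)
    to p z with lookup X z in eq
    ... | false = tt
    ... | true  = subst T (sym ([]=⇒lookup (⊑⇒⊆ p (lookup⇒[]= z X eq)))) tt

    from : (∀ z → T (not (lookup X z) ∨ lookup Y z)) → X ⊑ Y
    from p = ⊆⇒⊑ λ {z} z∈ → lookup⇒[]= z Y
      (Equivalence.to T-≡ (subst (λ x → T (not x ∨ lookup Y z)) ([]=⇒lookup z∈) (p z)))

  at : Vec (Subset n) k → Fin n → Vec Bool k
  at ρ z = map (λ X → lookup X z) ρ

  sound¹ : (f : Form k false) (ρ : Vec (Subset n) k) →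
           (⟦ f ⟧ ρ → ∀ z → T (eval f (at ρ z))) × ((∀ z → T (eval f (at ρ z))) → ⟦ f ⟧ ρ)
  sound¹ (s :⊑ t) ρ =
    (λ p z → subst T (eq z) (proj₁ (⊑⇔ _ _) p z)) ,
    (λ p → proj₂ (⊑⇔ _ _) (λ z → subst T (sym (eq z)) (p z)))
    where
    eq = λ z → cong₂ (λ x y → not x ∨ y) (lookup-⟦⟧ s ρ z) (lookup-⟦⟧ t ρ z)
  sound¹ (s :≡ t) ρ =
    (λ p z → xor-refl _ _ (trans (sym (lookup-⟦⟧ s ρ z))
                            (trans (cong (λ X → lookup X z) p) (lookup-⟦⟧ t ρ z)))) ,
    (λ p → ⊑-antisym (proj₂ (sound¹ (s :⊑ t) ρ) (λ z → xor⇒ (evalᵉ s _) (evalᵉ t _) (p z)))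
                     (proj₂ (sound¹ (t :⊑ s) ρ) (λ z → xor⇐ (evalᵉ s _) (evalᵉ t _) (p z))))
    where
    xor-refl : ∀ x y → x ≡ y → T (not (x xor y))
    xor-refl true  _ refl = tt
    xor-refl false _ refl = tt

    xor⇒ : ∀ x y → T (not (x xor y)) → T (not x ∨ y)
    xor⇒ true  true  _ = tt
    xor⇒ false false _ = tt

    xor⇐ : ∀ x y → T (not (x xor y)) → T (not y ∨ x)
    xor⇐ true  true  _ = tt
    xor⇐ false false _ = tt

  sound : (f : Form k b) (ρ : Vec (Subset n) k) → (∀ z → T (eval f (at ρ z))) → ⟦ f ⟧ ρ
  sound f@(_ :⊑ _) ρ p = proj₂ (sound¹ f ρ) p
  sound f@(_ :≡ _) ρ p = proj₂ (sound¹ f ρ) p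
  sound (h ⇒ f)    ρ p = λ q → sound f ρ (λ z → mp (proj₁ (sound¹ h ρ) q z) (p z))
    where
    mp : ∀ {x y} → T x → T (not x ∨ y) → T y
    mp {true} _ t = t

  vars : ∀ k → Vec (Expr k) k
  vars k = map var (allFin k)

  solve : ∀ k (f : N-ary k (Expr k) (Form k b))
          {_ : T (everywhere k (eval (f $ⁿ vars k)))} →
          ∀ⁿʰ k (curryⁿ {A = Subset n} (⟦ f $ⁿ vars k ⟧))
  solve k f {valid} =
    introⁿ k (λ ρ → sound (f $ⁿ vars k) ρ (λ z → everywhere-sound k _ valid (at ρ z)))

-- A checker for linear arithmetic: the sum of the hypotheses must imply the
-- conclusion coefficientwise.
module LinearSolver where

  open import Data.Bool.Base using (T)

  private
    variable
      k : ℕ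
      b : Bool

  infixl 6 _:+_
  infix  4 _:≤_ _:=_
  infixr 3 _⟹_

  data Expr (k : ℕ) : Set where
    var  : Fin k → Expr k
    con  : ℕ → Expr k
    _:+_ : Expr k → Expr k → Expr k

  data Form (k : ℕ) : Bool → Set where
    _:≤_ _:=_ : Expr k → Expr k → Form k false
    :false    : Form k false
    _⟹_       : Form k false → Form k b → Form k true

  ⟦_⟧ᵉ : Expr k → Vec ℕ k → ℕ
  ⟦ var i  ⟧ᵉ ρ = lookup ρ i
  ⟦ con c  ⟧ᵉ ρ = c
  ⟦ s :+ t ⟧ᵉ ρ = ⟦ s ⟧ᵉ ρ + ⟦ t ⟧ᵉ ρ

  ⟦_⟧ : Form k b → Vec ℕ k → Set
  ⟦ s :≤ t ⟧ ρ = ⟦ s ⟧ᵉ ρ ≤ ⟦ t ⟧ᵉ ρ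
  ⟦ s := t ⟧ ρ = ⟦ s ⟧ᵉ ρ ≡ ⟦ t ⟧ᵉ ρ
  ⟦ :false ⟧ ρ = Absurd
  ⟦ h ⟹ f  ⟧ ρ = ⟦ h ⟧ ρ → ⟦ f ⟧ ρ

  -- The coefficients of the variables, preceded by the constant term.
  Coeffs : ℕ → Set
  Coeffs k = Vec ℕ (suc k)

  unit : Fin k → Vec ℕ k
  unit zero    = 1 ∷ replicate _ 0
  unit (suc i) = 0 ∷ unit i

  coeffs : Expr k → Coeffs k
  coeffs (var i)  = 0 ∷ unit i
  coeffs (con c)  = c ∷ replicate _ 0
  coeffs (s :+ t) = zipWith _+_ (coeffs s) (coeffs t)

  dot : Vec ℕ k → Vec ℕ k → ℕ
  dot []      []      = 0
  dot (c ∷ u) (x ∷ v) = c * x + dot u v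

  dot-0 : (v : Vec ℕ k) → dot (replicate k 0) v ≡ 0
  dot-0 []      = refl
  dot-0 (x ∷ v) = dot-0 v

  dot-unit : (i : Fin k) (v : Vec ℕ k) → dot (unit i) v ≡ lookup v i
  dot-unit zero    (x ∷ v) =
    trans (cong₂ _+_ (ℕ.*-identityˡ x) (dot-0 v)) (ℕ.+-identityʳ x)
  dot-unit (suc i) (x ∷ v) = dot-unit i v

  dot-+ : (u v w : Vec ℕ k) → dot (zipWith _+_ u v) w ≡ dot u w + dot v w
  dot-+ []      []      []      = refl
  dot-+ (a ∷ u) (b ∷ v) (x ∷ w) =
    trans (cong ((a + b) * x +_) (dot-+ u v w)) (rearrange a b x (dot u w) (dot v w))
    where
    rearrange : ∀ a b x c d → (a + b) * x + (c + d) ≡ (a * x + c) + (b * x + d)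
    rearrange = solve-∀

  coeffs-sound : (s : Expr k) (ρ : Vec ℕ k) → ⟦ s ⟧ᵉ ρ ≡ dot (coeffs s) (1 ∷ ρ)
  coeffs-sound (var i)  ρ = sym (dot-unit i ρ)
  coeffs-sound (con c)  ρ =
    sym (trans (cong₂ _+_ (ℕ.*-identityʳ c) (dot-0 ρ)) (ℕ.+-identityʳ c))
  coeffs-sound (s :+ t) ρ =
    trans (cong₂ _+_ (coeffs-sound s ρ) (coeffs-sound t ρ))
          (sym (dot-+ (coeffs s) (coeffs t) (1 ∷ ρ)))

  _≤ᶜ_ _≡ᶜ_ : Vec ℕ k → Vec ℕ k → Bool
  []      ≤ᶜ []      = true
  (a ∷ u) ≤ᶜ (b ∷ v) = (a ℕ.≤ᵇ b) ∧ (u ≤ᶜ v)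

  []      ≡ᶜ []      = true
  (a ∷ u) ≡ᶜ (b ∷ v) = (a ℕ.≡ᵇ b) ∧ (u ≡ᶜ v)

  ≤ᶜ-sound : (u v w : Vec ℕ k) → T (u ≤ᶜ v) → dot u w ≤ dot v w
  ≤ᶜ-sound []      []      []      _ = z≤n
  ≤ᶜ-sound (a ∷ u) (b ∷ v) (x ∷ w) t =
    let p , q = Equivalence.to T-∧ t in
    ℕ.+-mono-≤ (ℕ.*-monoˡ-≤ x (ℕ.≤ᵇ⇒≤ a b p)) (≤ᶜ-sound u v w q)

  ≡ᶜ-sound : (u v w : Vec ℕ k) → T (u ≡ᶜ v) → dot u w ≡ dot v w
  ≡ᶜ-sound []      []      []      _ = refl
  ≡ᶜ-sound (a ∷ u) (b ∷ v) (x ∷ w) t =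
    let p , q = Equivalence.to T-∧ t in
    cong₂ _+_ (cong (_* x) (ℕ.≡ᵇ⇒≡ a b p)) (≡ᶜ-sound u v w q)

  equational : Form k false → Bool
  equational (_ := _) = true
  equational _        = false

  lhs rhs : Form k false → Expr k
  lhs (s :≤ t) = s
  lhs (s := t) = s
  lhs :false   = con 1
  rhs (s :≤ t) = t
  rhs (s := t) = t
  rhs :false   = con 0

  -- L and R are the two sides of the sum of the hypotheses met so far, and
  -- e records whether all of them are equations.
  check : (L R : Expr k) (e : Bool) → Form k b → Bool
  check L R e (h ⟹ f)    = check (L :+ lhs h) (R :+ rhs h) (e ∧ equational h) f
  check L R e f@(_ := _) = e ∧ (coeffs (R :+ lhs f) ≡ᶜ coeffs (L :+ rhs f))
  check L R e f@(_ :≤ _) = coeffs (R :+ lhs f) ≤ᶜ coeffs (L :+ rhs f)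
  check L R e f@:false   = coeffs (R :+ lhs f) ≤ᶜ coeffs (L :+ rhs f)

  Summed : (L R : Expr k) → Bool → Vec ℕ k → Set
  Summed L R e ρ = ⟦ L ⟧ᵉ ρ ≤ ⟦ R ⟧ᵉ ρ × (T e → ⟦ L ⟧ᵉ ρ ≡ ⟦ R ⟧ᵉ ρ)

  cancel-≤ : ∀ {a b u v} → a ≤ b → b + u ≤ a + v → u ≤ v
  cancel-≤ {a} {b} {u} {v} p q = ℕ.+-cancelˡ-≤ a u v (ℕ.≤-trans (ℕ.+-monoˡ-≤ u p) q)

  module _ (ρ : Vec ℕ k) where

    sums-≤ : (s t : Expr k) → T (coeffs s ≤ᶜ coeffs t) → ⟦ s ⟧ᵉ ρ ≤ ⟦ t ⟧ᵉ ρ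
    sums-≤ s t c = subst₂ _≤_ (sym (coeffs-sound s ρ)) (sym (coeffs-sound t ρ))
      (≤ᶜ-sound (coeffs s) (coeffs t) (1 ∷ ρ) c)

    sums-≡ : (s t : Expr k) → T (coeffs s ≡ᶜ coeffs t) → ⟦ s ⟧ᵉ ρ ≡ ⟦ t ⟧ᵉ ρ
    sums-≡ s t c = trans (coeffs-sound s ρ) (trans
      (≡ᶜ-sound (coeffs s) (coeffs t) (1 ∷ ρ) c) (sym (coeffs-sound t ρ)))

    hyp : (h : Form k false) → ⟦ h ⟧ ρ → Summed (lhs h) (rhs h) (equational h) ρ
    hyp (s :≤ t) p = p , λ ()
    hyp (s := t) p = ℕ.≤-reflexive p , λ _ → p

    sound : ∀ (L R : Expr k) e (f : Form k b) → Summed L R e ρ → T (check L R e f) → ⟦ f ⟧ ρ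
    sound L R e (h ⟹ f) (p , q) c x =
      sound (L :+ lhs h) (R :+ rhs h) (e ∧ equational h) f
        (ℕ.+-mono-≤ p (proj₁ (hyp h x)) ,
         (λ t → let t₁ , t₂ = Equivalence.to T-∧ t in cong₂ _+_ (q t₁) (proj₂ (hyp h x) t₂)))
        c
    sound L R e (s :≤ t) (p , q) c = cancel-≤ p (sums-≤ (R :+ s) (L :+ t) c)
    sound L R e (s := t) (p , q) c =
      let c₁ , c₂ = Equivalence.to T-∧ c
      in ℕ.+-cancelˡ-≡ (⟦ R ⟧ᵉ ρ) _ _
           (trans (sums-≡ (R :+ s) (L :+ t) c₂) (cong (_+ ⟦ t ⟧ᵉ ρ) (q c₁)))
    sound L R e :false (p , q) c =
      ℕ.<-irrefl refl (cancel-≤ p (sums-≤ (R :+ con 1) (L :+ con 0) c))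

  solve : ∀ k (f : N-ary k (Expr k) (Form k b))
           {_ : T (check (con 0) (con 0) true (f $ⁿ map var (allFin k)))} →
           ∀ⁿ k (curryⁿ (⟦ f $ⁿ map var (allFin k) ⟧))
  solve k f {valid} = introⁿᵉ k
    (λ ρ → sound ρ (con 0) (con 0) true (f $ⁿ map var (allFin k)) (z≤n , λ _ → refl) valid)

open SetSolver using (_:∩_; _:∪_; _:─_; :⊥; _:⊑_; _:≡_; _⇒_) renaming (solve to sets)
open LinearSolver using (con; _:+_; _:≤_; _:=_; :false; _⟹_) renaming (solve to linear)

-- Finite sets and ranks

module _ where

  private
    variable
      x y : Fin n
      X Y Z A B : Subset n

  ⊑-refl : X ⊑ X
  ⊑-refl = ⊆⇒⊑ id

  ⊑-trans : X ⊑ Y → Y ⊑ Z → X ⊑ Z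
  ⊑-trans p q = ⊆⇒⊑ (⊑⇒⊆ q ∘ ⊑⇒⊆ p)

  -- Elements are handled as singletons, so that membership is an inclusion.

  ∈⇒⊑ : x ∈ X → ⁅ x ⁆ ⊑ X
  ∈⇒⊑ {x = x} {X} x∈X = ⊆⇒⊑ λ z∈ → subst (_∈ X) (sym (x∈⁅y⁆⇒x≡y x z∈)) x∈X

  ⊑⇒∈ : ⁅ x ⁆ ⊑ X → x ∈ X
  ⊑⇒∈ {x = x} p = ⊑⇒⊆ p (x∈⁅x⁆ x)

  ∉⇒⊑ : x ∉ X → ⁅ x ⁆ ∩ X ⊑ ⊥
  ∉⇒⊑ {x = x} {X} x∉X = ⊆⇒⊑ λ z∈ →
    let a , b = x∈p∩q⁻ ⁅ x ⁆ X z∈ in ⊥-elim (x∉X (subst (_∈ X) (x∈⁅y⁆⇒x≡y x a) b))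

  ∈-or-∉ : ∀ (x : Fin n) X → ⁅ x ⁆ ⊑ X ⊎ ⁅ x ⁆ ∩ X ⊑ ⊥
  ∈-or-∉ x X with x ∈? X
  ... | yes x∈X = inj₁ (∈⇒⊑ x∈X)
  ... | no  x∉X = inj₂ (∉⇒⊑ x∉X)

  ⁅⁆⋢⊥ : ¬ ⁅ x ⁆ ⊑ ⊥
  ⁅⁆⋢⊥ = ∉⊥ ∘ ⊑⇒∈

  ≢⇒disjoint : x ≢ y → ⁅ x ⁆ ∩ ⁅ y ⁆ ⊑ ⊥
  ≢⇒disjoint {y = y} x≢y = ∉⇒⊑ (x≢y ∘ x∈⁅y⁆⇒x≡y y)

  disjoint⇒≢ : ⁅ x ⁆ ∩ ⁅ y ⁆ ⊑ ⊥ → x ≢ y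
  disjoint⇒≢ {x = x} p refl = ⁅⁆⋢⊥ {x = x} (sets 1 (λ x → x :∩ x :⊑ :⊥ ⇒ x :⊑ :⊥) p)

  separated⇒≢ : ⁅ x ⁆ ⊑ X → ⁅ y ⁆ ∩ X ⊑ ⊥ → x ≢ y
  separated⇒≢ p q = disjoint⇒≢ (sets 3 (λ x y X → x :⊑ X ⇒ y :∩ X :⊑ :⊥ ⇒ x :∩ y :⊑ :⊥) p q)

  nonempty-or-⊑⊥ : (X : Subset n) → (∃[ x ] ⁅ x ⁆ ⊑ X) ⊎ X ⊑ ⊥
  nonempty-or-⊑⊥ X with nonempty? X
  ... | yes (x , x∈X) = inj₁ (x , ∈⇒⊑ x∈X)
  ... | no  ¬ne       = inj₂ (⊆⇒⊑ λ x∈X → ⊥-elim (¬ne (_ , x∈X)))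

  ≡-≤-trans : ∀ {a b c : ℕ} → a ≡ b → b ≤ c → a ≤ c
  ≡-≤-trans p = ℕ.≤-trans (ℕ.≤-reflexive p)

  ≤-≡-trans : ∀ {a b c : ℕ} → a ≤ b → b ≡ c → a ≤ c
  ≤-≡-trans p q = ℕ.≤-trans p (ℕ.≤-reflexive q)

  ∣∪∣+∣∩∣ : (X Y : Subset n) → ∣ X ∪ Y ∣ + ∣ X ∩ Y ∣ ≡ ∣ X ∣ + ∣ Y ∣
  ∣∪∣+∣∩∣ []          []          = refl
  ∣∪∣+∣∩∣ (true ∷ X)  (true ∷ Y)  =
    cong suc (trans (ℕ.+-suc _ _) (trans (cong suc (∣∪∣+∣∩∣ X Y)) (sym (ℕ.+-suc _ _))))
  ∣∪∣+∣∩∣ (true ∷ X)  (false ∷ Y) = cong suc (∣∪∣+∣∩∣ X Y)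
  ∣∪∣+∣∩∣ (false ∷ X) (true ∷ Y)  = trans (cong suc (∣∪∣+∣∩∣ X Y)) (sym (ℕ.+-suc _ _))
  ∣∪∣+∣∩∣ (false ∷ X) (false ∷ Y) = ∣∪∣+∣∩∣ X Y

  card-mono : X ⊑ Y → ∣ X ∣ ≤ ∣ Y ∣
  card-mono p = p⊆q⇒∣p∣≤∣q∣ (⊑⇒⊆ p)

  card-cover : (Y Z : Subset n) → X ⊑ Y ∪ Z → ∣ X ∣ ≤ ∣ Y ∣ + ∣ Z ∣
  card-cover Y Z p =
    linear 5 (λ x u i y z → x :≤ u ⟹ u :+ i := y :+ z ⟹ x :≤ y :+ z)
      _ _ _ ∣ Y ∣ ∣ Z ∣ (card-mono p) (∣∪∣+∣∩∣ Y Z)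

  ∣⊑⊥∣ : X ⊑ ⊥ → ∣ X ∣ ≤ 0
  ∣⊑⊥∣ {n} p = ≤-≡-trans (card-mono p) (∣⊥∣≡0 n)

  card-disjoint : Y ∪ Z ⊑ X → Y ∩ Z ⊑ ⊥ → ∣ Y ∣ + ∣ Z ∣ ≤ ∣ X ∣
  card-disjoint {Y = Y} {Z} {X} p q =
    linear 5 (λ x u i y z → y :+ z := u :+ i ⟹ u :≤ x ⟹ i :≤ con 0 ⟹ y :+ z :≤ x)
      _ _ _ ∣ Y ∣ ∣ Z ∣ (sym (∣∪∣+∣∩∣ Y Z)) (card-mono p) (∣⊑⊥∣ q)

  ∣⁅⁆∣ : ∣ ⁅ x ⁆ ∣ ≡ 1
  ∣⁅⁆∣ {x = x} = ∣⁅x⁆∣≡1 x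

  card-≥1 : ⁅ x ⁆ ⊑ X → 1 ≤ ∣ X ∣
  card-≥1 {x = x} p = ≡-≤-trans (sym (∣⁅⁆∣ {x = x})) (card-mono p)

  card-≥2 : x ≢ y → ⁅ x ⁆ ⊑ X → ⁅ y ⁆ ⊑ X → 2 ≤ ∣ X ∣
  card-≥2 {x = x} {y} {X} x≢y p q = ≡-≤-trans (sym (cong₂ _+_ (∣⁅⁆∣ {x = x}) (∣⁅⁆∣ {x = y})))
    (card-disjoint (sets 3 (λ x y X → x :⊑ X ⇒ y :⊑ X ⇒ x :∪ y :⊑ X) p q) (≢⇒disjoint x≢y))

  ≥1⇒element : 1 ≤ ∣ X ∣ → ∃[ x ] ⁅ x ⁆ ⊑ X
  ≥1⇒element {X = X} p with nonempty-or-⊑⊥ X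
  ... | inj₁ e = e
  ... | inj₂ q = ⊥-elim (ℕ.<⇒≱ p (∣⊑⊥∣ q))

  ≤1⇒⊑⁅⁆ : ∣ X ∣ ≤ 1 → ⁅ x ⁆ ⊑ X → X ⊑ ⁅ x ⁆
  ≤1⇒⊑⁅⁆ {X = X} {x} p q with nonempty-or-⊑⊥ (X ─ ⁅ x ⁆)
  ... | inj₂ r = sets 2 (λ X x → X :─ x :⊑ :⊥ ⇒ X :⊑ x) r
  ... | inj₁ (y , r) = ⊥-elim (ℕ.<⇒≱ (card-≥2
          (separated⇒≢ {X = X ─ ⁅ x ⁆} r (sets 2 (λ X x → x :∩ (X :─ x) :⊑ :⊥)))
          (sets 3 (λ X x y → y :⊑ X :─ x ⇒ y :⊑ X) r) q) p)

  card-pair-≤ : (x y : Fin n) → ∣ ⁅ x ⁆ ∪ ⁅ y ⁆ ∣ ≤ 2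
  card-pair-≤ x y = ≤-≡-trans (card-cover ⁅ x ⁆ ⁅ y ⁆ ⊑-refl)
    (cong₂ _+_ (∣⁅⁆∣ {x = x}) (∣⁅⁆∣ {x = y}))

  card-strict : X ⊑ Y → ⁅ x ⁆ ⊑ Y → ⁅ x ⁆ ∩ X ⊑ ⊥ → suc ∣ X ∣ ≤ ∣ Y ∣
  card-strict {X = X} {Y} {x} X⊑Y x⊑Y x∩X = ≡-≤-trans (sym (cong (_+ ∣ X ∣) (∣⁅⁆∣ {x = x})))
    (card-disjoint (sets 3 (λ X Y x → X :⊑ Y ⇒ x :⊑ Y ⇒ x :∪ X :⊑ Y) X⊑Y x⊑Y) x∩X)

  rank-⊑ : (M : Matroid n) → X ⊑ Y → r M X ≤ r M Y
  rank-⊑ M p = rank-mono M (⊑⇒⊆ p)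

  submod : (M : Matroid n) (X Y : Subset n) → A ⊑ X ∪ Y → B ⊑ X ∩ Y →
           r M A + r M B ≤ r M X + r M Y
  submod M X Y p q = ℕ.≤-trans (ℕ.+-mono-≤ (rank-⊑ M p) (rank-⊑ M q)) (rank-submod M X Y)

  rank-cover : (M : Matroid n) (X Y : Subset n) → A ⊑ X ∪ Y → r M A ≤ r M X + r M Y
  rank-cover M X Y p = ℕ.≤-trans (ℕ.m≤m+n _ _)
    (submod M X Y p ⊑-refl)

  rank-≤ρ : (M : Matroid n) (X : Subset n) → r M X ≤ r M (E M)
  rank-≤ρ M X = ≡-≤-trans (sym (rank-ground M X)) (rank-⊑ M (sets 2 (λ X E → X :∩ E :⊑ E)))

  rank-⊥ : (M : Matroid n) → X ⊑ ⊥ → r M X ≡ 0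
  rank-⊥ M p = ℕ.n≤0⇒n≡0 (ℕ.≤-trans (rank-card M _) (∣⊑⊥∣ p))

  rank-⁅⁆ : (M : Matroid n) (x : Fin n) → r M ⁅ x ⁆ ≤ 1
  rank-⁅⁆ M x = ≤-≡-trans (rank-card M ⁅ x ⁆) (∣⁅⁆∣ {x = x})

  rank-insert : (M : Matroid n) (X : Subset n) (x : Fin n) → r M (X ∪ ⁅ x ⁆) ≤ r M X + 1
  rank-insert M X x = ℕ.≤-trans (rank-cover M X ⁅ x ⁆ ⊑-refl)
    (ℕ.+-monoʳ-≤ _ (rank-⁅⁆ M x))

  spanned-mono : (M : Matroid n) (x : Fin n) → r M (X ∪ ⁅ x ⁆) ≤ r M X → X ⊑ Y →
                 r M (Y ∪ ⁅ x ⁆) ≤ r M Y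
  spanned-mono {X = X} {Y = Y} M x p q =
    linear 4 (λ a b c d → a :+ b :≤ c :+ d ⟹ c :≤ b ⟹ a :≤ d)
      (r M (Y ∪ ⁅ x ⁆)) (r M X) (r M (X ∪ ⁅ x ⁆)) (r M Y)
      (submod M (X ∪ ⁅ x ⁆) Y
        (sets 3 (λ X Y x → Y :∪ x :⊑ (X :∪ x) :∪ Y))
        (sets 3 (λ X Y x → X :⊑ Y ⇒ X :⊑ (X :∪ x) :∩ Y) q)) p

  separation-bound : ∀ (M : Matroid n) → Connected 3 M → ∀ k → 1 ≤ k → k ℕ.< 3 →
    ∀ {A B X Y} → A ⊑ X ∩ E M → B ⊑ Y ∩ E M → A ∩ B ⊑ ⊥ → E M ⊑ X ∪ Y →
    k ≤ ∣ A ∣ → k ≤ ∣ B ∣ → r M (E M) + k ≤ r M X + r M Y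
  separation-bound M conn k 1≤k k<3 {A} {B} {X} {Y} A⊑ B⊑ disj cover k≤A k≤B =
    ℕ.≮⇒≥ λ small → conn k 1≤k k<3 U
      ( ⊑⇒⊆ (sets 3 (λ X E B → (X :∩ E) :─ B :⊑ E))
      , ℕ.m<n+o⇒m∸n<o _ (r M (E M)) {{ℕ.>-nonZero 1≤k}} (ℕ.≤-<-trans (ℕ.+-mono-≤
          (rank-⊑ M (sets 3 (λ X E B → (X :∩ E) :─ B :⊑ X)))
          (rank-⊑ M (sets 4 (λ X E B Y → E :⊑ X :∪ Y ⇒ B :⊑ Y :∩ E ⇒
                                          E :─ ((X :∩ E) :─ B) :⊑ Y) cover B⊑))) small)
      , ℕ.≤-trans k≤A (card-mono (sets 4 (λ A X E B → A :⊑ X :∩ E ⇒ A :∩ B :⊑ :⊥ ⇒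
                                          A :⊑ (X :∩ E) :─ B) A⊑ disj))
      , ℕ.≤-trans k≤B (card-mono (sets 4 (λ Y X E B → B :⊑ Y :∩ E ⇒
                                          B :⊑ E :─ ((X :∩ E) :─ B)) B⊑)) )
    where
    U = (X ∩ E M) ─ B

  connected-intro : (M : Matroid n) →
    (∀ k → 1 ≤ k → k ℕ.< 3 → ∀ X → X ⊑ E M → k ≤ ∣ X ∣ → k ≤ ∣ E M ─ X ∣ →
     r M (E M) + k ≤ r M X + r M (E M ─ X)) →
    Connected 3 M
  connected-intro M bound k 1≤k k<3 X (X⊆E , small , k≤X , k≤Y) =
    ℕ.<⇒≱ small (ℕ.m+n≤o⇒m≤o∸n k (≡-≤-trans (ℕ.+-comm k _) (bound k 1≤k k<3 X (⊆⇒⊑ X⊆E) k≤X k≤Y)))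

-- Minors and vertical separations

record IsMinor (K L : Matroid n) (T : Subset n) : Set where
  field
    ground   : E L ⊑ E K
    contract : T ⊑ E K
    disjoint : E L ∩ T ⊑ ⊥
    rank     : ∀ {Z} → Z ⊑ E L → r L Z + r K T ≡ r K (Z ∪ T)

minor-exists : (K : Matroid n) (T F : Subset n) → F ⊑ E K → T ⊑ E K → F ∩ T ⊑ ⊥ →
               ∃[ L ] (E L ≡ F × IsMinor K L T)
minor-exists K T F F⊑ T⊑ F∩T = K ／ T ＼ (E K ─ F) , eq , record
  { ground   = subst (_⊑ E K) (sym eq) F⊑
  ; contract = T⊑
  ; disjoint = subst (λ U → U ∩ T ⊑ ⊥) (sym eq) F∩T
  ; rank     = λ {Z} Z⊑ → trans
      (ℕ.m∸n+n≡m (rank-⊑ K (sets 2 (λ A T → T :⊑ A :∪ T))))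
      (cong (λ U → r K (U ∪ T)) (sets 2 (λ Z F → Z :⊑ F ⇒ Z :∩ F :≡ Z) Z⊑))
  }
  where
  eq : (E K ─ T) ─ (E K ─ F) ≡ F
  eq = sets 3 (λ F T E → F :⊑ E ⇒ F :∩ T :⊑ :⊥ ⇒ (E :─ T) :─ (E :─ F) :≡ F) F⊑ F∩T

record Renamed (L L′ : Matroid n) (F : Subset n) (e e′ : Fin n) : Set where
  field
    ground  : E L ≡ F ∪ ⁅ e ⁆
    ground′ : E L′ ≡ F ∪ ⁅ e′ ⁆
    e∉F     : ⁅ e ⁆ ∩ F ⊑ ⊥
    e′∉F    : ⁅ e′ ⁆ ∩ F ⊑ ⊥
    without : ∀ {Z} → Z ⊑ F → r L Z ≡ r L′ Z
    with-e  : ∀ {Z} → Z ⊑ F → r L (Z ∪ ⁅ e ⁆) ≡ r L′ (Z ∪ ⁅ e′ ⁆)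

-- (P , x , Q) is a vertical 3-separation of a 3-connected matroid M exactly
-- if (P , Q) is a vertical 2-separation of M ／ ⁅ x ⁆.
record Vertical (M : Matroid n) (x : Fin n) (P Q : Subset n) : Set where
  field
    x∈    : ⁅ x ⁆ ⊑ E M
    P⊑    : P ⊑ E M
    Q⊑    : Q ⊑ E M
    cover : E M ⊑ P ∪ ⁅ x ⁆ ∪ Q
    P∩Q   : P ∩ Q ⊑ ⊥
    x∉P   : ⁅ x ⁆ ∩ P ⊑ ⊥
    x∉Q   : ⁅ x ⁆ ∩ Q ⊑ ⊥
    rP    : 3 ≤ r M (P ∪ ⁅ x ⁆)
    rQ    : 3 ≤ r M (Q ∪ ⁅ x ⁆)
    sum   : r M (P ∪ ⁅ x ⁆) + r M (Q ∪ ⁅ x ⁆) ≤ r M (E M) + 2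

vertical-sym : ∀ {M : Matroid n} {x P Q} → Vertical M x P Q → Vertical M x Q P
vertical-sym {M = M} {x} {P} {Q} v = record
  { x∈ = x∈ ; P⊑ = Q⊑ ; Q⊑ = P⊑
  ; cover = sets 4 (λ E P x Q → E :⊑ P :∪ x :∪ Q ⇒ E :⊑ Q :∪ x :∪ P) cover
  ; P∩Q = sets 2 (λ P Q → P :∩ Q :⊑ :⊥ ⇒ Q :∩ P :⊑ :⊥) P∩Q
  ; x∉P = x∉Q ; x∉Q = x∉P ; rP = rQ ; rQ = rP
  ; sum = ≡-≤-trans (ℕ.+-comm (r M (Q ∪ ⁅ x ⁆)) _) sum }
  where open Vertical v

last-moment : ∀ {n} {S : Subset n → Set} → (∀ A → Dec (S A)) → ∀ {A X} → A ⊑ X → S A → ¬ S X →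
       ∃[ A′ ] ∃[ e ] (A ⊑ A′ × A′ ∪ ⁅ e ⁆ ⊑ X × ⁅ e ⁆ ∩ A′ ⊑ ⊥ × S A′ × ¬ S (A′ ∪ ⁅ e ⁆))
last-moment {n} {S} S? {A₀} {X} A₀⊑X sA₀ ¬sX = go (∣ X ─ A₀ ∣) ℕ.≤-refl ⊑-refl A₀⊑X sA₀
  where
  go : ∀ k {A} → ∣ X ─ A ∣ ≤ k → A₀ ⊑ A → A ⊑ X → S A →
       ∃[ A′ ] ∃[ e ] (A₀ ⊑ A′ × A′ ∪ ⁅ e ⁆ ⊑ X × ⁅ e ⁆ ∩ A′ ⊑ ⊥ × S A′ × ¬ S (A′ ∪ ⁅ e ⁆))
  go k {A} bound A₀⊑A A⊑X sA with nonempty-or-⊑⊥ (X ─ A)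
  ... | inj₂ none = ⊥-elim (¬sX (subst S (⊑-antisym A⊑X
          (sets 2 (λ X A → X :─ A :⊑ :⊥ ⇒ X :⊑ A) none)) sA))
  ... | inj₁ (e , e∈) with S? (A ∪ ⁅ e ⁆)
  ...   | no ¬s = A , e , A₀⊑A
          , sets 3 (λ A e X → A :⊑ X ⇒ e :⊑ X :─ A ⇒ A :∪ e :⊑ X) A⊑X e∈
          , sets 3 (λ A e X → e :⊑ X :─ A ⇒ e :∩ A :⊑ :⊥) e∈ , sA , ¬s
  ...   | yes s with k
  ...     | zero   = ⊥-elim (ℕ.<⇒≱ (card-≥1 e∈) bound)
  ...     | suc k′ = go k′
              (ℕ.≤-pred (ℕ.≤-trans (card-strict
                  (sets 3 (λ X A e → X :─ (A :∪ e) :⊑ X :─ A) {_} {X} {A} {⁅ e ⁆}) e∈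
                  (sets 3 (λ X A e → e :∩ (X :─ (A :∪ e)) :⊑ :⊥))) bound))
              (sets 3 (λ A₀ A e → A₀ :⊑ A ⇒ A₀ :⊑ A :∪ e) A₀⊑A)
              (sets 3 (λ A e X → A :⊑ X ⇒ e :⊑ X :─ A ⇒ A :∪ e :⊑ X) A⊑X e∈) s

-- For a vertical 3-separation (X , x₀ , Y) of M the matroid M ／ ⁅ x₀ ⁆ is a
-- 2-sum.  A set A ⊆ X is skew if contracting A keeps the Y-part of this 2-sum.
module TwoSum {m} (M : Matroid m) {x₀ X Y} (v : Vertical M x₀ X Y) (r₀ : 1 ≤ r M ⁅ x₀ ⁆) where
  open Vertical v

  Y₀ X₀ : Subset m
  Y₀ = Y ∪ ⁅ x₀ ⁆
  X₀ = X ∪ ⁅ x₀ ⁆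

  Skew : Subset m → Set
  Skew A = r M (A ∪ ⁅ x₀ ⁆) + r M Y₀ ≤ r M (A ∪ Y₀) + 1

  skew? : ∀ A → Dec (Skew A)
  skew? A = _ ℕ.≤? _

  ¬skew⇒ : ∀ {A} → ¬ Skew A → r M (A ∪ Y₀) + 2 ≤ r M (A ∪ ⁅ x₀ ⁆) + r M Y₀
  ¬skew⇒ ¬s = ≡-≤-trans (ℕ.+-suc _ 1) (ℕ.≰⇒> ¬s)

  skew-rank : ∀ {A S} → A ⊑ X → ⁅ x₀ ⁆ ⊑ S → S ⊑ Y₀ → Skew A →
              r M (A ∪ S) + 1 ≡ r M S + r M (A ∪ ⁅ x₀ ⁆)
  skew-rank {A} {S} A⊑ x₀⊑ S⊑ skew = ℕ.≤-antisym
    (linear 4 (λ as x ax s → as :+ x :≤ ax :+ s ⟹ con 1 :≤ x ⟹ as :+ con 1 :≤ s :+ ax)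
      _ _ (r M (A ∪ ⁅ x₀ ⁆)) (r M S)
      (submod M (A ∪ ⁅ x₀ ⁆) S (sets 3 (λ A S x → A :∪ S :⊑ (A :∪ x) :∪ S))
        (sets 3 (λ A S x → x :⊑ S ⇒ x :⊑ (A :∪ x) :∩ S) x₀⊑)) r₀)
    (linear 5 (λ as ay ax s y → ay :+ s :≤ as :+ y ⟹ ax :+ y :≤ ay :+ con 1 ⟹
                 s :+ ax :≤ as :+ con 1)
      (r M (A ∪ S)) (r M (A ∪ Y₀)) (r M (A ∪ ⁅ x₀ ⁆)) (r M S) (r M Y₀)
      (submod M (A ∪ S) Y₀ (sets 3 (λ A S Y → A :∪ Y :⊑ (A :∪ S) :∪ Y))
        (sets 3 (λ A S Y → S :⊑ Y ⇒ S :⊑ (A :∪ S) :∩ Y) S⊑)) skew)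

  nonskew-rank : ∀ {A S} → A ⊑ X → ⁅ x₀ ⁆ ⊑ S → S ⊑ Y₀ → ¬ Skew A →
                 r M (A ∪ S) + r M X₀ ≡ r M (X ∪ S) + r M (A ∪ ⁅ x₀ ⁆)
  nonskew-rank {A} {S} A⊑ x₀⊑ S⊑ ¬skew = ℕ.≤-antisym
    (linear 7 (λ as xs ay ax y x₀ ρ → ρ :+ as :≤ xs :+ ay ⟹ ay :+ con 2 :≤ ax :+ y ⟹
                 x₀ :+ y :≤ ρ :+ con 2 ⟹ as :+ x₀ :≤ xs :+ ax)
      (r M (A ∪ S)) (r M (X ∪ S)) (r M (A ∪ Y₀)) (r M (A ∪ ⁅ x₀ ⁆)) (r M Y₀) (r M X₀) (r M (E M))
      (submod M (X ∪ S) (A ∪ Y₀)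
        (sets 6 (λ E X x Y S A → E :⊑ X :∪ x :∪ Y ⇒ E :⊑ (X :∪ S) :∪ (A :∪ (Y :∪ x))) cover)
        (sets 4 (λ A X S Y₀ → A :⊑ X ⇒ S :⊑ Y₀ ⇒ A :∪ S :⊑ (X :∪ S) :∩ (A :∪ Y₀))
          A⊑ S⊑))
      (¬skew⇒ ¬skew) sum)
    (submod M (A ∪ S) X₀
      (sets 4 (λ A S X x → X :∪ S :⊑ (A :∪ S) :∪ (X :∪ x)))
      (sets 4 (λ A S X x → A :⊑ X ⇒ x :⊑ S ⇒ A :∪ x :⊑ (A :∪ S) :∩ (X :∪ x)) A⊑ x₀⊑))

  nonskew-mono : ∀ {A B} → A ⊑ B → ¬ Skew A → ¬ Skew B
  nonskew-mono {A} {B} A⊑B ¬sA sB = ¬sA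
    (linear 5 (λ by ax bx ay y → by :+ ax :≤ bx :+ ay ⟹ bx :+ y :≤ by :+ con 1 ⟹
                 ax :+ y :≤ ay :+ con 1)
      (r M (B ∪ Y₀)) (r M (A ∪ ⁅ x₀ ⁆)) (r M (B ∪ ⁅ x₀ ⁆)) (r M (A ∪ Y₀)) (r M Y₀)
      (submod M (B ∪ ⁅ x₀ ⁆) (A ∪ Y₀)
        (sets 4 (λ B x A Y → B :∪ (Y :∪ x) :⊑ (B :∪ x) :∪ (A :∪ (Y :∪ x))))
        (sets 4 (λ B x A Y → A :⊑ B ⇒ A :∪ x :⊑ (B :∪ x) :∩ (A :∪ (Y :∪ x))) A⊑B)) sB)

  skew-insert : ∀ {A e} → Skew A → ¬ Skew (A ∪ ⁅ e ⁆) →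
                r M ((A ∪ ⁅ e ⁆) ∪ ⁅ x₀ ⁆) ≡ r M (A ∪ ⁅ x₀ ⁆) + 1
  skew-insert {A} {e} s ¬s = ℕ.≤-antisym
    (ℕ.≤-trans (rank-⊑ M (sets 3 (λ A e x → (A :∪ e) :∪ x :⊑ (A :∪ x) :∪ e))) (rank-insert M _ e))
    (linear 5 (λ aey ay aex ax y → ay :≤ aey ⟹ aey :+ con 2 :≤ aex :+ y ⟹
                 ax :+ y :≤ ay :+ con 1 ⟹ ax :+ con 1 :≤ aex)
      (r M ((A ∪ ⁅ e ⁆) ∪ Y₀)) (r M (A ∪ Y₀)) (r M ((A ∪ ⁅ e ⁆) ∪ ⁅ x₀ ⁆)) (r M (A ∪ ⁅ x₀ ⁆)) (r M Y₀)
      (rank-⊑ M (sets 3 (λ A e Y → A :∪ Y :⊑ (A :∪ e) :∪ Y))) (¬skew⇒ ¬s) s)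

  module _ {S₁ S₂} (x₀⊑₁ : ⁅ x₀ ⁆ ⊑ S₁) (S₁⊑ : S₁ ⊑ Y₀) (x₀⊑₂ : ⁅ x₀ ⁆ ⊑ S₂) (S₂⊑ : S₂ ⊑ Y₀) where

    skew-shift : ∀ {A} → A ⊑ X → Skew A →
                 r M (A ∪ S₁) + r M S₂ ≡ r M (A ∪ S₂) + r M S₁
    skew-shift {A} A⊑ s = linear 5
      (λ a₁ a₂ s₁ s₂ a → a₁ :+ con 1 := s₁ :+ a ⟹ s₂ :+ a := a₂ :+ con 1 ⟹ a₁ :+ s₂ := a₂ :+ s₁)
      (r M (A ∪ S₁)) (r M (A ∪ S₂)) (r M S₁) (r M S₂) (r M (A ∪ ⁅ x₀ ⁆))
      (skew-rank A⊑ x₀⊑₁ S₁⊑ s) (sym (skew-rank A⊑ x₀⊑₂ S₂⊑ s))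

    nonskew-shift : ∀ {A} → A ⊑ X → ¬ Skew A →
                    r M (A ∪ S₁) + r M (X ∪ S₂) ≡ r M (A ∪ S₂) + r M (X ∪ S₁)
    nonskew-shift {A} A⊑ ¬s = linear 6
      (λ a₁ a₂ s₁ s₂ a x → a₁ :+ x := s₁ :+ a ⟹ s₂ :+ a := a₂ :+ x ⟹ a₁ :+ s₂ := a₂ :+ s₁)
      (r M (A ∪ S₁)) (r M (A ∪ S₂)) (r M (X ∪ S₁)) (r M (X ∪ S₂)) (r M (A ∪ ⁅ x₀ ⁆)) (r M X₀)
      (nonskew-rank A⊑ x₀⊑₁ S₁⊑ ¬s) (sym (nonskew-rank A⊑ x₀⊑₂ S₂⊑ ¬s))

    same-kind-shift : ∀ {A B} → A ⊑ X → B ⊑ X → (Skew A × Skew B) ⊎ (¬ Skew A × ¬ Skew B) →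
                      r M (A ∪ S₁) + r M (B ∪ S₂) ≡ r M (A ∪ S₂) + r M (B ∪ S₁)
    same-kind-shift {A} {B} A⊑ B⊑ (inj₁ (a , b)) = linear 6
      (λ a₁ a₂ b₁ b₂ s₁ s₂ → a₁ :+ s₂ := a₂ :+ s₁ ⟹ b₂ :+ s₁ := b₁ :+ s₂ ⟹ a₁ :+ b₂ := a₂ :+ b₁)
      (r M (A ∪ S₁)) (r M (A ∪ S₂)) (r M (B ∪ S₁)) (r M (B ∪ S₂)) (r M S₁) (r M S₂)
      (skew-shift A⊑ a) (sym (skew-shift B⊑ b))
    same-kind-shift {A} {B} A⊑ B⊑ (inj₂ (a , b)) = linear 6
      (λ a₁ a₂ b₁ b₂ s₁ s₂ → a₁ :+ s₂ := a₂ :+ s₁ ⟹ b₂ :+ s₁ := b₁ :+ s₂ ⟹ a₁ :+ b₂ := a₂ :+ b₁)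
      (r M (A ∪ S₁)) (r M (A ∪ S₂)) (r M (B ∪ S₁)) (r M (B ∪ S₂)) (r M (X ∪ S₁)) (r M (X ∪ S₂))
      (nonskew-shift A⊑ a) (sym (nonskew-shift B⊑ b))

  -- A minor with one element e on the X-side is determined by its Y-side.
  module OneElement {L A e S} (minor : IsMinor M L (A ∪ S)) (A⊑ : A ⊑ X) (e⊑ : ⁅ e ⁆ ⊑ X)
                    (x₀⊑ : ⁅ x₀ ⁆ ⊑ S) (S⊑ : S ⊑ Y₀)
                    (sA : Skew A) (¬sAe : ¬ Skew (A ∪ ⁅ e ⁆)) where

    rank-without : ∀ {Z} → Z ⊑ E L → Z ⊑ Y₀ → r L Z + r M S ≡ r M (Z ∪ S)
    rank-without {Z} Z⊑ Z⊑Y₀ = linear 5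
      (λ l t a s z → l :+ t := a ⟹ a :+ s := t :+ z ⟹ l :+ s := z)
      (r L Z) (r M (A ∪ S)) (r M (A ∪ (Z ∪ S))) (r M S) (r M (Z ∪ S))
      (trans (IsMinor.rank minor Z⊑) (cong (r M) (sets 3 (λ Z A S → Z :∪ (A :∪ S) :≡ A :∪ (Z :∪ S)))))
      (skew-shift (sets 3 (λ x Z S → x :⊑ S ⇒ x :⊑ Z :∪ S) x₀⊑)
                  (sets 3 (λ Z S Y → Z :⊑ Y ⇒ S :⊑ Y ⇒ Z :∪ S :⊑ Y) Z⊑Y₀ S⊑)
                  x₀⊑ S⊑ A⊑ sA)

    rank-with : ∀ {Z} → Z ∪ ⁅ e ⁆ ⊑ E L → Z ⊑ Y₀ →
                r L (Z ∪ ⁅ e ⁆) + (r M S + r M X₀) ≡ r M (X ∪ (Z ∪ S)) + 2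
    rank-with {Z} Ze⊑ Z⊑Y₀ = linear 8
      (λ l t u s ax aex x₀ xs → l :+ t := u ⟹ u :+ x₀ := xs :+ aex ⟹
         aex := ax :+ con 1 ⟹ s :+ ax := t :+ con 1 ⟹ l :+ (s :+ x₀) := xs :+ con 2)
      (r L (Z ∪ ⁅ e ⁆)) (r M (A ∪ S)) (r M ((A ∪ ⁅ e ⁆) ∪ (Z ∪ S))) (r M S) (r M (A ∪ ⁅ x₀ ⁆))
      (r M ((A ∪ ⁅ e ⁆) ∪ ⁅ x₀ ⁆)) (r M X₀) (r M (X ∪ (Z ∪ S)))
      (trans (IsMinor.rank minor Ze⊑)
        (cong (r M) (sets 4 (λ Z A e S → (Z :∪ e) :∪ (A :∪ S) :≡ (A :∪ e) :∪ (Z :∪ S)))))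
      (nonskew-rank (sets 3 (λ A e X → A :⊑ X ⇒ e :⊑ X ⇒ A :∪ e :⊑ X) A⊑ e⊑)
        (sets 3 (λ x Z S → x :⊑ S ⇒ x :⊑ Z :∪ S) x₀⊑)
        (sets 3 (λ Z S Y → Z :⊑ Y ⇒ S :⊑ Y ⇒ Z :∪ S :⊑ Y) Z⊑Y₀ S⊑) ¬sAe)
      (skew-insert sA ¬sAe)
      (sym (skew-rank A⊑ x₀⊑ S⊑ sA))

-- Stands for the class of the matroids isomorphic to N.
record MinorClass (m : ℕ) : Set₁ where
  field
    Member    : Matroid m → Set
    connected : ∀ {L} → Member L → Connected 3 L
    four-elements : ∀ {L} → Member L → 4 ≤ ∣ E L ∣
    rename    : ∀ {L L′ F e e′} → Renamed L L′ F e e′ → Member L → Member L′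

module _ {m} (M : Matroid m) (𝓝 : MinorClass m) where
  open MinorClass 𝓝

  -- As x ∈ T, L is a minor of M ／ ⁅ x ⁆.
  record SmallMinor (x : Fin m) (X : Subset m) : Set where
    field
      {L}    : Matroid m
      {T}    : Subset m
      minor  : IsMinor M L T
      member : Member L
      x∈T    : ⁅ x ⁆ ⊑ T
      small  : ∣ E L ∩ X ∣ ≤ 1

  contract-X : ∀ {x₀ X Y x} → 1 ≤ r M ⁅ x₀ ⁆ → Vertical M x₀ X Y → SmallMinor x₀ X → ⁅ x ⁆ ⊑ X →
               ¬ (r M ((Y ∪ ⁅ x₀ ⁆) ∪ ⁅ x ⁆) ≤ r M (Y ∪ ⁅ x₀ ⁆)) → SmallMinor x X
  contract-X {x₀} {X} {Y} {x} r₀ v sm x⊑ x∉cl = result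
    where
    open Vertical v
    open SmallMinor sm
    open TwoSum M v r₀

    A S : Subset m
    A = T ∩ X
    S = T ∩ Y₀

    A⊑ : A ⊑ X
    A⊑ = sets 2 (λ T X → T :∩ X :⊑ X)
    S⊑ : S ⊑ Y₀
    S⊑ = sets 2 (λ T X → T :∩ X :⊑ X)
    S⊑T : S ⊑ T
    S⊑T = sets 2 (λ T X → T :∩ X :⊑ T)
    x₀⊑S : ⁅ x₀ ⁆ ⊑ S
    x₀⊑S = sets 3 (λ T Y x → x :⊑ T ⇒ x :⊑ T :∩ (Y :∪ x)) x∈T
    X⊑ : X ⊑ E M
    X⊑ = P⊑
    X∩S : X ∩ S ⊑ ⊥
    X∩S = sets 4 (λ X Y x T → X :∩ Y :⊑ :⊥ ⇒ x :∩ X :⊑ :⊥ ⇒ X :∩ (T :∩ (Y :∪ x)) :⊑ :⊥) P∩Q x∉P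
    T≡ : T ≡ A ∪ S
    T≡ = sets 5 (λ T E X x Y → T :⊑ E ⇒ E :⊑ X :∪ x :∪ Y ⇒ T :≡ (T :∩ X) :∪ (T :∩ (Y :∪ x)))
           (IsMinor.contract minor) cover
    S⊑E : S ⊑ E M
    S⊑E = sets 3 (λ S T E → S :⊑ T ⇒ T :⊑ E ⇒ S :⊑ E) S⊑T (IsMinor.contract minor)

    minor′ : IsMinor M L (A ∪ S)
    minor′ = subst (IsMinor M L) T≡ minor

    x-skew : Skew ⁅ x ⁆
    x-skew = linear 6 (λ xx₀ x x₀ y xy yx → xx₀ :≤ x :+ x₀ ⟹ x :≤ con 1 ⟹ x₀ :≤ con 1 ⟹
                 con 1 :+ y :≤ yx ⟹ yx :≤ xy ⟹ xx₀ :+ y :≤ xy :+ con 1)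
      _ (r M ⁅ x ⁆) (r M ⁅ x₀ ⁆) (r M Y₀) (r M (⁅ x ⁆ ∪ Y₀)) _
      (rank-cover M _ _ ⊑-refl) (rank-⁅⁆ M x) (rank-⁅⁆ M x₀) (ℕ.≰⇒> x∉cl)
      (rank-⊑ M (sets 2 (λ Y x → Y :∪ x :⊑ x :∪ Y)))

    -- With no element on the X-side, the X-part of T can be exchanged for
    -- any set of the same kind.
    exchange : ∀ B → B ⊑ X → (Skew A × Skew B) ⊎ (¬ Skew A × ¬ Skew B) → E L ∩ X ⊑ ⊥ →
               IsMinor M L (B ∪ S)
    exchange B B⊑ kind none = record
      { ground   = IsMinor.ground minor
      ; contract = sets 4 (λ B X S E → B :⊑ X ⇒ X :⊑ E ⇒ S :⊑ E ⇒ B :∪ S :⊑ E) B⊑ X⊑ S⊑E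
      ; disjoint = sets 5 (λ F X B S T → F :∩ X :⊑ :⊥ ⇒ B :⊑ X ⇒ F :∩ T :⊑ :⊥ ⇒ S :⊑ T ⇒
                           F :∩ (B :∪ S) :⊑ :⊥) none B⊑ (IsMinor.disjoint minor) S⊑T
      ; rank     = λ {Z} Z⊑ → linear 5
          (λ l t u t′ u′ → l :+ t := u ⟹ u :+ t′ := t :+ u′ ⟹ l :+ t′ := u′)
          _ (r M (A ∪ S)) (r M (Z ∪ (A ∪ S))) (r M (B ∪ S)) _
          (IsMinor.rank minor′ Z⊑)
          (trans (cong (λ U → r M U + r M (B ∪ S)) (sets 3 (λ Z A S → Z :∪ (A :∪ S) :≡ A :∪ (Z :∪ S))))
            (trans (same-kind-shift
              (sets 3 (λ x Z S → x :⊑ S ⇒ x :⊑ Z :∪ S) x₀⊑S)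
              (sets 7 (λ Z F X E T Y x → Z :⊑ F ⇒ F :∩ X :⊑ :⊥ ⇒ F :⊑ E ⇒ E :⊑ X :∪ x :∪ Y ⇒
                        Z :∪ (T :∩ (Y :∪ x)) :⊑ Y :∪ x) Z⊑ none (IsMinor.ground minor) cover)
              x₀⊑S S⊑ A⊑ B⊑ kind)
            (cong (λ U → r M (A ∪ S) + r M U) (sets 3 (λ Z B S → B :∪ (Z :∪ S) :≡ Z :∪ (B :∪ S))))))
      }

    no-element : E L ∩ X ⊑ ⊥ → SmallMinor x X
    no-element none with skew? A
    ... | yes s = record
      { minor = exchange ⁅ x ⁆ x⊑ (inj₁ (s , x-skew)) none ; member = member
      ; x∈T = sets 2 (λ x S → x :⊑ x :∪ S) ; small = small }
    ... | no ¬s = record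
      { minor = exchange X ⊑-refl (inj₂ (¬s , nonskew-mono A⊑ ¬s)) none ; member = member
      ; x∈T = sets 3 (λ x X S → x :⊑ X ⇒ x :⊑ X :∪ S) x⊑ ; small = small }

    module _ {e} (e⊑ : ⁅ e ⁆ ⊑ E L ∩ X) where

      F : Subset m
      F = E L ∩ Y₀

      F⊑ : F ⊑ Y₀
      F⊑ = sets 2 (λ T X → T :∩ X :⊑ X)

      e⊑X : ⁅ e ⁆ ⊑ X
      e⊑X = sets 3 (λ e L X → e :⊑ L :∩ X ⇒ e :⊑ X) e⊑

      L-ground : E L ≡ F ∪ ⁅ e ⁆
      L-ground = sets 6 (λ L X Y x e E → L :∩ X :⊑ e ⇒ e :⊑ L :∩ X ⇒ L :⊑ E ⇒ E :⊑ X :∪ x :∪ Y ⇒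
          L :≡ (L :∩ (Y :∪ x)) :∪ e) (≤1⇒⊑⁅⁆ small e⊑) e⊑ (IsMinor.ground minor) cover

      in-L : ∀ {Z} → Z ⊑ F ∪ ⁅ e ⁆ → Z ⊑ E L
      in-L {Z} = subst (Z ⊑_) (sym L-ground)

      F∩X : F ∩ X ⊑ ⊥
      F∩X = sets 4 (λ L Y x X → X :∩ Y :⊑ :⊥ ⇒ x :∩ X :⊑ :⊥ ⇒ (L :∩ (Y :∪ x)) :∩ X :⊑ :⊥) P∩Q x∉P

      disjoint-from-F : ∀ {f} → ⁅ f ⁆ ⊑ X → ⁅ f ⁆ ∩ F ⊑ ⊥
      disjoint-from-F f⊑ = sets 3 (λ f F X → f :⊑ X ⇒ F :∩ X :⊑ :⊥ ⇒ f :∩ F :⊑ :⊥) f⊑ F∩X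

      Ae⊑ : A ∪ ⁅ e ⁆ ⊑ X
      Ae⊑ = sets 3 (λ A e X → A :⊑ X ⇒ e :⊑ X ⇒ A :∪ e :⊑ X) A⊑ e⊑X

      F-nonempty : 1 ≤ ∣ F ∣
      F-nonempty = linear 3 (λ l f e → con 4 :≤ l ⟹ l :≤ f :+ e ⟹ e :≤ con 1 ⟹ con 1 :≤ f)
        _ ∣ F ∣ ∣ ⁅ e ⁆ ∣ (four-elements member) (card-cover F ⁅ e ⁆ (subst (_⊑ F ∪ ⁅ e ⁆) (sym L-ground) ⊑-refl))
        (ℕ.≤-reflexive (∣⁅⁆∣ {x = e}))

      -- Otherwise e would be a loop or a coloop of L.
      different-kinds : ¬ ((Skew A × Skew (A ∪ ⁅ e ⁆)) ⊎ (¬ Skew A × ¬ Skew (A ∪ ⁅ e ⁆)))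
      different-kinds kind = linear 7
        (λ l f e t ft et lt →
           l :+ con 1 :≤ e :+ f ⟹ e :+ t := et ⟹ f :+ t := ft ⟹ lt := l :+ t ⟹
           et :+ ft := t :+ lt ⟹ :false)
        (r L (E L)) (r L F) (r L ⁅ e ⁆) (r M (A ∪ S)) (r M (F ∪ (A ∪ S))) (r M (⁅ e ⁆ ∪ (A ∪ S)))
        (r M (E L ∪ (A ∪ S)))
        (separation-bound L (connected member) 1 (s≤s z≤n) (s≤s (s≤s z≤n)) {A = ⁅ e ⁆} {B = F}
          (sets 3 (λ e L X → e :⊑ L :∩ X ⇒ e :⊑ e :∩ L) e⊑)
          (sets 2 (λ L Y → L :∩ Y :⊑ (L :∩ Y) :∩ L))
          (disjoint-from-F e⊑X)
          (subst (_⊑ ⁅ e ⁆ ∪ F) (sym L-ground) (sets 2 (λ F e → F :∪ e :⊑ e :∪ F)))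
          (card-≥1 {X = ⁅ e ⁆} ⊑-refl) F-nonempty)
        (IsMinor.rank minor′ (in-L (sets 2 (λ F e → e :⊑ F :∪ e))))
        (IsMinor.rank minor′ (in-L (sets 2 (λ F e → F :⊑ F :∪ e))))
        (sym (IsMinor.rank minor′ ⊑-refl))
        (trans (cong₂ (λ U V → r M U + r M V)
                  (sets 3 (λ e A S → e :∪ (A :∪ S) :≡ (A :∪ e) :∪ S))
                  (sets 3 (λ F A S → F :∪ (A :∪ S) :≡ A :∪ (F :∪ S))))
          (trans (ℕ.+-comm (r M ((A ∪ ⁅ e ⁆) ∪ S)) _)
          (trans (same-kind-shift
              (sets 3 (λ x Z S → x :⊑ S ⇒ x :⊑ Z :∪ S) x₀⊑S)
              (sets 3 (λ Z S Y → Z :⊑ Y ⇒ S :⊑ Y ⇒ Z :∪ S :⊑ Y) F⊑ S⊑)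
              x₀⊑S S⊑ A⊑ Ae⊑ kind)
          (cong (λ U → r M (A ∪ S) + r M U)
            (trans (sets 4 (λ e A F S → (A :∪ e) :∪ (F :∪ S) :≡ (F :∪ e) :∪ (A :∪ S)))
                   (cong (_∪ (A ∪ S)) (sym L-ground)))))))

      A-skew : Skew A
      A-skew with skew? A
      ... | yes s = s
      ... | no ¬s = ⊥-elim (different-kinds (inj₂ (¬s , nonskew-mono (sets 2 (λ A e → A :⊑ A :∪ e)) ¬s)))

      Ae-nonskew : ¬ Skew (A ∪ ⁅ e ⁆)
      Ae-nonskew s = different-kinds (inj₁ (A-skew , s))

      one-element : SmallMinor x X
      one-element = from-last-moment
        (last-moment skew? {⁅ x ⁆} {X} x⊑ x-skew (nonskew-mono Ae⊑ Ae-nonskew))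
        where
        from-last-moment : ∃[ A′ ] ∃[ e ] (⁅ x ⁆ ⊑ A′ × A′ ∪ ⁅ e ⁆ ⊑ X × ⁅ e ⁆ ∩ A′ ⊑ ⊥ ×
                                           Skew A′ × ¬ Skew (A′ ∪ ⁅ e ⁆)) → SmallMinor x X
        from-last-moment (A′ , e′ , x⊑A′ , A′e′⊑ , e′∉A′ , A′-skew , A′e′-nonskew) =
          replace (minor-exists M (A′ ∪ S) (F ∪ ⁅ e′ ⁆) ground⊑
            (sets 4 (λ A X S E → A :⊑ X ⇒ X :⊑ E ⇒ S :⊑ E ⇒ A :∪ S :⊑ E) A′⊑ X⊑ S⊑E) disj)
          where
          A′⊑ : A′ ⊑ X
          A′⊑ = sets 3 (λ A e X → A :∪ e :⊑ X ⇒ A :⊑ X) A′e′⊑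
          e′⊑ : ⁅ e′ ⁆ ⊑ X
          e′⊑ = sets 3 (λ A e X → A :∪ e :⊑ X ⇒ e :⊑ X) A′e′⊑
          ground⊑ : F ∪ ⁅ e′ ⁆ ⊑ E M
          ground⊑ = sets 5 (λ L Y e X E → L :⊑ E ⇒ e :⊑ X ⇒ X :⊑ E ⇒ (L :∩ Y) :∪ e :⊑ E)
                      (IsMinor.ground minor) e′⊑ X⊑
          disj : (F ∪ ⁅ e′ ⁆) ∩ (A′ ∪ S) ⊑ ⊥
          disj = sets 7 (λ L e A S X T F → e :⊑ X ⇒ A :⊑ X ⇒ F :∩ X :⊑ :⊥ ⇒ e :∩ A :⊑ :⊥ ⇒
                   X :∩ S :⊑ :⊥ ⇒ F :⊑ L ⇒ S :⊑ T ⇒ L :∩ T :⊑ :⊥ ⇒ (F :∪ e) :∩ (A :∪ S) :⊑ :⊥)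
                   e′⊑ A′⊑ F∩X e′∉A′ X∩S (sets 2 (λ L Y → L :∩ Y :⊑ L)) S⊑T (IsMinor.disjoint minor)

          module _ {L′} (L′-ground : E L′ ≡ F ∪ ⁅ e′ ⁆) (minor″ : IsMinor M L′ (A′ ∪ S)) where
            in-L′ : ∀ {Z} → Z ⊑ F ∪ ⁅ e′ ⁆ → Z ⊑ E L′
            in-L′ {Z} = subst (Z ⊑_) (sym L′-ground)

            module O  = OneElement {L} {A} {e} {S} minor′ A⊑ e⊑X x₀⊑S S⊑ A-skew Ae-nonskew
            module O′ = OneElement {L′} {A′} {e′} {S} minor″ A′⊑ e′⊑ x₀⊑S S⊑ A′-skew A′e′-nonskew

            renamed : Renamed L L′ F e e′
            renamed = record
              { ground = L-ground ; ground′ = L′-ground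
              ; e∉F = disjoint-from-F e⊑X ; e′∉F = disjoint-from-F e′⊑
              ; without = λ {Z} Z⊑ → ℕ.+-cancelʳ-≡ (r M S) _ _
                  (trans (O.rank-without (in-L (sets 3 (λ Z F e → Z :⊑ F ⇒ Z :⊑ F :∪ e) Z⊑))
                           (sets 3 (λ Z F Y → Z :⊑ F ⇒ F :⊑ Y ⇒ Z :⊑ Y) Z⊑ F⊑))
                    (sym (O′.rank-without (in-L′ (sets 3 (λ Z F e → Z :⊑ F ⇒ Z :⊑ F :∪ e) Z⊑))
                           (sets 3 (λ Z F Y → Z :⊑ F ⇒ F :⊑ Y ⇒ Z :⊑ Y) Z⊑ F⊑))))
              ; with-e = λ {Z} Z⊑ → ℕ.+-cancelʳ-≡ (r M S + r M X₀) _ _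
                  (trans (O.rank-with (in-L (sets 3 (λ Z F e → Z :⊑ F ⇒ Z :∪ e :⊑ F :∪ e) Z⊑))
                           (sets 3 (λ Z F Y → Z :⊑ F ⇒ F :⊑ Y ⇒ Z :⊑ Y) Z⊑ F⊑))
                    (sym (O′.rank-with (in-L′ (sets 3 (λ Z F e → Z :⊑ F ⇒ Z :∪ e :⊑ F :∪ e) Z⊑))
                           (sets 3 (λ Z F Y → Z :⊑ F ⇒ F :⊑ Y ⇒ Z :⊑ Y) Z⊑ F⊑)))) }

          replace : ∃[ L′ ] (E L′ ≡ F ∪ ⁅ e′ ⁆ × IsMinor M L′ (A′ ∪ S)) → SmallMinor x X
          replace (L′ , L′-ground , minor″) = record
            { minor = minor″ ; member = rename (renamed L′-ground minor″) member
            ; x∈T = sets 3 (λ x A S → x :⊑ A ⇒ x :⊑ A :∪ S) x⊑A′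
            ; small = ℕ.≤-trans (card-mono (subst (λ U → U ∩ X ⊑ ⁅ e′ ⁆) (sym L′-ground)
                        (sets 3 (λ F e X → F :∩ X :⊑ :⊥ ⇒ (F :∪ e) :∩ X :⊑ e) F∩X)))
                        (ℕ.≤-reflexive (∣⁅⁆∣ {x = e′})) }

    result : SmallMinor x X
    result with nonempty-or-⊑⊥ (E L ∩ X)
    ... | inj₁ (e , e⊑) = one-element e⊑
    ... | inj₂ none     = no-element none

-- 3-connected matroids

vertical? : ∀ {n} (M : Matroid n) {x} → ⁅ x ⁆ ⊑ E M →
            (∃[ P ] ∃[ Q ] Vertical M x P Q) ⊎ (∀ {P Q} → ¬ Vertical M x P Q)
vertical? {n} M {x} x∈ = decide (anySubset? test?)
  where
  Test : Subset n → Set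
  Test P = P ⊆ E M × x ∉ P × 3 ≤ r M (P ∪ ⁅ x ⁆) × 3 ≤ r M ((E M ─ (P ∪ ⁅ x ⁆)) ∪ ⁅ x ⁆) ×
           r M (P ∪ ⁅ x ⁆) + r M ((E M ─ (P ∪ ⁅ x ⁆)) ∪ ⁅ x ⁆) ≤ r M (E M) + 2

  test? : ∀ P → Dec (Test P)
  test? P = (P ⊆? E M) ×-dec ¬? (x ∈? P) ×-dec (3 ℕ.≤? _) ×-dec (3 ℕ.≤? _) ×-dec (_ ℕ.≤? _)

  decide : Dec (∃[ P ] Test P) → (∃[ P ] ∃[ Q ] Vertical M x P Q) ⊎ (∀ {P Q} → ¬ Vertical M x P Q)
  decide (yes (P , P⊆ , x∉P , rP , rQ , sum)) = inj₁ (P , E M ─ (P ∪ ⁅ x ⁆) , record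
    { x∈ = x∈ ; P⊑ = ⊆⇒⊑ P⊆
    ; Q⊑ = sets 2 (λ E P → E :─ P :⊑ E)
    ; cover = sets 3 (λ E P x → E :⊑ P :∪ x :∪ (E :─ (P :∪ x)))
    ; P∩Q = sets 3 (λ E P x → P :∩ (E :─ (P :∪ x)) :⊑ :⊥)
    ; x∉P = ∉⇒⊑ x∉P
    ; x∉Q = sets 3 (λ E P x → x :∩ (E :─ (P :∪ x)) :⊑ :⊥)
    ; rP = rP ; rQ = rQ ; sum = sum })
  decide (no none) = inj₂ λ {P} {Q} v →
    let open Vertical v
        Q≡ : Q ≡ E M ─ (P ∪ ⁅ x ⁆)
        Q≡ = sets 4 (λ E P x Q → Q :⊑ E ⇒ E :⊑ P :∪ x :∪ Q ⇒ P :∩ Q :⊑ :⊥ ⇒ x :∩ Q :⊑ :⊥ ⇒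
                       Q :≡ E :─ (P :∪ x)) Q⊑ cover P∩Q x∉Q
    in none (P , ⊑⇒⊆ P⊑
            , (λ x∈P → ⁅⁆⋢⊥ (sets 2 (λ x P → x :⊑ P ⇒ x :∩ P :⊑ :⊥ ⇒ x :⊑ :⊥) (∈⇒⊑ x∈P) x∉P)) , rP
            , subst (λ U → 3 ≤ r M (U ∪ ⁅ x ⁆)) Q≡ rQ
            , subst (λ U → r M (P ∪ ⁅ x ⁆) + r M (U ∪ ⁅ x ⁆) ≤ r M (E M) + 2) Q≡ sum)

module ThreeConnected {m} (M : Matroid m) (conn : Connected 3 M) (large : 4 ≤ ∣ E M ∣) where

  ρ : ℕ
  ρ = r M (E M)

  separation-bound₁ : ∀ {A B X Y} → A ⊑ X ∩ E M → B ⊑ Y ∩ E M → A ∩ B ⊑ ⊥ → E M ⊑ X ∪ Y →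
                      1 ≤ ∣ A ∣ → 1 ≤ ∣ B ∣ → ρ + 1 ≤ r M X + r M Y
  separation-bound₁ = separation-bound M conn 1 (s≤s z≤n) (s≤s (s≤s z≤n))

  separation-bound₂ : ∀ {A B X Y} → A ⊑ X ∩ E M → B ⊑ Y ∩ E M → A ∩ B ⊑ ⊥ → E M ⊑ X ∪ Y →
                      2 ≤ ∣ A ∣ → 2 ≤ ∣ B ∣ → ρ + 2 ≤ r M X + r M Y
  separation-bound₂ = separation-bound M conn 2 (s≤s z≤n) (s≤s (s≤s (s≤s z≤n)))

  rank-≥1 : ∀ {x} → ⁅ x ⁆ ⊑ E M → 1 ≤ r M ⁅ x ⁆
  rank-≥1 {x} x∈ = linear 3 (λ x ex ρ → ρ :+ con 1 :≤ x :+ ex ⟹ ex :≤ ρ ⟹ con 1 :≤ x)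
    (r M ⁅ x ⁆) (r M (E M ─ ⁅ x ⁆)) ρ
    (separation-bound₁ {A = ⁅ x ⁆} {E M ─ ⁅ x ⁆} (sets 2 (λ x E → x :⊑ E ⇒ x :⊑ x :∩ E) x∈)
      (sets 2 (λ x E → E :─ x :⊑ (E :─ x) :∩ E)) (sets 2 (λ x E → x :∩ (E :─ x) :⊑ :⊥))
      (sets 2 (λ x E → E :⊑ x :∪ (E :─ x))) (card-≥1 {X = ⁅ x ⁆} ⊑-refl)
      (linear 3 (λ e x ex → con 4 :≤ e ⟹ e :≤ x :+ ex ⟹ x :≤ con 1 ⟹ con 1 :≤ ex)
         (∣ E M ∣) (∣ ⁅ x ⁆ ∣) (∣ E M ─ ⁅ x ⁆ ∣) large
         (card-cover ⁅ x ⁆ (E M ─ ⁅ x ⁆) (sets 2 (λ x E → E :⊑ x :∪ (E :─ x)))) (ℕ.≤-reflexive (∣⁅⁆∣ {x = x}))))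
    (rank-≤ρ M _)

  rank-≥2 : ∀ {x y} → x ≢ y → ⁅ x ⁆ ⊑ E M → ⁅ y ⁆ ⊑ E M → 2 ≤ r M (⁅ x ⁆ ∪ ⁅ y ⁆)
  rank-≥2 {x} {y} x≢y x∈ y∈ = linear 3 (λ x ex ρ → ρ :+ con 2 :≤ x :+ ex ⟹ ex :≤ ρ ⟹ con 2 :≤ x)
    (r M XY) (r M (E M ─ XY)) ρ
    (separation-bound₂ {A = XY} {E M ─ XY}
      (sets 3 (λ x y E → x :⊑ E ⇒ y :⊑ E ⇒ x :∪ y :⊑ (x :∪ y) :∩ E) x∈ y∈)
      (sets 2 (λ x E → E :─ x :⊑ (E :─ x) :∩ E)) (sets 2 (λ x E → x :∩ (E :─ x) :⊑ :⊥))
      (sets 2 (λ x E → E :⊑ x :∪ (E :─ x)))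
      (card-≥2 x≢y (sets 2 (λ x y → x :⊑ x :∪ y)) (sets 2 (λ x y → y :⊑ x :∪ y)))
      (linear 3 (λ e x ex → con 4 :≤ e ⟹ e :≤ x :+ ex ⟹ x :≤ con 2 ⟹ con 2 :≤ ex)
         (∣ E M ∣) (∣ XY ∣) (∣ E M ─ XY ∣) large
         (card-cover XY (E M ─ XY) (sets 2 (λ x E → E :⊑ x :∪ (E :─ x)))) (card-pair-≤ x y)))
    (rank-≤ρ M _)
    where
    XY = ⁅ x ⁆ ∪ ⁅ y ⁆

  lines-meeting-twice : ∀ {S S′ x y} → x ≢ y → ⁅ x ⁆ ⊑ E M → ⁅ y ⁆ ⊑ E M →
    ⁅ x ⁆ ∪ ⁅ y ⁆ ⊑ S → ⁅ x ⁆ ∪ ⁅ y ⁆ ⊑ S′ → r M S ≤ 2 → r M S′ ≤ 2 → r M (S ∪ S′) ≤ 2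
  lines-meeting-twice {S} {S′} {x} {y} x≢y x∈ y∈ ⊑S ⊑S′ rS rS′ =
    linear 4 (λ u i s s′ → u :+ i :≤ s :+ s′ ⟹ con 2 :≤ i ⟹ s :≤ con 2 ⟹ s′ :≤ con 2 ⟹ u :≤ con 2)
      _ (r M (⁅ x ⁆ ∪ ⁅ y ⁆)) (r M S) (r M S′)
      (submod M S S′ ⊑-refl (sets 3 (λ p S S′ → p :⊑ S ⇒ p :⊑ S′ ⇒ p :⊑ S :∩ S′) ⊑S ⊑S′))
      (rank-≥2 x≢y x∈ y∈) rS rS′

  module _ {x P Q} (v : Vertical M x P Q) where
    open Vertical v

    card-Px : 3 ≤ ∣ P ∪ ⁅ x ⁆ ∣
    card-Px = ℕ.≤-trans rP (rank-card M _)

    card-Qx : 3 ≤ ∣ Q ∪ ⁅ x ⁆ ∣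
    card-Qx = ℕ.≤-trans rQ (rank-card M _)

    guts : r M (P ∪ ⁅ x ⁆) ≤ r M P
    guts = linear 4 (λ p px qx ρ → ρ :+ con 2 :≤ p :+ qx ⟹ px :+ qx :≤ ρ :+ con 2 ⟹ px :≤ p)
      (r M P) (r M (P ∪ ⁅ x ⁆)) (r M (Q ∪ ⁅ x ⁆)) ρ
      (separation-bound₂ {A = P} {Q ∪ ⁅ x ⁆}
        (sets 2 (λ P E → P :⊑ E ⇒ P :⊑ P :∩ E) P⊑)
        (sets 3 (λ Q x E → Q :⊑ E ⇒ x :⊑ E ⇒ Q :∪ x :⊑ (Q :∪ x) :∩ E) Q⊑ x∈)
        (sets 3 (λ P Q x → P :∩ Q :⊑ :⊥ ⇒ x :∩ P :⊑ :⊥ ⇒ P :∩ (Q :∪ x) :⊑ :⊥) P∩Q x∉P)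
        (sets 4 (λ E P Q x → E :⊑ P :∪ x :∪ Q ⇒ E :⊑ P :∪ (Q :∪ x)) cover)
        (linear 3 (λ u p x → con 3 :≤ u ⟹ u :≤ p :+ x ⟹ x :≤ con 1 ⟹ con 2 :≤ p)
          _ (∣ P ∣) (∣ ⁅ x ⁆ ∣) card-Px (card-cover P ⁅ x ⁆ ⊑-refl) (ℕ.≤-reflexive (∣⁅⁆∣ {x = x})))
        (ℕ.≤-trans (s≤s (s≤s z≤n)) card-Qx))
      sum

    card-P : 3 ≤ ∣ P ∣
    card-P = ℕ.≤-trans rP (ℕ.≤-trans guts (rank-card M P))

    -- If P spans X, then Q ─ X still spans x, which contradicts x ∉ cl (E ─ X).
    not-spanning : ∀ {X} → ⁅ x ⁆ ⊑ X → ¬ (r M ((E M ─ X) ∪ ⁅ x ⁆) ≤ r M (E M ─ X)) →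
                   ¬ (r M (P ∪ X) ≤ r M (P ∪ ⁅ x ⁆))
    not-spanning {X} x⊑X x∉cl spanning = by-size (2 ℕ.≤? ∣ Q′ ∣)
      where
      Q′ : Subset m
      Q′ = Q ─ X

      cover′ : E M ⊑ Q′ ∪ (P ∪ X)
      cover′ = sets 5 (λ E P Q x X → E :⊑ P :∪ x :∪ Q ⇒ x :⊑ X ⇒ E :⊑ (Q :─ X) :∪ (P :∪ X)) cover x⊑X

      Q′⊑ : Q′ ⊑ Q′ ∩ E M
      Q′⊑ = sets 3 (λ Q X E → Q :⊑ E ⇒ Q :─ X :⊑ (Q :─ X) :∩ E) Q⊑

      Px⊑ : P ∪ ⁅ x ⁆ ⊑ (P ∪ X) ∩ E M
      Px⊑ = sets 4 (λ P x X E → P :⊑ E ⇒ x :⊑ X ⇒ x :⊑ E ⇒ P :∪ x :⊑ (P :∪ X) :∩ E) P⊑ x⊑X x∈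

      Q′∩Px : Q′ ∩ (P ∪ ⁅ x ⁆) ⊑ ⊥
      Q′∩Px = sets 4 (λ P Q x X → P :∩ Q :⊑ :⊥ ⇒ x :⊑ X ⇒ (Q :─ X) :∩ (P :∪ x) :⊑ :⊥) P∩Q x⊑X

      too-small : ρ ≤ r M (P ∪ ⁅ x ⁆) → Absurd
      too-small = linear 3 (λ px qx ρ → px :+ qx :≤ ρ :+ con 2 ⟹ con 3 :≤ qx ⟹ ρ :≤ px ⟹ :false)
        (r M (P ∪ ⁅ x ⁆)) (r M (Q ∪ ⁅ x ⁆)) ρ sum rQ

      by-size : Dec (2 ≤ ∣ Q′ ∣) → Absurd
      by-size (yes two) = x∉cl (spanned-mono M x
        (linear 6 (λ q′ qx px px′ q′x ρ → ρ :+ con 2 :≤ q′ :+ px′ ⟹ px′ :≤ px ⟹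
                      px :+ qx :≤ ρ :+ con 2 ⟹ q′x :≤ qx ⟹ q′x :≤ q′)
          (r M Q′) (r M (Q ∪ ⁅ x ⁆)) (r M (P ∪ ⁅ x ⁆)) (r M (P ∪ X)) (r M (Q′ ∪ ⁅ x ⁆)) ρ
          (separation-bound₂ {A = Q′} {P ∪ ⁅ x ⁆} Q′⊑ Px⊑ Q′∩Px cover′ two
            (ℕ.≤-trans (s≤s (s≤s z≤n)) card-Px))
          spanning sum (rank-⊑ M (sets 3 (λ Q X x → (Q :─ X) :∪ x :⊑ Q :∪ x))))
        (sets 3 (λ Q X E → Q :⊑ E ⇒ Q :─ X :⊑ E :─ X) Q⊑))
      by-size (no few) = [ one , none ]′ (nonempty-or-⊑⊥ Q′)
        where
        one : ∃[ q ] ⁅ q ⁆ ⊑ Q′ → Absurd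
        one (q , q⊑) = too-small (linear 4
          (λ q′ px′ px ρ → ρ :+ con 1 :≤ q′ :+ px′ ⟹ q′ :≤ con 1 ⟹ px′ :≤ px ⟹ ρ :≤ px)
          (r M Q′) (r M (P ∪ X)) (r M (P ∪ ⁅ x ⁆)) ρ
          (separation-bound₁ {A = Q′} {P ∪ ⁅ x ⁆} Q′⊑ Px⊑ Q′∩Px cover′ (card-≥1 q⊑)
            (ℕ.≤-trans (s≤s z≤n) card-Px))
          (ℕ.≤-trans (rank-card M Q′) (ℕ.≤-pred (ℕ.≰⇒> few))) spanning)
        none : Q′ ⊑ ⊥ → Absurd
        none empty = too-small (ℕ.≤-trans (rank-⊑ M
          (sets 4 (λ E Q P X → E :⊑ Q :∪ (P :∪ X) ⇒ Q :⊑ :⊥ ⇒ E :⊑ P :∪ X) cover′ empty)) spanning)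

    line-of-plane : ∀ {X X₀ S} → ⁅ x ⁆ ⊑ X → ¬ (r M ((E M ─ X) ∪ ⁅ x ⁆) ≤ r M (E M ─ X)) →
                    X ⊑ X₀ → r M X₀ ≤ 3 → S ⊑ P ∪ ⁅ x ⁆ → S ⊑ X₀ → r M S ≤ 2
    line-of-plane {X} {X₀} {S} x⊑X x∉cl X⊑ plane S⊑Px S⊑X₀ = ℕ.≮⇒≥ λ S-big → not-spanning x⊑X x∉cl
      (linear 4 (λ px′ s px x₀ → px′ :+ s :≤ px :+ x₀ ⟹ con 3 :≤ s ⟹ x₀ :≤ con 3 ⟹ px′ :≤ px)
        (r M (P ∪ X)) (r M S) (r M (P ∪ ⁅ x ⁆)) (r M X₀)
        (submod M (P ∪ ⁅ x ⁆) X₀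
          (sets 4 (λ P x X X₀ → X :⊑ X₀ ⇒ P :∪ X :⊑ (P :∪ x) :∪ X₀) X⊑)
          (sets 3 (λ S Px X₀ → S :⊑ Px ⇒ S :⊑ X₀ ⇒ S :⊑ Px :∩ X₀) S⊑Px S⊑X₀)) S-big plane)

    uncross : ∀ {X} → X ⊑ E M → ⁅ x ⁆ ⊑ X → r M X + r M (E M ─ X) ≤ ρ + 2 →
              2 ≤ ∣ X ∣ → 2 ≤ ∣ Q ─ X ∣ → r M ((P ∩ X) ∪ ⁅ x ⁆) + r M (E M ─ (P ∩ X)) ≤ ρ + 2
    uncross {X} X⊑ x⊑X sumX X≥2 QX≥2 = linear 9
      (λ u px X i w qx ex q ρ → u :+ i :≤ px :+ X ⟹ w :+ q :≤ qx :+ ex ⟹ px :+ qx :≤ ρ :+ con 2 ⟹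
         X :+ ex :≤ ρ :+ con 2 ⟹ ρ :+ con 2 :≤ q :+ u ⟹ i :+ w :≤ ρ :+ con 2)
      (r M (P ∪ X)) (r M (P ∪ ⁅ x ⁆)) (r M X) (r M ((P ∩ X) ∪ ⁅ x ⁆)) (r M (E M ─ (P ∩ X)))
      (r M (Q ∪ ⁅ x ⁆)) (r M (E M ─ X)) (r M (Q ─ X)) ρ
      (submod M (P ∪ ⁅ x ⁆) X (sets 3 (λ P x X → P :∪ X :⊑ (P :∪ x) :∪ X))
        (sets 3 (λ P x X → x :⊑ X ⇒ (P :∩ X) :∪ x :⊑ (P :∪ x) :∩ X) x⊑X))
      (submod M (Q ∪ ⁅ x ⁆) (E M ─ X)
        (sets 5 (λ P Q x X E → E :⊑ P :∪ x :∪ Q ⇒ E :─ (P :∩ X) :⊑ (Q :∪ x) :∪ (E :─ X)) cover)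
        (sets 4 (λ Q x X E → Q :⊑ E ⇒ Q :─ X :⊑ (Q :∪ x) :∩ (E :─ X)) Q⊑))
      sum sumX
      (separation-bound₂ {A = Q ─ X} {X} (sets 3 (λ Q X E → Q :⊑ E ⇒ Q :─ X :⊑ (Q :─ X) :∩ E) Q⊑)
        (sets 3 (λ P X E → X :⊑ E ⇒ X :⊑ (P :∪ X) :∩ E) X⊑) (sets 2 (λ Q X → (Q :─ X) :∩ X :⊑ :⊥))
        (sets 5 (λ E P Q x X → E :⊑ P :∪ x :∪ Q ⇒ x :⊑ X ⇒ E :⊑ (Q :─ X) :∪ (P :∪ X)) cover x⊑X)
        QX≥2 X≥2)

    shrink : ∀ {X} → ⁅ x ⁆ ⊑ X → r M ((P ∩ X) ∪ ⁅ x ⁆) + r M (E M ─ (P ∩ X)) ≤ ρ + 2 →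
             3 ≤ r M ((P ∩ X) ∪ ⁅ x ⁆) → Vertical M x (P ∩ X) (E M ─ ((P ∩ X) ∪ ⁅ x ⁆))
    shrink {X} x⊑X sumZ Z≥3 = record
      { x∈ = x∈ ; P⊑ = sets 3 (λ P X E → P :⊑ E ⇒ P :∩ X :⊑ E) P⊑
      ; Q⊑ = sets 2 (λ E A → E :─ A :⊑ E)
      ; cover = sets 3 (λ E Z x → E :⊑ Z :∪ x :∪ (E :─ (Z :∪ x)))
      ; P∩Q = sets 3 (λ E Z x → Z :∩ (E :─ (Z :∪ x)) :⊑ :⊥)
      ; x∉P = sets 3 (λ x P X → x :∩ P :⊑ :⊥ ⇒ x :∩ (P :∩ X) :⊑ :⊥) x∉P
      ; x∉Q = sets 3 (λ E Z x → x :∩ (E :─ (Z :∪ x)) :⊑ :⊥)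
      ; rP = Z≥3
      ; rQ = ℕ.≤-trans rQ (rank-⊑ M (sets 5 (λ E P Q x X → Q :⊑ E ⇒ P :∩ Q :⊑ :⊥ ⇒
               Q :∪ x :⊑ (E :─ ((P :∩ X) :∪ x)) :∪ x) Q⊑ P∩Q))
      ; sum = ℕ.≤-trans (ℕ.+-monoʳ-≤ _ (rank-⊑ M (sets 4 (λ E P x X → x :⊑ E ⇒ x :∩ P :⊑ :⊥ ⇒
               (E :─ ((P :∩ X) :∪ x)) :∪ x :⊑ E :─ (P :∩ X)) x∈ x∉P))) sumZ }

-- X is a rank-3 cocircuit consisting of a point c and of a line without its
-- element x₀, where x₀ ∉ X.
module LineAndPoint {m} (M : Matroid m) (conn : Connected 3 M) (large : 4 ≤ ∣ E M ∣)
  {X Line : Subset m} {c x₀ : Fin m}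
  (coclosed : ∀ {e} → ⁅ e ⁆ ⊑ X → ¬ (r M ((E M ─ X) ∪ ⁅ e ⁆) ≤ r M (E M ─ X)))
  (plane : r M (X ∪ ⁅ x₀ ⁆) ≤ 3) (line : r M Line ≤ 2)
  (X⊑E : X ⊑ E M) (Line⊑ : Line ⊑ X ∪ ⁅ x₀ ⁆) (X⊑ : X ⊑ Line ∪ ⁅ c ⁆) (c∈X : ⁅ c ⁆ ⊑ X)
  (x₀∈E : ⁅ x₀ ⁆ ⊑ E M) (x₀∉X : ⁅ x₀ ⁆ ∩ X ⊑ ⊥) (x₀∈Line : ⁅ x₀ ⁆ ⊑ Line)
  (not-collinear : ∀ {u w} → u ≢ w → ⁅ u ⁆ ⊑ Line → ⁅ w ⁆ ⊑ Line →
                   ¬ (r M (⁅ c ⁆ ∪ ⁅ u ⁆ ∪ ⁅ w ⁆) ≤ 2))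
  where
  open ThreeConnected M conn large

  gap : ∀ {Z e} → Z ⊑ E M ─ X → ⁅ e ⁆ ⊑ X → r M Z + 1 ≤ r M (Z ∪ ⁅ e ⁆)
  gap {Z} {e} Z⊑ e∈ = ≡-≤-trans (ℕ.+-comm _ 1)
    (ℕ.≰⇒> λ spanned → coclosed e∈ (spanned-mono M e spanned Z⊑))

  Line⊑E : Line ⊑ E M
  Line⊑E = sets 4 (λ L X x E → L :⊑ X :∪ x ⇒ X :⊑ E ⇒ x :⊑ E ⇒ L :⊑ E) Line⊑ X⊑E x₀∈E

  off-Line : ∀ {z P Q} → Vertical M z P Q → ⁅ z ⁆ ⊑ Line → ⁅ z ⁆ ⊑ X → ⁅ c ⁆ ⊑ P → P ∩ Line ⊑ ⊥
  off-Line {z} {P} {Q} v z∈L z∈X c∈P = [ impossible , id ]′ (nonempty-or-⊑⊥ (P ∩ Line))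
    where
    open Vertical v
    impossible : ∃[ u ] ⁅ u ⁆ ⊑ P ∩ Line → P ∩ Line ⊑ ⊥
    impossible (u , u∈) = ⊥-elim (not-collinear
      (separated⇒≢ (sets 3 (λ u P L → u :⊑ P :∩ L ⇒ u :⊑ P) u∈) x∉P)
      (sets 3 (λ u P L → u :⊑ P :∩ L ⇒ u :⊑ L) u∈) z∈L
      (line-of-plane v z∈X (coclosed z∈X) (sets 2 (λ X x → X :⊑ X :∪ x)) plane
        (sets 5 (λ c u z P L → c :⊑ P ⇒ u :⊑ P :∩ L ⇒ c :∪ u :∪ z :⊑ P :∪ z) c∈P u∈)
        (sets 7 (λ c u z P L X x → c :⊑ X ⇒ u :⊑ P :∩ L ⇒ L :⊑ X :∪ x ⇒ z :⊑ X ⇒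
                  c :∪ u :∪ z :⊑ X :∪ x) c∈X u∈ Line⊑ z∈X)))

  module Crossing {x a P Q R S} (v : Vertical M x P Q) (w : Vertical M a R S) (x≢a : x ≢ a)
    (x∈L : ⁅ x ⁆ ⊑ Line) (a∈L : ⁅ a ⁆ ⊑ Line) (x∈X : ⁅ x ⁆ ⊑ X) (a∈X : ⁅ a ⁆ ⊑ X)
    (c∈P : ⁅ c ⁆ ⊑ P) (c∈R : ⁅ c ⁆ ⊑ R) where
    module V = Vertical v
    module W′ = Vertical w

    x∩a : ⁅ x ⁆ ∩ ⁅ a ⁆ ⊑ ⊥
    x∩a = ≢⇒disjoint x≢a

    Line⊑Qx : Line ⊑ Q ∪ ⁅ x ⁆
    Line⊑Qx = sets 5 (λ E P Q x L → E :⊑ P :∪ x :∪ Q ⇒ P :∩ L :⊑ :⊥ ⇒ L :⊑ E ⇒ L :⊑ Q :∪ x)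
      V.cover (off-Line v x∈L x∈X c∈P) Line⊑E

    Line⊑Sa : Line ⊑ S ∪ ⁅ a ⁆
    Line⊑Sa = sets 5 (λ E P Q x L → E :⊑ P :∪ x :∪ Q ⇒ P :∩ L :⊑ :⊥ ⇒ L :⊑ E ⇒ L :⊑ Q :∪ x)
      W′.cover (off-Line w a∈L a∈X c∈R) Line⊑E

    x∈S : ⁅ x ⁆ ⊑ S
    x∈S = sets 4 (λ x L S a → x :⊑ L ⇒ L :⊑ S :∪ a ⇒ x :∩ a :⊑ :⊥ ⇒ x :⊑ S) x∈L Line⊑Sa x∩a

    a∈Q : ⁅ a ⁆ ⊑ Q
    a∈Q = sets 4 (λ x L Q a → a :⊑ L ⇒ L :⊑ Q :∪ x ⇒ x :∩ a :⊑ :⊥ ⇒ a :⊑ Q) a∈L Line⊑Qx x∩a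

    gap-PS : r M (P ∩ S) + 1 ≤ r M ((P ∩ S) ∪ ⁅ x ⁆)
    gap-PS = gap (sets 7 (λ P S X c L E R → P :⊑ E ⇒ X :⊑ L :∪ c ⇒ P :∩ L :⊑ :⊥ ⇒ c :⊑ R ⇒ R :∩ S :⊑ :⊥ ⇒
        P :∩ S :⊑ E :─ X) V.P⊑ X⊑ (off-Line v x∈L x∈X c∈P) c∈R W′.P∩Q) x∈X

    gap-QR : r M (Q ∩ R) + 1 ≤ r M ((Q ∩ R) ∪ ⁅ a ⁆)
    gap-QR = gap (sets 7 (λ P S X c L E R → P :⊑ E ⇒ X :⊑ L :∪ c ⇒ P :∩ L :⊑ :⊥ ⇒ c :⊑ R ⇒ R :∩ S :⊑ :⊥ ⇒
        S :∩ P :⊑ E :─ X) W′.P⊑ X⊑ (off-Line w a∈L a∈X c∈R) c∈P V.P∩Q) a∈X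

    crossing-sum : (r M (P ∩ S) + r M (E M ─ (P ∩ S))) + (r M (Q ∩ R) + r M (E M ─ (Q ∩ R)))
                   ≤ ρ + ρ + 2
    crossing-sum = linear 11
      (λ ps psx eps qr qra eqr px qx ra sa ρ →
         eqr :+ psx :≤ px :+ sa ⟹ eps :+ qra :≤ qx :+ ra ⟹ px :+ qx :≤ ρ :+ con 2 ⟹
         ra :+ sa :≤ ρ :+ con 2 ⟹ ps :+ con 1 :≤ psx ⟹ qr :+ con 1 :≤ qra ⟹
         (ps :+ eps) :+ (qr :+ eqr) :≤ ρ :+ ρ :+ con 2)
      (r M (P ∩ S)) (r M ((P ∩ S) ∪ ⁅ x ⁆)) (r M (E M ─ (P ∩ S)))
      (r M (Q ∩ R)) (r M ((Q ∩ R) ∪ ⁅ a ⁆)) (r M (E M ─ (Q ∩ R)))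
      (r M (P ∪ ⁅ x ⁆)) (r M (Q ∪ ⁅ x ⁆)) (r M (R ∪ ⁅ a ⁆)) (r M (S ∪ ⁅ a ⁆)) ρ
      (submod M (P ∪ ⁅ x ⁆) (S ∪ ⁅ a ⁆)
        (sets 7 (λ E P Q x R S a → E :⊑ P :∪ x :∪ Q ⇒ E :⊑ R :∪ a :∪ S ⇒
                  E :─ (Q :∩ R) :⊑ (P :∪ x) :∪ (S :∪ a)) V.cover W′.cover)
        (sets 4 (λ P x S a → x :⊑ S ⇒ (P :∩ S) :∪ x :⊑ (P :∪ x) :∩ (S :∪ a)) x∈S))
      (submod M (Q ∪ ⁅ x ⁆) (R ∪ ⁅ a ⁆)
        (sets 7 (λ E P Q x R S a → E :⊑ P :∪ x :∪ Q ⇒ E :⊑ R :∪ a :∪ S ⇒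
                  E :─ (P :∩ S) :⊑ (Q :∪ x) :∪ (R :∪ a)) V.cover W′.cover)
        (sets 4 (λ Q x R a → a :⊑ Q ⇒ (Q :∩ R) :∪ a :⊑ (Q :∪ x) :∩ (R :∪ a)) a∈Q))
      V.sum W′.sum gap-PS gap-QR

    -- Otherwise W = (Q ∩ S) ─ X, whose complement is spanned by P ∪ R, would
    -- be 2-separating with at least two elements.
    QS⊑Line : 2 ≤ ∣ P ∩ R ∣ → Q ∩ S ⊑ Line
    QS⊑Line PR≥2 = sets 7 (λ Q S X x₀ L c P → (Q :∩ S) :─ X :⊑ x₀ ⇒ x₀ :⊑ L ⇒ X :⊑ L :∪ c ⇒ c :⊑ P ⇒
        P :∩ Q :⊑ :⊥ ⇒ Q :∩ S :⊑ L) (≤1⇒⊑⁅⁆ (ℕ.≤-pred (ℕ.≰⇒> small)) x₀∈W) x₀∈Line X⊑ c∈P V.P∩Q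
      where
      W U : Subset m
      W = (Q ∩ S) ─ X
      U = (P ∪ ⁅ x ⁆) ∪ (R ∪ ⁅ a ⁆)

      x₀∈W : ⁅ x₀ ⁆ ⊑ W
      x₀∈W = sets 7 (λ x₀ L Q x S a X → x₀ :⊑ L ⇒ L :⊑ Q :∪ x ⇒ L :⊑ S :∪ a ⇒ x₀ :∩ X :⊑ :⊥ ⇒
               x :⊑ X ⇒ a :⊑ X ⇒ x₀ :⊑ (Q :∩ S) :─ X) x₀∈Line Line⊑Qx Line⊑Sa x₀∉X x∈X a∈X

      PR-bound : ρ + 2 ≤ r M (P ∩ R) + r M (E M ─ (P ∩ R))
      PR-bound = separation-bound₂ {A = P ∩ R} {Q}
        (sets 3 (λ P R E → P :⊑ E ⇒ P :∩ R :⊑ (P :∩ R) :∩ E) V.P⊑)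
        (sets 4 (λ P R E Q → Q :⊑ E ⇒ P :∩ Q :⊑ :⊥ ⇒ Q :⊑ (E :─ (P :∩ R)) :∩ E) V.Q⊑ V.P∩Q)
        (sets 3 (λ P Q R → P :∩ Q :⊑ :⊥ ⇒ (P :∩ R) :∩ Q :⊑ :⊥) V.P∩Q)
        (sets 2 (λ E A → E :⊑ A :∪ (E :─ A))) PR≥2
        (ℕ.≤-trans (s≤s (s≤s z≤n)) (card-P (vertical-sym v)))

      UL≤U : r M (U ∪ Line) ≤ r M U
      UL≤U = linear 4 (λ ul xa u l → ul :+ xa :≤ u :+ l ⟹ con 2 :≤ xa ⟹ l :≤ con 2 ⟹ ul :≤ u)
        (r M (U ∪ Line)) (r M (⁅ x ⁆ ∪ ⁅ a ⁆)) (r M U) (r M Line)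
        (submod M U Line ⊑-refl (sets 5 (λ x a P R L → x :⊑ L ⇒ a :⊑ L ⇒
          x :∪ a :⊑ ((P :∪ x) :∪ (R :∪ a)) :∩ L) x∈L a∈L))
        (rank-≥2 x≢a V.x∈ W′.x∈) line

      small : ¬ 2 ≤ ∣ W ∣
      small W≥2 = linear 11
        (λ u pr px ra epr wx qx sa w ul ρ →
          u :+ pr :≤ px :+ ra ⟹ epr :+ wx :≤ qx :+ sa ⟹ px :+ qx :≤ ρ :+ con 2 ⟹
          ra :+ sa :≤ ρ :+ con 2 ⟹ ρ :+ con 2 :≤ pr :+ epr ⟹ w :+ con 1 :≤ wx ⟹
          ul :≤ u ⟹ ρ :+ con 2 :≤ w :+ ul ⟹ :false)
        (r M U) (r M (P ∩ R)) (r M (P ∪ ⁅ x ⁆)) (r M (R ∪ ⁅ a ⁆)) (r M (E M ─ (P ∩ R)))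
        (r M (W ∪ ⁅ x ⁆)) (r M (Q ∪ ⁅ x ⁆)) (r M (S ∪ ⁅ a ⁆)) (r M W) (r M (U ∪ Line)) ρ
        (submod M (P ∪ ⁅ x ⁆) (R ∪ ⁅ a ⁆) ⊑-refl
          (sets 4 (λ P x R a → P :∩ R :⊑ (P :∪ x) :∩ (R :∪ a))))
        (submod M (Q ∪ ⁅ x ⁆) (S ∪ ⁅ a ⁆)
          (sets 7 (λ E P Q x R S a → E :⊑ P :∪ x :∪ Q ⇒ E :⊑ R :∪ a :∪ S ⇒
                    E :─ (P :∩ R) :⊑ (Q :∪ x) :∪ (S :∪ a)) V.cover W′.cover)
          (sets 5 (λ Q x S a X → x :⊑ S ⇒ ((Q :∩ S) :─ X) :∪ x :⊑ (Q :∪ x) :∩ (S :∪ a)) x∈S))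
        V.sum W′.sum PR-bound
        (gap (sets 4 (λ Q S X E → Q :⊑ E ⇒ (Q :∩ S) :─ X :⊑ E :─ X) V.Q⊑) x∈X) UL≤U
        (separation-bound₂ {A = W} {P}
          (sets 4 (λ Q S X E → Q :⊑ E ⇒ (Q :∩ S) :─ X :⊑ ((Q :∩ S) :─ X) :∩ E) V.Q⊑)
          (sets 6 (λ P x R a L E → P :⊑ E ⇒ P :⊑ (((P :∪ x) :∪ (R :∪ a)) :∪ L) :∩ E) V.P⊑)
          (sets 4 (λ Q S X P → P :∩ Q :⊑ :⊥ ⇒ ((Q :∩ S) :─ X) :∩ P :⊑ :⊥) V.P∩Q)
          W-cover W≥2 (ℕ.≤-trans (s≤s (s≤s z≤n)) (card-P v)))
        where
        W-cover : E M ⊑ W ∪ (U ∪ Line)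
        W-cover = ⊑-trans
          (sets 8 (λ E P Qx R Sa L X W → E :⊑ P :∪ Qx ⇒ E :⊑ R :∪ Sa ⇒ X :⊑ L :∪ P ⇒
              (Qx :∩ Sa) :─ (X :∪ L) :⊑ W ⇒ E :⊑ W :∪ ((P :∪ R) :∪ L))
            V.cover W′.cover
            (sets 4 (λ X L c P → X :⊑ L :∪ c ⇒ c :⊑ P ⇒ X :⊑ L :∪ P) X⊑ c∈P)
            (sets 6 (λ x Q a S X L → x :⊑ L ⇒ a :⊑ L ⇒
                      ((x :∪ Q) :∩ (a :∪ S)) :─ (X :∪ L) :⊑ (Q :∩ S) :─ X) x∈L a∈L))
          (sets 6 (λ W P x R a L → W :∪ ((P :∪ R) :∪ L) :⊑ W :∪ (((P :∪ x) :∪ (R :∪ a)) :∪ L)))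

    PS-nonempty : ¬ P ∩ S ⊑ ⊥
    PS-nonempty empty = ℕ.<⇒≱ (W′.rQ) (ℕ.≤-trans
      (rank-⊑ M (sets 7 (λ P Q S x L a E → P :∩ S :⊑ :⊥ ⇒ Q :∩ S :⊑ L ⇒ S :⊑ E ⇒ E :⊑ P :∪ x :∪ Q ⇒
          x :⊑ L ⇒ a :⊑ L ⇒ S :∪ a :⊑ L) empty (QS⊑Line PR≥2) (W′.Q⊑) V.cover x∈L a∈L))
      line)
      where
      PR≥2 : 2 ≤ ∣ P ∩ R ∣
      PR≥2 = ℕ.≤-trans (s≤s (s≤s z≤n)) (ℕ.≤-trans (card-P v) (card-mono
        (sets 6 (λ E P Q R S a → P :⊑ E ⇒ P :∩ Q :⊑ :⊥ ⇒ a :⊑ Q ⇒ E :⊑ R :∪ a :∪ S ⇒ P :∩ S :⊑ :⊥ ⇒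
             P :⊑ P :∩ R) V.P⊑ V.P∩Q a∈Q (W′.cover) empty)))

  near-line : ∀ {x a P Q R S} → Vertical M x P Q → Vertical M a R S → x ≢ a →
              ⁅ x ⁆ ⊑ Line → ⁅ a ⁆ ⊑ Line → ⁅ x ⁆ ⊑ X → ⁅ a ⁆ ⊑ X → ⁅ c ⁆ ⊑ P → ⁅ c ⁆ ⊑ R →
              ∣ Q ─ Line ∣ ≤ 1
  near-line {x} {a} {P} {Q} {R} {S} v w x≢a x∈L a∈L x∈X a∈X c∈P c∈R =
    ℕ.≤-trans (card-mono (sets 6 (λ E Q R S a L → Q :⊑ E ⇒ E :⊑ R :∪ a :∪ S ⇒ Q :∩ S :⊑ L ⇒
        a :⊑ L ⇒ Q :─ L :⊑ Q :∩ R) V.Q⊑ W′.cover (QS⊑Line PR≥2) a∈L)) QR≤1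
    where
    open Crossing v w x≢a x∈L a∈L x∈X a∈X c∈P c∈R
    module C′ = Crossing w v (x≢a ∘ sym) a∈L x∈L a∈X x∈X c∈R c∈P

    PS≥1 : 1 ≤ ∣ P ∩ S ∣
    PS≥1 = [ (λ (_ , p) → card-≥1 p) , (λ e → ⊥-elim (PS-nonempty e)) ]′ (nonempty-or-⊑⊥ (P ∩ S))

    QR≥1 : 1 ≤ ∣ Q ∩ R ∣
    QR≥1 = [ (λ (_ , p) → card-≥1 p)
           , (λ e → ⊥-elim (C′.PS-nonempty (sets 2 (λ Q R → Q :∩ R :⊑ :⊥ ⇒ R :∩ Q :⊑ :⊥) e))) ]′
           (nonempty-or-⊑⊥ (Q ∩ R))

    σ≥₁ : ∀ {A Z} → A ⊑ E M → Z ⊑ E M → A ∩ Z ⊑ ⊥ → 3 ≤ ∣ A ∣ → 1 ≤ ∣ Z ∣ →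
          ρ + 1 ≤ r M Z + r M (E M ─ Z)
    σ≥₁ {A} {Z} A⊑ Z⊑ A∩Z A≥3 Z≥1 = separation-bound₁ {A = Z} {A}
      (sets 2 (λ Z E → Z :⊑ E ⇒ Z :⊑ Z :∩ E) Z⊑)
      (sets 3 (λ A Z E → A :⊑ E ⇒ A :∩ Z :⊑ :⊥ ⇒ A :⊑ (E :─ Z) :∩ E) A⊑ A∩Z)
      (sets 2 (λ A Z → A :∩ Z :⊑ :⊥ ⇒ Z :∩ A :⊑ :⊥) A∩Z) (sets 2 (λ E Z → E :⊑ Z :∪ (E :─ Z)))
      Z≥1 (ℕ.≤-trans (s≤s z≤n) A≥3)

    σ≥₂ : ∀ {A Z} → A ⊑ E M → Z ⊑ E M → A ∩ Z ⊑ ⊥ → 3 ≤ ∣ A ∣ → 2 ≤ ∣ Z ∣ →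
          ρ + 2 ≤ r M Z + r M (E M ─ Z)
    σ≥₂ {A} {Z} A⊑ Z⊑ A∩Z A≥3 Z≥2 = separation-bound₂ {A = Z} {A}
      (sets 2 (λ Z E → Z :⊑ E ⇒ Z :⊑ Z :∩ E) Z⊑)
      (sets 3 (λ A Z E → A :⊑ E ⇒ A :∩ Z :⊑ :⊥ ⇒ A :⊑ (E :─ Z) :∩ E) A⊑ A∩Z)
      (sets 2 (λ A Z → A :∩ Z :⊑ :⊥ ⇒ Z :∩ A :⊑ :⊥) A∩Z) (sets 2 (λ E Z → E :⊑ Z :∪ (E :─ Z)))
      Z≥2 (ℕ.≤-trans (s≤s (s≤s z≤n)) A≥3)

    PS⊑ : P ∩ S ⊑ E M
    PS⊑ = sets 3 (λ P S E → P :⊑ E ⇒ P :∩ S :⊑ E) V.P⊑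
    QR⊑ : Q ∩ R ⊑ E M
    QR⊑ = sets 3 (λ P S E → P :⊑ E ⇒ P :∩ S :⊑ E) V.Q⊑
    Q∩PS : Q ∩ (P ∩ S) ⊑ ⊥
    Q∩PS = sets 3 (λ P Q S → P :∩ Q :⊑ :⊥ ⇒ Q :∩ (P :∩ S) :⊑ :⊥) V.P∩Q
    P∩QR : P ∩ (Q ∩ R) ⊑ ⊥
    P∩QR = sets 3 (λ P Q R → P :∩ Q :⊑ :⊥ ⇒ P :∩ (Q :∩ R) :⊑ :⊥) V.P∩Q

    too-many : ∀ {k l} → ρ + k ≤ r M (P ∩ S) + r M (E M ─ (P ∩ S)) →
               ρ + l ≤ r M (Q ∩ R) + r M (E M ─ (Q ∩ R)) → k + l ≤ 2
    too-many {k} {l} = linear 7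
      (λ k l ps eps qr eqr ρ → (ps :+ eps) :+ (qr :+ eqr) :≤ ρ :+ ρ :+ con 2 ⟹
         ρ :+ k :≤ ps :+ eps ⟹ ρ :+ l :≤ qr :+ eqr ⟹ k :+ l :≤ con 2)
      k l (r M (P ∩ S)) (r M (E M ─ (P ∩ S))) (r M (Q ∩ R)) (r M (E M ─ (Q ∩ R))) ρ crossing-sum

    QR≤1 : ∣ Q ∩ R ∣ ≤ 1
    QR≤1 = ℕ.≮⇒≥ λ QR≥2 → ℕ.<-irrefl refl
      (too-many {1} {2} (σ≥₁ V.Q⊑ PS⊑ Q∩PS (card-P (vertical-sym v)) PS≥1)
                        (σ≥₂ V.P⊑ QR⊑ P∩QR (card-P v) QR≥2))

    PS≤1 : ∣ P ∩ S ∣ ≤ 1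
    PS≤1 = ℕ.≮⇒≥ λ PS≥2 → ℕ.<-irrefl refl
      (too-many {2} {1} (σ≥₂ V.Q⊑ PS⊑ Q∩PS (card-P (vertical-sym v)) PS≥2)
                        (σ≥₁ V.P⊑ QR⊑ P∩QR (card-P v) QR≥1))

    PR≥2 : 2 ≤ ∣ P ∩ R ∣
    PR≥2 = linear 3 (λ p pr ps → con 3 :≤ p ⟹ p :≤ pr :+ ps ⟹ ps :≤ con 1 ⟹ con 2 :≤ pr)
      (∣ P ∣) (∣ P ∩ R ∣) (∣ P ∩ S ∣) (card-P v)
      (card-cover (P ∩ R) (P ∩ S) (sets 6 (λ E P Q R S a → P :⊑ E ⇒ E :⊑ R :∪ a :∪ S ⇒ a :⊑ Q ⇒
         P :∩ Q :⊑ :⊥ ⇒ P :⊑ (P :∩ R) :∪ (P :∩ S)) V.P⊑ W′.cover a∈Q V.P∩Q))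
      PS≤1

-- Rank-3 cocircuits

-- The three cases of the theorem, for the dual of its matroid: C is a cocircuit of M.
data Outcome {m} (M : Matroid m) (C : Subset m) (𝓝 : MinorClass m) : Set where
  si-connected : ∀ {x} → ⁅ x ⁆ ⊑ C → SmallMinor M 𝓝 x ⊥ → (∀ {P Q} → ¬ Vertical M x P Q) → Outcome M C 𝓝
  co-si-connected : ∀ {x Line} → ⁅ x ⁆ ⊑ C → SmallMinor M 𝓝 x ⊥ → r M (Line ∪ ⁅ x ⁆) ≤ 2 →
    (∀ {P Q} → Vertical M x P Q → ∣ P ─ Line ∣ ≤ 1 ⊎ ∣ Q ─ Line ∣ ≤ 1) → Outcome M C 𝓝
  fan : ∀ {x₁ x₂ x₃ x₄} → ⁅ x₂ ⁆ ⊑ C → ⁅ x₄ ⁆ ⊑ C → ⁅ x₁ ⁆ ⊑ E M → ⁅ x₃ ⁆ ⊑ E M →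
    x₁ ≢ x₂ × x₁ ≢ x₃ × x₁ ≢ x₄ × x₂ ≢ x₃ × x₂ ≢ x₄ × x₃ ≢ x₄ →
    r M (E M ─ (⁅ x₁ ⁆ ∪ ⁅ x₂ ⁆ ∪ ⁅ x₃ ⁆)) + 1 ≤ r M (E M) → r M (⁅ x₂ ⁆ ∪ ⁅ x₃ ⁆ ∪ ⁅ x₄ ⁆) ≤ 2 →
    SmallMinor M 𝓝 x₃ ⊥ → (∀ {P Q} → ¬ Vertical M x₃ P Q) → Outcome M C 𝓝

module PlaneCase {m} (M : Matroid m) (conn : Connected 3 M) (large : 4 ≤ ∣ E M ∣)
  {C : Subset m} (C-coclosed : ∀ {x} → ⁅ x ⁆ ⊑ C → ¬ (r M ((E M ─ C) ∪ ⁅ x ⁆) ≤ r M (E M ─ C)))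
  (𝓝 : MinorClass m) where
  open ThreeConnected M conn large

  module Plane {X x₀ Y} (v₀ : Vertical M x₀ X Y) (x₀∈C : ⁅ x₀ ⁆ ⊑ C)
    (closed : ∀ {e} → ⁅ e ⁆ ⊑ X → ¬ (r M ((E M ─ X) ∪ ⁅ e ⁆) ≤ r M (E M ─ X)))
    (minors : ∀ {e} → ⁅ e ⁆ ⊑ X → SmallMinor M 𝓝 e ⊥) (rX : r M X ≤ 3) where
    module V₀ = Vertical v₀

    X₀ : Subset m
    X₀ = X ∪ ⁅ x₀ ⁆

    plane : r M X₀ ≤ 3
    plane = ℕ.≤-trans (guts v₀) rX

    X≥3 : 3 ≤ r M X
    X≥3 = ℕ.≤-trans V₀.rP (guts v₀)

    module _ {x P Q} (x∈C : ⁅ x ⁆ ⊑ C) (x∈X : ⁅ x ⁆ ⊑ X) (v : Vertical M x P Q) (x₀∈Q : ⁅ x₀ ⁆ ⊑ Q) where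
      open Vertical v

      Line Line′ : Subset m
      Line  = (Q ∩ X₀) ∪ ⁅ x ⁆
      Line′ = (P ∩ X₀) ∪ ⁅ x ⁆

      line : r M Line ≤ 2
      line = line-of-plane (vertical-sym v) x∈X (closed x∈X) (sets 2 (λ X x → X :⊑ X :∪ x)) plane
        (sets 3 (λ Q X x → (Q :∩ X) :∪ x :⊑ Q :∪ x))
        (sets 4 (λ Q X x₀ x → x :⊑ X ⇒ (Q :∩ (X :∪ x₀)) :∪ x :⊑ X :∪ x₀) x∈X)

      line′ : r M Line′ ≤ 2
      line′ = line-of-plane v x∈X (closed x∈X) (sets 2 (λ X x → X :⊑ X :∪ x)) plane
        (sets 3 (λ Q X x → (Q :∩ X) :∪ x :⊑ Q :∪ x))
        (sets 4 (λ Q X x₀ x → x :⊑ X ⇒ (Q :∩ (X :∪ x₀)) :∪ x :⊑ X :∪ x₀) x∈X)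

      not-in-line : ∀ {S} → X ⊑ S → ¬ (r M S ≤ 2)
      not-in-line X⊑S rS = ℕ.<⇒≱ X≥3 (ℕ.≤-trans (rank-⊑ M X⊑S) rS)

      P∩X-element : ∃[ c ] ⁅ c ⁆ ⊑ P ∩ X
      P∩X-element = [ id , (λ e → ⊥-elim (not-in-line
        (sets 6 (λ E P Q X x x₀ → X :⊑ E ⇒ E :⊑ P :∪ x :∪ Q ⇒ P :∩ X :⊑ :⊥ ⇒
          X :⊑ (Q :∩ (X :∪ x₀)) :∪ x) V₀.P⊑ cover e) line)) ]′ (nonempty-or-⊑⊥ (P ∩ X))

      Q∩X-element : ∃[ l ] ⁅ l ⁆ ⊑ Q ∩ X
      Q∩X-element = [ id , (λ e → ⊥-elim (not-in-line
        (sets 6 (λ E P Q X x x₀ → X :⊑ E ⇒ E :⊑ P :∪ x :∪ Q ⇒ Q :∩ X :⊑ :⊥ ⇒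
          X :⊑ (P :∩ (X :∪ x₀)) :∪ x) V₀.P⊑ cover e) line′)) ]′ (nonempty-or-⊑⊥ (Q ∩ X))

      in-Line⊑E : Line ⊑ E M
      in-Line⊑E = sets 4 (λ Q X x E → Q :⊑ E ⇒ x :⊑ E ⇒ (Q :∩ X) :∪ x :⊑ E) Q⊑ x∈

      not-collinear : ∀ {c u w} → ⁅ c ⁆ ⊑ P ∩ X → u ≢ w → ⁅ u ⁆ ⊑ Line → ⁅ w ⁆ ⊑ Line →
                      ¬ (r M (⁅ c ⁆ ∪ ⁅ u ⁆ ∪ ⁅ w ⁆) ≤ 2)
      not-collinear {c} {u} {w} c∈ u≢w u∈ w∈ collinear = not-in-line
        (sets 7 (λ E P Q X x x₀ A → X :⊑ E ⇒ E :⊑ P :∪ x :∪ Q ⇒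
          X :⊑ (A :∪ ((Q :∩ (X :∪ x₀)) :∪ x)) :∪ ((P :∩ (X :∪ x₀)) :∪ x)) V₀.P⊑ cover)
        (lines-meeting-twice {S = (⁅ c ⁆ ∪ ⁅ u ⁆ ∪ ⁅ w ⁆) ∪ Line} {Line′} {c} {x}
          (separated⇒≢ (sets 3 (λ c P X → c :⊑ P :∩ X ⇒ c :⊑ P) c∈) x∉P)
          (sets 4 (λ c P X E → c :⊑ P :∩ X ⇒ P :⊑ E ⇒ c :⊑ E) c∈ P⊑) x∈
          (sets 4 (λ c u x Q → c :∪ x :⊑ (c :∪ u) :∪ (Q :∪ x)))
          (sets 5 (λ c P X x₀ x → c :⊑ P :∩ X ⇒ c :∪ x :⊑ (P :∩ (X :∪ x₀)) :∪ x) c∈)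
          (lines-meeting-twice {S = ⁅ c ⁆ ∪ ⁅ u ⁆ ∪ ⁅ w ⁆} {Line} {u} {w} u≢w
            (sets 3 (λ u L E → u :⊑ L ⇒ L :⊑ E ⇒ u :⊑ E) u∈ in-Line⊑E)
            (sets 3 (λ u L E → u :⊑ L ⇒ L :⊑ E ⇒ u :⊑ E) w∈ in-Line⊑E)
            (sets 3 (λ c u w → u :∪ w :⊑ c :∪ u :∪ w))
            (sets 3 (λ u w L → u :⊑ L ⇒ w :⊑ L ⇒ u :∪ w :⊑ L) u∈ w∈) collinear line)
          line′)

      -- Two elements of a line through x outside C would span x, which is in C.
      one-outside-C : ∀ {S A c} → r M (S ∪ ⁅ x ⁆) ≤ 2 → S ⊑ E M → A ⊑ S → A ∩ C ⊑ ⊥ → ⁅ c ⁆ ⊑ A → A ⊑ ⁅ c ⁆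
      one-outside-C {S} {A} {c} rS S⊑E A⊑ A∩C c∈ =
        [ another , (λ e → sets 2 (λ A c → A :─ c :⊑ :⊥ ⇒ A :⊑ c) e) ]′ (nonempty-or-⊑⊥ (A ─ ⁅ c ⁆))
        where
        another : ∃[ d ] ⁅ d ⁆ ⊑ A ─ ⁅ c ⁆ → A ⊑ ⁅ c ⁆
        another (d , d∈) = ⊥-elim (C-coclosed x∈C (spanned-mono M x
          (ℕ.≤-trans (rank-⊑ M (sets 5 (λ c d A S x → c :⊑ A ⇒ d :⊑ A :─ c ⇒ A :⊑ S ⇒
                        (d :∪ c) :∪ x :⊑ S :∪ x) c∈ d∈ A⊑))
            (ℕ.≤-trans rS (rank-≥2 (separated⇒≢ d∈ (sets 2 (λ A c → c :∩ (A :─ c) :⊑ :⊥)))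
              (sets 5 (λ c d A S E → d :⊑ A :─ c ⇒ A :⊑ S ⇒ S :⊑ E ⇒ d :⊑ E) d∈ A⊑ S⊑E)
              (sets 4 (λ c A S E → c :⊑ A ⇒ A :⊑ S ⇒ S :⊑ E ⇒ c :⊑ E) c∈ A⊑ S⊑E))))
          (sets 6 (λ c d A S C E → c :⊑ A ⇒ d :⊑ A :─ c ⇒ A :⊑ S ⇒ S :⊑ E ⇒ A :∩ C :⊑ :⊥ ⇒
             d :∪ c :⊑ E :─ C) c∈ d∈ A⊑ S⊑E A∩C)))

      module _ {l} (l∈ : ⁅ l ⁆ ⊑ Q ∩ X) where

        l∈Line : ⁅ l ⁆ ⊑ Line
        l∈Line = sets 5 (λ l Q X x₀ x → l :⊑ Q :∩ X ⇒ l :⊑ (Q :∩ (X :∪ x₀)) :∪ x) l∈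

        x∈Line : ⁅ x ⁆ ⊑ Line
        x∈Line = sets 2 (λ A x → x :⊑ A :∪ x)

        x₀∈Line : ⁅ x₀ ⁆ ⊑ Line
        x₀∈Line = sets 4 (λ Q X x₀ x → x₀ :⊑ Q ⇒ x₀ :⊑ (Q :∩ (X :∪ x₀)) :∪ x) x₀∈Q

        l≢x : l ≢ x
        l≢x = separated⇒≢ (sets 3 (λ l Q X → l :⊑ Q :∩ X ⇒ l :⊑ Q) l∈) x∉Q

        x≢x₀ : x ≢ x₀
        x≢x₀ = separated⇒≢ x∈X V₀.x∉P

        l≢x₀ : l ≢ x₀
        l≢x₀ = separated⇒≢ (sets 3 (λ l Q X → l :⊑ Q :∩ X ⇒ l :⊑ X) l∈) V₀.x∉P

        -- Of the three points x, l and x₀ of Line, two would be on a line with c.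
        no-vertical : ∀ {c P′ Q′} → ⁅ c ⁆ ⊑ P ∩ X → ¬ Vertical M c P′ Q′
        no-vertical {c} {P′} {Q′} c∈ v′ = pigeonhole (side x x∈Line) (side l l∈Line) (side x₀ x₀∈Line)
          where
          module V′ = Vertical v′
          c∈X : ⁅ c ⁆ ⊑ X
          c∈X = sets 3 (λ c P X → c :⊑ P :∩ X ⇒ c :⊑ X) c∈

          Line∩c : Line ∩ ⁅ c ⁆ ⊑ ⊥
          Line∩c = sets 5 (λ P Q X x c → P :∩ Q :⊑ :⊥ ⇒ x :∩ P :⊑ :⊥ ⇒ c :⊑ P ⇒
              ((Q :∩ X) :∪ x) :∩ c :⊑ :⊥) P∩Q x∉P (sets 3 (λ c P X → c :⊑ P :∩ X ⇒ c :⊑ P) c∈)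

          side : ∀ u → ⁅ u ⁆ ⊑ Line → ⁅ u ⁆ ⊑ P′ ⊎ ⁅ u ⁆ ⊑ Q′
          side u u∈ = [ inj₁ , (λ u∉ → inj₂ (sets 6 (λ E P Q c L u → E :⊑ P :∪ c :∪ Q ⇒ L :⊑ E ⇒
              u :⊑ L ⇒ L :∩ c :⊑ :⊥ ⇒ u :∩ P :⊑ :⊥ ⇒ u :⊑ Q) V′.cover in-Line⊑E u∈ Line∩c u∉)) ]′ (∈-or-∉ u P′)

          together : ∀ {R S u w} → Vertical M c R S → u ≢ w → ⁅ u ⁆ ⊑ Line → ⁅ w ⁆ ⊑ Line →
                     ⁅ u ⁆ ⊑ R → ⁅ w ⁆ ⊑ R → Absurd
          together v″ u≢w u∈ w∈ u∈R w∈R = not-collinear c∈ u≢w u∈ w∈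
            (line-of-plane v″ c∈X (closed c∈X) (sets 2 (λ X x → X :⊑ X :∪ x)) plane
              (sets 4 (λ c u w R → u :⊑ R ⇒ w :⊑ R ⇒ c :∪ u :∪ w :⊑ R :∪ c) u∈R w∈R)
              (sets 6 (λ c u w X x₀ L → c :⊑ X ⇒ u :⊑ L ⇒ w :⊑ L ⇒ L :⊑ X :∪ x₀ ⇒
                c :∪ u :∪ w :⊑ X :∪ x₀) c∈X u∈ w∈
                (sets 4 (λ Q X x₀ x → x :⊑ X ⇒ (Q :∩ (X :∪ x₀)) :∪ x :⊑ X :∪ x₀) x∈X)))

          pigeonhole : ⁅ x ⁆ ⊑ P′ ⊎ ⁅ x ⁆ ⊑ Q′ → ⁅ l ⁆ ⊑ P′ ⊎ ⁅ l ⁆ ⊑ Q′ → ⁅ x₀ ⁆ ⊑ P′ ⊎ ⁅ x₀ ⁆ ⊑ Q′ → Absurd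
          pigeonhole (inj₁ p) (inj₁ q) _        = together v′ l≢x l∈Line x∈Line q p
          pigeonhole (inj₁ p) (inj₂ q) (inj₁ s) = together v′ x≢x₀ x∈Line x₀∈Line p s
          pigeonhole (inj₁ p) (inj₂ q) (inj₂ s) = together (vertical-sym v′) l≢x₀ l∈Line x₀∈Line q s
          pigeonhole (inj₂ p) (inj₁ q) (inj₁ s) = together v′ l≢x₀ l∈Line x₀∈Line q s
          pigeonhole (inj₂ p) (inj₁ q) (inj₂ s) = together (vertical-sym v′) x≢x₀ x∈Line x₀∈Line p s
          pigeonhole (inj₂ p) (inj₂ q) _        = together (vertical-sym v′) l≢x l∈Line x∈Line q p

        good-point : ∃[ c ] ⁅ c ⁆ ⊑ (P ∩ X) ∩ C → Outcome M C 𝓝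
        good-point (c , c∈) = [ (λ (_ , _ , v′) → ⊥-elim (no-vertical (sets 3 (λ c A C → c :⊑ A :∩ C ⇒ c :⊑ A) c∈) v′))
                              , si-connected (sets 3 (λ c A C → c :⊑ A :∩ C ⇒ c :⊑ C) c∈) (minors c∈X) ]′
                              (vertical? M (⊑-trans c∈X V₀.P⊑))
          where
          c∈X : ⁅ c ⁆ ⊑ X
          c∈X = sets 4 (λ c P X C → c :⊑ (P :∩ X) :∩ C ⇒ c :⊑ X) c∈

        module _ {c} (c∈ : ⁅ c ⁆ ⊑ P ∩ X) (P∩X⊑ : P ∩ X ⊑ ⁅ c ⁆) where

          c∈P : ⁅ c ⁆ ⊑ P
          c∈P = sets 3 (λ c P X → c :⊑ P :∩ X ⇒ c :⊑ P) c∈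

          c∈X : ⁅ c ⁆ ⊑ X
          c∈X = sets 3 (λ c P X → c :⊑ P :∩ X ⇒ c :⊑ X) c∈

          Line⊑X₀ : Line ⊑ X₀
          Line⊑X₀ = sets 4 (λ Q X x₀ x → x :⊑ X ⇒ (Q :∩ (X :∪ x₀)) :∪ x :⊑ X :∪ x₀) x∈X

          X⊑Line∪c : X ⊑ Line ∪ ⁅ c ⁆
          X⊑Line∪c = sets 7 (λ E P Q X x x₀ c → X :⊑ E ⇒ E :⊑ P :∪ x :∪ Q ⇒ P :∩ X :⊑ c ⇒
            X :⊑ ((Q :∩ (X :∪ x₀)) :∪ x) :∪ c) V₀.P⊑ cover P∩X⊑

          near-line : ∀ {a P Q R S} → Vertical M x P Q → Vertical M a R S → x ≢ a →
            ⁅ a ⁆ ⊑ Line → ⁅ a ⁆ ⊑ X → ⁅ c ⁆ ⊑ P → ⁅ c ⁆ ⊑ R → ∣ Q ─ Line ∣ ≤ 1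
          near-line v w x≢a a∈L a∈X c∈P c∈R = LineAndPoint.near-line M conn large {X} {Line} {c} {x₀}
            closed plane line V₀.P⊑ Line⊑X₀ X⊑Line∪c c∈X V₀.x∈ V₀.x∉P x₀∈Line (not-collinear c∈)
            v w x≢a x∈Line a∈L x∈X a∈X c∈P c∈R

          side-of-c : ∀ {z R S} → Vertical M z R S → c ≢ z → ⁅ c ⁆ ⊑ R ⊎ ⁅ c ⁆ ⊑ S
          side-of-c {z} {R} w c≢z = [ inj₁ , (λ c∉ → inj₂ (sets 6 (λ E R z S c X → E :⊑ R :∪ z :∪ S ⇒
            X :⊑ E ⇒ c :⊑ X ⇒ c :∩ z :⊑ :⊥ ⇒ c :∩ R :⊑ :⊥ ⇒ c :⊑ S)
            (Vertical.cover w) V₀.P⊑ c∈X (≢⇒disjoint c≢z) c∉)) ]′ (∈-or-∉ c R)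

          c≢x : c ≢ x
          c≢x = separated⇒≢ c∈P x∉P

          Q-disjoint-P : ∀ {a} → ⁅ a ⁆ ⊑ Q → ⁅ a ⁆ ∩ P ⊑ ⊥
          Q-disjoint-P a∈Q = sets 3 (λ a P Q → a :⊑ Q ⇒ P :∩ Q :⊑ :⊥ ⇒ a :∩ P :⊑ :⊥) a∈Q P∩Q

          two-separations : ∀ {a R S} → ⁅ a ⁆ ⊑ Q ∩ X → Vertical M a R S → Outcome M C 𝓝
          two-separations {a} {R} {S} a∈ w = [ from w , from (vertical-sym w) ]′ (side-of-c w c≢a)
            where
            a∈Q : ⁅ a ⁆ ⊑ Q
            a∈Q = sets 3 (λ l Q X → l :⊑ Q :∩ X ⇒ l :⊑ Q) a∈
            a∈X : ⁅ a ⁆ ⊑ X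
            a∈X = sets 3 (λ l Q X → l :⊑ Q :∩ X ⇒ l :⊑ X) a∈
            a∈Line : ⁅ a ⁆ ⊑ Line
            a∈Line = sets 5 (λ l Q X x₀ x → l :⊑ Q :∩ X ⇒ l :⊑ (Q :∩ (X :∪ x₀)) :∪ x) a∈
            c≢a : c ≢ a
            c≢a = separated⇒≢ c∈P (Q-disjoint-P a∈Q)
            x≢a : x ≢ a
            x≢a = separated⇒≢ a∈Q x∉Q ∘ sym

            from : ∀ {R S} → Vertical M a R S → ⁅ c ⁆ ⊑ R → Outcome M C 𝓝
            from w c∈R = co-si-connected x∈C (minors x∈X)
              (ℕ.≤-trans (rank-⊑ M (sets 2 (λ A x → (A :∪ x) :∪ x :⊑ A :∪ x))) line)
              λ v′ → [ (λ c∈P′ → inj₂ (near-line v′ w x≢a a∈Line a∈X c∈P′ c∈R))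
                     , (λ c∈Q′ → inj₁ (near-line (vertical-sym v′) w x≢a a∈Line a∈X c∈Q′ c∈R))
                     ]′ (side-of-c v′ c≢x)

          in-C : ∃[ a ] ⁅ a ⁆ ⊑ (Q ∩ X) ∩ C → Outcome M C 𝓝
          in-C (a , a∈) =
            [ (λ (_ , _ , w) → two-separations (sets 3 (λ c A C → c :⊑ A :∩ C ⇒ c :⊑ A) a∈) w)
            , si-connected (sets 3 (λ c A C → c :⊑ A :∩ C ⇒ c :⊑ C) a∈) (minors a∈X) ]′
            (vertical? M (⊑-trans a∈X V₀.P⊑))
            where
            a∈X : ⁅ a ⁆ ⊑ X
            a∈X = sets 4 (λ c P X C → c :⊑ (P :∩ X) :∩ C ⇒ c :⊑ X) a∈

          outside-C : (Q ∩ X) ∩ C ⊑ ⊥ → Outcome M C 𝓝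
          outside-C QXC = [ (λ (_ , _ , w) → two-separations l∈ w)
            , fan x∈C x₀∈C (⊑-trans c∈X V₀.P⊑) (⊑-trans l∈X V₀.P⊑)
                ( c≢x , separated⇒≢ c∈P (Q-disjoint-P (sets 3 (λ l Q X → l :⊑ Q :∩ X ⇒ l :⊑ Q) l∈))
                , separated⇒≢ c∈X V₀.x∉P , l≢x ∘ sym , x≢x₀ , l≢x₀ )
                (ℕ.≤-trans (ℕ.+-monoˡ-≤ 1 (rank-⊑ M (sets 7 (λ E P Q X x c l → X :⊑ E ⇒
                    E :⊑ P :∪ x :∪ Q ⇒ P :∩ X :⊑ c ⇒ Q :∩ X :⊑ l ⇒ E :─ (c :∪ x :∪ l) :⊑ E :─ X)
                    V₀.P⊑ cover P∩X⊑ Q∩X⊑)))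
                  (≡-≤-trans (ℕ.+-comm _ 1) (ℕ.≤-trans (ℕ.≰⇒> (closed x∈X)) (rank-≤ρ M _))))
                (ℕ.≤-trans (rank-⊑ M (sets 4 (λ x l x₀ L → x :⊑ L ⇒ l :⊑ L ⇒ x₀ :⊑ L ⇒
                    x :∪ l :∪ x₀ :⊑ L) x∈Line l∈Line x₀∈Line)) line)
                (minors l∈X) ]′ (vertical? M (⊑-trans l∈X V₀.P⊑))
            where
            l∈X : ⁅ l ⁆ ⊑ X
            l∈X = sets 3 (λ l Q X → l :⊑ Q :∩ X ⇒ l :⊑ X) l∈
            Q∩X⊑ : Q ∩ X ⊑ ⁅ l ⁆
            Q∩X⊑ = one-outside-C {S = Q ∩ X₀} line (sets 3 (λ Q X E → Q :⊑ E ⇒ Q :∩ X :⊑ E) Q⊑)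
              (sets 3 (λ Q X x₀ → Q :∩ X :⊑ Q :∩ (X :∪ x₀))) QXC l∈

        outcome : Outcome M C 𝓝
        outcome = [ good-point , bad-points P∩X-element ]′ (nonempty-or-⊑⊥ ((P ∩ X) ∩ C))
          where
          bad-points : ∃[ c ] ⁅ c ⁆ ⊑ P ∩ X → (P ∩ X) ∩ C ⊑ ⊥ → Outcome M C 𝓝
          bad-points (c , c∈) PXC = [ in-C c∈ P∩X⊑ , outside-C c∈ P∩X⊑ ]′ (nonempty-or-⊑⊥ ((Q ∩ X) ∩ C))
            where
            P∩X⊑ : P ∩ X ⊑ ⁅ c ⁆
            P∩X⊑ = one-outside-C {S = P ∩ X₀} line′ (sets 3 (λ Q X E → Q :⊑ E ⇒ Q :∩ X :⊑ E) P⊑)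
              (sets 3 (λ Q X x₀ → Q :∩ X :⊑ Q :∩ (X :∪ x₀))) PXC c∈

    plane-outcome : ∀ {x P Q} → ⁅ x ⁆ ⊑ C → ⁅ x ⁆ ⊑ X → Vertical M x P Q → Outcome M C 𝓝
    plane-outcome {x} {P} {Q} x∈C x∈X v =
      [ (λ x₀∈P → outcome x∈C x∈X (vertical-sym v) x₀∈P (proj₂ (Q∩X-element x∈C x∈X (vertical-sym v) x₀∈P)))
      , (λ x₀∉P → outcome x∈C x∈X v (x₀∈Q x₀∉P) (proj₂ (Q∩X-element x∈C x∈X v (x₀∈Q x₀∉P)))) ]′
      (∈-or-∉ x₀ P)
      where
      x₀∈Q : ⁅ x₀ ⁆ ∩ P ⊑ ⊥ → ⁅ x₀ ⁆ ⊑ Q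
      x₀∈Q x₀∉P = sets 6 (λ E P x Q x₀ X → E :⊑ P :∪ x :∪ Q ⇒ x₀ :⊑ E ⇒ x :⊑ X ⇒ x₀ :∩ X :⊑ :⊥ ⇒
        x₀ :∩ P :⊑ :⊥ ⇒ x₀ :⊑ Q) (Vertical.cover v) V₀.x∈ x∈X V₀.x∉P x₀∉P

-- Descent to a smallest vertical separation

module Descent {m} (M : Matroid m) (conn : Connected 3 M) (large : 4 ≤ ∣ E M ∣)
  {C : Subset m} (C⊑E : C ⊑ E M)
  (C-coclosed : ∀ {x} → ⁅ x ⁆ ⊑ C → ¬ (r M ((E M ─ C) ∪ ⁅ x ⁆) ≤ r M (E M ─ C)))
  (𝓝 : MinorClass m) where
  open ThreeConnected M conn large
  open MinorClass 𝓝

  small-side : ∀ {x P Q} → Vertical M x P Q → ∀ {L T} → IsMinor M L T → Member L → ⁅ x ⁆ ⊑ T →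
               ∣ E L ∩ P ∣ ≤ 1 ⊎ ∣ E L ∩ Q ∣ ≤ 1
  small-side {x} {P} {Q} v {L} {T} minor member x∈T =
    by-size (∣ E L ∩ P ∣ ℕ.≤? 1) (∣ E L ∩ Q ∣ ℕ.≤? 1)
    where
    open Vertical v
    module I = IsMinor minor
    F FP FQ TP : Subset m
    F  = E L
    FP = F ∩ P
    FQ = F ∩ Q
    TP = (T ∩ P) ∪ ⁅ x ⁆

    -- The connectivity between the two sides does not increase in a minor.
    bound : r M (FP ∪ T) + r M (FQ ∪ T) ≤ r M (F ∪ T) + r M T + 1
    bound = linear 12
      (λ u w f a v b p tp q t o ρ →
         v :+ u :≤ f :+ a ⟹ ρ :+ w :≤ v :+ b ⟹ a :+ tp :≤ p :+ t ⟹ b :+ o :≤ q :+ tp ⟹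
         con 1 :≤ o ⟹ p :+ q :≤ ρ :+ con 2 ⟹ u :+ w :≤ f :+ t :+ con 1)
      (r M (FP ∪ T)) (r M (FQ ∪ T)) (r M (F ∪ T)) (r M ((P ∪ ⁅ x ⁆) ∪ T))
      (r M (((P ∪ ⁅ x ⁆) ∪ T) ∪ FQ)) (r M ((Q ∪ ⁅ x ⁆) ∪ T)) (r M (P ∪ ⁅ x ⁆)) (r M TP)
      (r M (Q ∪ ⁅ x ⁆)) (r M T) (r M ⁅ x ⁆) ρ
      (submod M (F ∪ T) ((P ∪ ⁅ x ⁆) ∪ T)
        (sets 5 (λ P x T F Q → ((P :∪ x) :∪ T) :∪ (F :∩ Q) :⊑ (F :∪ T) :∪ ((P :∪ x) :∪ T)))
        (sets 4 (λ P x T F → (F :∩ P) :∪ T :⊑ (F :∪ T) :∩ ((P :∪ x) :∪ T))))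
      (submod M (((P ∪ ⁅ x ⁆) ∪ T) ∪ FQ) ((Q ∪ ⁅ x ⁆) ∪ T)
        (sets 6 (λ E P x Q T F → E :⊑ P :∪ x :∪ Q ⇒
           E :⊑ (((P :∪ x) :∪ T) :∪ (F :∩ Q)) :∪ ((Q :∪ x) :∪ T)) cover)
        (sets 5 (λ P x T F Q → (F :∩ Q) :∪ T :⊑
           (((P :∪ x) :∪ T) :∪ (F :∩ Q)) :∩ ((Q :∪ x) :∪ T))))
      (submod M (P ∪ ⁅ x ⁆) T ⊑-refl
        (sets 3 (λ P x T → x :⊑ T ⇒ (T :∩ P) :∪ x :⊑ (P :∪ x) :∩ T) x∈T))
      (submod M (Q ∪ ⁅ x ⁆) TP
        (sets 5 (λ E P x Q T → T :⊑ E ⇒ E :⊑ P :∪ x :∪ Q ⇒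
           (Q :∪ x) :∪ T :⊑ (Q :∪ x) :∪ ((T :∩ P) :∪ x)) I.contract cover)
        (sets 4 (λ P x Q T → x :⊑ (Q :∪ x) :∩ ((T :∩ P) :∪ x))))
      (rank-≥1 x∈) sum

    both-large : 2 ≤ ∣ FP ∣ → 2 ≤ ∣ FQ ∣ → Absurd
    both-large FP≥2 FQ≥2 = linear 7
      (λ l lp lq t p q f → l :+ con 2 :≤ lp :+ lq ⟹ lp :+ t :≤ p ⟹ lq :+ t :≤ q ⟹ f :≤ l :+ t ⟹
         p :+ q :≤ f :+ t :+ con 1 ⟹ :false)
      (r L F) (r L FP) (r L FQ) (r M T) (r M (FP ∪ T)) (r M (FQ ∪ T)) (r M (F ∪ T))
      (separation-bound L (connected member) 2 (s≤s z≤n) (s≤s (s≤s (s≤s z≤n))) {A = FP} {FQ}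
        (sets 2 (λ F P → F :∩ P :⊑ (F :∩ P) :∩ F)) (sets 2 (λ F P → F :∩ P :⊑ (F :∩ P) :∩ F))
        (sets 3 (λ F P Q → P :∩ Q :⊑ :⊥ ⇒ (F :∩ P) :∩ (F :∩ Q) :⊑ :⊥) P∩Q)
        (sets 6 (λ E P x Q F T → F :⊑ E ⇒ E :⊑ P :∪ x :∪ Q ⇒ x :⊑ T ⇒ F :∩ T :⊑ :⊥ ⇒
           F :⊑ (F :∩ P) :∪ (F :∩ Q)) I.ground cover x∈T I.disjoint) FP≥2 FQ≥2)
      (ℕ.≤-reflexive (I.rank (sets 2 (λ F P → F :∩ P :⊑ F))))
      (ℕ.≤-reflexive (I.rank (sets 2 (λ F P → F :∩ P :⊑ F))))
      (ℕ.≤-reflexive (sym (I.rank ⊑-refl))) bound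

    by-size : Dec (∣ FP ∣ ≤ 1) → Dec (∣ FQ ∣ ≤ 1) → ∣ FP ∣ ≤ 1 ⊎ ∣ FQ ∣ ≤ 1
    by-size (yes p) _       = inj₁ p
    by-size (no _)  (yes q) = inj₂ q
    by-size (no p)  (no q)  = ⊥-elim (both-large (ℕ.≰⇒> p) (ℕ.≰⇒> q))

  restrict-small : ∀ {x X Y} → Y ⊑ X → SmallMinor M 𝓝 x X → SmallMinor M 𝓝 x Y
  restrict-small Y⊑X sm = record
    { minor = minor ; member = member ; x∈T = x∈T
    ; small = ℕ.≤-trans (card-mono {X = E L ∩ _} {Y = E L ∩ _}
        (sets 3 (λ F X Y → Y :⊑ X ⇒ F :∩ Y :⊑ F :∩ X) {_} {E L} Y⊑X)) small }
    where open SmallMinor sm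

  descend : ∀ k {x₀ X Y} → ∣ X ∣ ≤ k → ⁅ x₀ ⁆ ⊑ C → Vertical M x₀ X Y → SmallMinor M 𝓝 x₀ X → Outcome M C 𝓝
  descend zero X≤0 _ v _ = ⊥-elim (ℕ.<⇒≱ (ℕ.≤-trans (s≤s z≤n) (card-P v)) X≤0)
  descend (suc k) {x₀} {X} {Y} X≤k x₀∈C v₀ sm₀ = by-closure
    (Fin.any? λ e → (e ∈? X) ×-dec (r M ((E M ─ X) ∪ ⁅ e ⁆) ℕ.≤? r M (E M ─ X)))
    where
    module V₀ = Vertical v₀

    smaller : ∀ Z → suc ∣ Z ∣ ≤ ∣ X ∣ → ∣ Z ∣ ≤ k
    smaller _ Z<X = ℕ.≤-pred (ℕ.≤-trans Z<X X≤k)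

    E─X⊑ : E M ─ X ⊑ Y ∪ ⁅ x₀ ⁆
    E─X⊑ = sets 4 (λ E X x Y → E :⊑ X :∪ x :∪ Y ⇒ E :─ X :⊑ Y :∪ x) V₀.cover

    Y₀⊑ : Y ∪ ⁅ x₀ ⁆ ⊑ E M ─ X
    Y₀⊑ = sets 4 (λ E X x Y → x :⊑ E ⇒ Y :⊑ E ⇒ X :∩ Y :⊑ :⊥ ⇒ x :∩ X :⊑ :⊥ ⇒ Y :∪ x :⊑ E :─ X)
            V₀.x∈ V₀.Q⊑ V₀.P∩Q V₀.x∉P

    enlarge-Y : ∀ {e} → ⁅ e ⁆ ⊑ X → r M ((E M ─ X) ∪ ⁅ e ⁆) ≤ r M (E M ─ X) → Outcome M C 𝓝
    enlarge-Y {e} e∈ spanned = descend k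
      (smaller (X ─ ⁅ e ⁆) (card-strict (sets 2 (λ X e → X :─ e :⊑ X)) e∈ (sets 2 (λ X e → e :∩ (X :─ e) :⊑ :⊥))))
      x₀∈C record
        { x∈ = V₀.x∈
        ; P⊑ = sets 3 (λ X e E → X :⊑ E ⇒ X :─ e :⊑ E) V₀.P⊑
        ; Q⊑ = sets 4 (λ X e E Y → X :⊑ E ⇒ Y :⊑ E ⇒ e :⊑ X ⇒ Y :∪ e :⊑ E) V₀.P⊑ V₀.Q⊑ e∈
        ; cover = sets 5 (λ E X x Y e → E :⊑ X :∪ x :∪ Y ⇒ E :⊑ (X :─ e) :∪ x :∪ (Y :∪ e)) V₀.cover
        ; P∩Q = sets 3 (λ X Y e → X :∩ Y :⊑ :⊥ ⇒ (X :─ e) :∩ (Y :∪ e) :⊑ :⊥) V₀.P∩Q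
        ; x∉P = sets 3 (λ X x e → x :∩ X :⊑ :⊥ ⇒ x :∩ (X :─ e) :⊑ :⊥) V₀.x∉P
        ; x∉Q = sets 4 (λ X x e Y → x :∩ X :⊑ :⊥ ⇒ x :∩ Y :⊑ :⊥ ⇒ e :⊑ X ⇒ x :∩ (Y :∪ e) :⊑ :⊥)
                  V₀.x∉P V₀.x∉Q e∈
        ; rP = linear 7 (λ x′ ye ex exe xx y ρ → ρ :+ con 2 :≤ x′ :+ ye ⟹ ye :≤ exe ⟹ exe :≤ ex ⟹
                   ex :≤ y ⟹ xx :+ y :≤ ρ :+ con 2 ⟹ con 3 :≤ xx ⟹ con 3 :≤ x′)
            (r M ((X ─ ⁅ e ⁆) ∪ ⁅ x₀ ⁆)) (r M (Y ∪ ⁅ e ⁆)) (r M (E M ─ X)) (r M ((E M ─ X) ∪ ⁅ e ⁆))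
            (r M (X ∪ ⁅ x₀ ⁆)) (r M (Y ∪ ⁅ x₀ ⁆)) ρ
            (separation-bound₂ {A = X ─ ⁅ e ⁆} {Y}
              (sets 4 (λ X e x E → X :⊑ E ⇒ X :─ e :⊑ ((X :─ e) :∪ x) :∩ E) V₀.P⊑)
              (sets 3 (λ Y e E → Y :⊑ E ⇒ Y :⊑ (Y :∪ e) :∩ E) V₀.Q⊑)
              (sets 3 (λ X Y e → X :∩ Y :⊑ :⊥ ⇒ (X :─ e) :∩ Y :⊑ :⊥) V₀.P∩Q)
              (sets 5 (λ E X x Y e → E :⊑ X :∪ x :∪ Y ⇒ E :⊑ ((X :─ e) :∪ x) :∪ (Y :∪ e)) V₀.cover)
              (linear 3 (λ x x′ e → con 3 :≤ x ⟹ x :≤ x′ :+ e ⟹ e :≤ con 1 ⟹ con 2 :≤ x′)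
                (∣ X ∣) (∣ X ─ ⁅ e ⁆ ∣) (∣ ⁅ e ⁆ ∣) (card-P v₀)
                (card-cover (X ─ ⁅ e ⁆) ⁅ e ⁆ (sets 2 (λ X e → X :⊑ (X :─ e) :∪ e)))
                (ℕ.≤-reflexive (∣⁅⁆∣ {x = e})))
              (ℕ.≤-trans (s≤s (s≤s z≤n)) (card-P (vertical-sym v₀))))
            (rank-⊑ M (sets 4 (λ Y x e EX → Y :∪ x :⊑ EX ⇒ Y :∪ e :⊑ EX :∪ e) Y₀⊑)) spanned
            (rank-⊑ M E─X⊑) V₀.sum V₀.rP
        ; rQ = ℕ.≤-trans V₀.rQ (rank-⊑ M (sets 3 (λ Y x e → Y :∪ x :⊑ (Y :∪ e) :∪ x)))
        ; sum = linear 7 (λ x′ ye ex exe xx y ρ → x′ :≤ xx ⟹ ye :≤ exe ⟹ exe :≤ ex ⟹ ex :≤ y ⟹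
                    xx :+ y :≤ ρ :+ con 2 ⟹ x′ :+ ye :≤ ρ :+ con 2)
            (r M ((X ─ ⁅ e ⁆) ∪ ⁅ x₀ ⁆)) (r M ((Y ∪ ⁅ e ⁆) ∪ ⁅ x₀ ⁆)) (r M (E M ─ X))
            (r M ((E M ─ X) ∪ ⁅ e ⁆)) (r M (X ∪ ⁅ x₀ ⁆)) (r M (Y ∪ ⁅ x₀ ⁆)) ρ
            (rank-⊑ M (sets 3 (λ X e x → (X :─ e) :∪ x :⊑ X :∪ x)))
            (rank-⊑ M (sets 4 (λ Y x e EX → Y :∪ x :⊑ EX ⇒ (Y :∪ e) :∪ x :⊑ EX :∪ e) Y₀⊑))
            spanned (rank-⊑ M E─X⊑) V₀.sum
        }
      (restrict-small (sets 2 (λ X e → X :─ e :⊑ X)) sm₀)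

    module Closed (closed : ∀ {e} → ⁅ e ⁆ ⊑ X → ¬ (r M ((E M ─ X) ∪ ⁅ e ⁆) ≤ r M (E M ─ X))) where

      minors : ∀ {e} → ⁅ e ⁆ ⊑ X → SmallMinor M 𝓝 e X
      minors {e} e∈ = contract-X M 𝓝 (rank-≥1 V₀.x∈) v₀ sm₀ e∈
        (λ spanned → closed e∈ (ℕ.≤-trans
          (rank-⊑ M (sets 3 (λ A B e → A :⊑ B ⇒ A :∪ e :⊑ B :∪ e) E─X⊑))
          (ℕ.≤-trans spanned (rank-⊑ M Y₀⊑))))

      C-element : ∃[ x ] ⁅ x ⁆ ⊑ X ∩ C
      C-element = [ id , (λ empty → ⊥-elim (C-coclosed x₀∈C (spanned-mono M x₀ (guts v₀)
        (sets 3 (λ X C E → X :⊑ E ⇒ X :∩ C :⊑ :⊥ ⇒ X :⊑ E :─ C) V₀.P⊑ empty)))) ]′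
        (nonempty-or-⊑⊥ (X ∩ C))

      sum-X : r M X + r M (E M ─ X) ≤ ρ + 2
      sum-X = ℕ.≤-trans (ℕ.+-mono-≤ (rank-⊑ M (sets 2 (λ X x → X :⊑ X :∪ x))) (rank-⊑ M E─X⊑)) V₀.sum

      X≥2 : 2 ≤ ∣ X ∣
      X≥2 = ℕ.≤-trans (s≤s (s≤s z≤n)) (card-P v₀)

      module _ {x} (x∈C : ⁅ x ⁆ ⊑ C) (x∈X : ⁅ x ⁆ ⊑ X) where
        module S = SmallMinor (minors x∈X)

        module Uncrossed {P Q} (v : Vertical M x P Q) (P-small : ∣ E S.L ∩ P ∣ ≤ 1) where
          open Vertical v

          shrink-X : ∀ {P Q} (v : Vertical M x P Q) → 2 ≤ ∣ Q ─ X ∣ → 3 ≤ r M ((P ∩ X) ∪ ⁅ x ⁆) → Outcome M C 𝓝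
          shrink-X {P} {Q} v QX≥2 Z≥3 = descend k
            (smaller (P ∩ X) (card-strict (sets 2 (λ P X → P :∩ X :⊑ X)) x∈X
              (sets 3 (λ x P X → x :∩ P :⊑ :⊥ ⇒ x :∩ (P :∩ X) :⊑ :⊥) (Vertical.x∉P v)))) x∈C
            (shrink v x∈X (uncross v V₀.P⊑ x∈X sum-X X≥2 QX≥2) Z≥3)
            (restrict-small (sets 2 (λ P X → P :∩ X :⊑ X)) (minors x∈X))

          Q─X≥2 : 2 ≤ ∣ Q ─ X ∣
          Q─X≥2 = linear 5 (λ l p s xl q → con 4 :≤ l ⟹ l :≤ p :+ s ⟹ s :≤ xl :+ q ⟹ p :≤ con 1 ⟹
                        xl :≤ con 1 ⟹ con 2 :≤ q)
            (∣ E S.L ∣) (∣ E S.L ∩ P ∣) (∣ (E S.L ∩ X) ∪ (Q ─ X) ∣) (∣ E S.L ∩ X ∣) (∣ Q ─ X ∣)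
            (four-elements S.member)
            (card-cover (E S.L ∩ P) ((E S.L ∩ X) ∪ (Q ─ X)) (sets 6 (λ E P x Q L X → L :⊑ E ⇒
              E :⊑ P :∪ x :∪ Q ⇒ x :⊑ X ⇒ L :⊑ (L :∩ P) :∪ ((L :∩ X) :∪ (Q :─ X)))
              (IsMinor.ground S.minor) cover x∈X))
            (card-cover (E S.L ∩ X) (Q ─ X) ⊑-refl) P-small S.small

          plane : r M ((P ∩ X) ∪ ⁅ x ⁆) ≤ 2 → r M ((Q ∩ X) ∪ ⁅ x ⁆) ≤ 2 → r M X ≤ 3
          plane rP rQ = linear 4 (λ X o p q → X :+ o :≤ p :+ q ⟹ con 1 :≤ o ⟹ p :≤ con 2 ⟹
                            q :≤ con 2 ⟹ X :≤ con 3)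
            (r M X) (r M ⁅ x ⁆) (r M ((P ∩ X) ∪ ⁅ x ⁆)) (r M ((Q ∩ X) ∪ ⁅ x ⁆))
            (submod M ((P ∩ X) ∪ ⁅ x ⁆) ((Q ∩ X) ∪ ⁅ x ⁆)
              (sets 5 (λ E P x Q X → X :⊑ E ⇒ E :⊑ P :∪ x :∪ Q ⇒
                X :⊑ ((P :∩ X) :∪ x) :∪ ((Q :∩ X) :∪ x)) V₀.P⊑ cover)
              (sets 3 (λ P Q x → x :⊑ (P :∪ x) :∩ (Q :∪ x)))) (rank-≥1 x∈) rP rQ

          P─X≥2 : r M ((P ∩ X) ∪ ⁅ x ⁆) ≤ 2 → ∣ X ∣ ≤ ∣ P ∣ → 2 ≤ ∣ P ─ X ∣
          P─X≥2 rZ X≤P = ℕ.≮⇒≥ λ few → ℕ.<⇒≱ (ℕ.≤-trans V₀.rP (guts v₀))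
            (ℕ.≤-trans (rank-⊑ M (X⊑ (ℕ.≤-pred few))) rZ)
            where
            X⊑ : ∣ P ─ X ∣ ≤ 1 → X ⊑ (P ∩ X) ∪ ⁅ x ⁆
            X⊑ few = [ (λ (d , d∈) → ⊥-elim (linear 6
                (λ X p z q zx o → X :≤ p ⟹ p :≤ z :+ q ⟹ q :≤ con 1 ⟹ z :+ o :≤ zx ⟹ con 1 :≤ o ⟹
                   con 1 :+ zx :≤ X ⟹ :false)
                (∣ X ∣) (∣ P ∣) (∣ P ∩ X ∣) (∣ P ─ X ∣) (∣ (P ∩ X) ∪ ⁅ x ⁆ ∣) (∣ ⁅ x ⁆ ∣)
                X≤P (card-cover (P ∩ X) (P ─ X) (sets 2 (λ P X → P :⊑ (P :∩ X) :∪ (P :─ X)))) few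
                (card-disjoint ⊑-refl (sets 3 (λ x P X → x :∩ P :⊑ :⊥ ⇒ (P :∩ X) :∩ x :⊑ :⊥) x∉P))
                (card-≥1 {X = ⁅ x ⁆} ⊑-refl)
                (card-strict (sets 3 (λ P X x → x :⊑ X ⇒ (P :∩ X) :∪ x :⊑ X) x∈X)
                  (sets 3 (λ d X Z → d :⊑ X :─ Z ⇒ d :⊑ X) d∈)
                  (sets 3 (λ d X Z → d :⊑ X :─ Z ⇒ d :∩ Z :⊑ :⊥) d∈))))
              , (λ empty → sets 2 (λ X Z → X :─ Z :⊑ :⊥ ⇒ X :⊑ Z) empty) ]′
              (nonempty-or-⊑⊥ (X ─ ((P ∩ X) ∪ ⁅ x ⁆)))

          by-rank : Dec (3 ≤ r M ((P ∩ X) ∪ ⁅ x ⁆)) → Dec (suc ∣ P ∣ ≤ ∣ X ∣) →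
                    Dec (3 ≤ r M ((Q ∩ X) ∪ ⁅ x ⁆)) → Outcome M C 𝓝
          by-rank (yes Z≥3) _ _ = shrink-X v Q─X≥2 Z≥3
          by-rank (no _) (yes P<X) _ = descend k (smaller P P<X) x∈C v record
            { minor = S.minor ; member = S.member ; x∈T = S.x∈T ; small = P-small }
          by-rank (no Z≱3) (no P≮X) (yes W≥3) = shrink-X (vertical-sym v)
            (P─X≥2 (ℕ.≤-pred (ℕ.≰⇒> Z≱3)) (ℕ.≮⇒≥ P≮X)) W≥3
          by-rank (no Z≱3) (no P≮X) (no W≱3) = PlaneCase.Plane.plane-outcome
            M conn large C-coclosed 𝓝 v₀ x₀∈C closed
            (λ e∈ → restrict-small (sets 1 (λ X → :⊥ :⊑ X)) (minors e∈))
            (plane (ℕ.≤-pred (ℕ.≰⇒> Z≱3)) (ℕ.≤-pred (ℕ.≰⇒> W≱3))) x∈C x∈X v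

          uncrossed : Outcome M C 𝓝
          uncrossed = by-rank (3 ℕ.≤? _) (suc ∣ P ∣ ℕ.≤? _) (3 ℕ.≤? _)

        at-x : Outcome M C 𝓝
        at-x = [ (λ (_ , _ , v) → [ Uncrossed.uncrossed v , Uncrossed.uncrossed (vertical-sym v) ]′
                   (small-side v S.minor S.member S.x∈T))
               , si-connected x∈C (restrict-small (sets 1 (λ X → :⊥ :⊑ X)) (minors x∈X)) ]′
               (vertical? M (⊑-trans x∈X V₀.P⊑))

      closed-outcome : Outcome M C 𝓝
      closed-outcome = let x , x∈ = C-element in
        at-x (sets 3 (λ x X C → x :⊑ X :∩ C ⇒ x :⊑ C) x∈) (sets 3 (λ x X C → x :⊑ X :∩ C ⇒ x :⊑ X) x∈)

    by-closure : Dec (∃[ e ] (e ∈ X × r M ((E M ─ X) ∪ ⁅ e ⁆) ≤ r M (E M ─ X))) → Outcome M C 𝓝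
    by-closure (yes (e , e∈ , spanned)) = enlarge-Y (∈⇒⊑ e∈) spanned
    by-closure (no closed) = Closed.closed-outcome λ e∈ spanned → closed (_ , ⊑⇒∈ e∈ , spanned)

  outcome : ∀ {x₀ L T} → ⁅ x₀ ⁆ ⊑ C → IsMinor M L T → Member L → ⁅ x₀ ⁆ ⊑ T → Outcome M C 𝓝
  outcome {x₀} {L} {T} x₀∈C minor member x₀∈T =
    [ (λ (X , Y , v) → [ (λ small → start v small) , (λ small → start (vertical-sym v) small) ]′
        (small-side v minor member x₀∈T))
    , si-connected x₀∈C record { minor = minor ; member = member ; x∈T = x₀∈T
        ; small = ℕ.≤-trans (∣⊑⊥∣ {X = E L ∩ ⊥} (sets 1 (λ F → F :∩ :⊥ :⊑ :⊥))) z≤n } ]′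
    (vertical? M (⊑-trans x₀∈C C⊑E))
    where
    start : ∀ {X Y} → Vertical M x₀ X Y → ∣ E L ∩ X ∣ ≤ 1 → Outcome M C 𝓝
    start {X} v small = descend ∣ X ∣ ℕ.≤-refl x₀∈C v
      record { minor = minor ; member = member ; x∈T = x₀∈T ; small = small }

-- Simplification and duality

comprehension : ∀ {P : Fin n → Set} → (∀ e → Dec (P e)) → Subset n
comprehension P? = tabulate (λ e → does (P? e))

∈-comprehension⁺ : ∀ {P : Fin n → Set} (P? : ∀ e → Dec (P e)) {e} → P e → e ∈ comprehension P?
∈-comprehension⁺ P? {e} p = lookup⇒[]= e _ (trans (lookup∘tabulate _ e) (dec-true (P? e) p))

∈-comprehension⁻ : ∀ {P : Fin n → Set} (P? : ∀ e → Dec (P e)) {e} → e ∈ comprehension P? → P e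
∈-comprehension⁻ P? {e} e∈ with P? e | trans (sym (lookup∘tabulate (λ e → does (P? e)) e)) ([]=⇒lookup e∈)
... | yes p | _  = p
... | no _  | ()

spanned-all : (M : Matroid n) (U : Subset n) → ∀ {A} → (∀ {e} → ⁅ e ⁆ ⊑ A → r M (U ∪ ⁅ e ⁆) ≤ r M U) →
              r M (U ∪ A) ≤ r M U
spanned-all {n} M U {A} spanned = go (∣ A ∣) ℕ.≤-refl spanned
  where
  go : ∀ k {A} → ∣ A ∣ ≤ k → (∀ {e} → ⁅ e ⁆ ⊑ A → r M (U ∪ ⁅ e ⁆) ≤ r M U) → r M (U ∪ A) ≤ r M U
  go k {A} bound s with nonempty-or-⊑⊥ A
  ... | inj₂ empty = rank-⊑ M (sets 2 (λ U A → A :⊑ :⊥ ⇒ U :∪ A :⊑ U) empty)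
  ... | inj₁ (e , e∈) with k
  ...   | zero   = ⊥-elim (ℕ.<⇒≱ (card-≥1 e∈) bound)
  ...   | suc k′ = linear 4 (λ ua u ue uae → ua :+ u :≤ ue :+ uae ⟹ ue :≤ u ⟹ uae :≤ u ⟹ ua :≤ u)
          (r M (U ∪ A)) (r M U) (r M (U ∪ ⁅ e ⁆)) (r M (U ∪ (A ─ ⁅ e ⁆)))
          (submod M (U ∪ ⁅ e ⁆) (U ∪ (A ─ ⁅ e ⁆))
            (sets 3 (λ U A e → U :∪ A :⊑ (U :∪ e) :∪ (U :∪ (A :─ e))))
            (sets 3 (λ U A e → U :⊑ (U :∪ e) :∩ (U :∪ (A :─ e)))))
          (s e∈)
          (go k′ (ℕ.≤-pred (ℕ.≤-trans (card-strict {X = A ─ ⁅ e ⁆} (sets 2 (λ A e → A :─ e :⊑ A)) e∈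
                    (sets 2 (λ A e → e :∩ (A :─ e) :⊑ :⊥))) bound))
                 (λ f∈ → s (⊑-trans f∈ (sets 2 (λ A e → A :─ e :⊑ A)))))

-- Circuits

circuit-intro : (M : Matroid n) {X : Subset n} → X ⊑ E M → r M X ℕ.< ∣ X ∣ →
                (∀ {D} → D ⊑ X → ∣ D ∣ ℕ.< ∣ X ∣ → ∣ D ∣ ≤ r M D) → Circuit M X
circuit-intro M X⊑ dependent indep =
  ⊑⇒⊆ X⊑ , (λ (_ , eq) → ℕ.<⇒≢ dependent eq) , λ D D⊂X →
  let D⊑X = ⊆⇒⊑ (p⊂q⇒p⊆q D⊂X)
  in ⊑⇒⊆ (⊑-trans D⊑X X⊑) , ℕ.≤-antisym (rank-card M D) (indep D⊑X (p⊂q⇒∣p∣<∣q∣ D⊂X))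

circuit-rank : (M : Matroid n) {X : Subset n} → Circuit M X → r M X ℕ.< ∣ X ∣
circuit-rank M (X⊆ , ¬indep , _) = ℕ.≤∧≢⇒< (rank-card M _) (λ eq → ¬indep (X⊆ , eq))

small-independent : (M : Matroid n) {D : Subset n} → (∀ {e} → ⁅ e ⁆ ⊑ D → 1 ≤ r M ⁅ e ⁆) →
                    ∣ D ∣ ≤ 1 → ∣ D ∣ ≤ r M D
small-independent M {D} nonloop D≤1 with nonempty-or-⊑⊥ D
... | inj₂ empty     = ℕ.≤-trans (∣⊑⊥∣ empty) z≤n
... | inj₁ (e , e∈) = ℕ.≤-trans D≤1 (ℕ.≤-trans (nonloop e∈) (rank-⊑ M e∈))

-- Duality

dual-rank : (M : Matroid n) (X : Subset n) →
            r (dual M) X + r M (E M) ≡ ∣ X ∩ E M ∣ + r M (E M ─ X)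
dual-rank M X = ℕ.m∸n+n≡m (ℕ.≤-trans
  (rank-cover M (X ∩ E M) (E M ─ X) (sets 2 (λ E X → E :⊑ (X :∩ E) :∪ (E :─ X))))
  (ℕ.+-monoˡ-≤ _ (rank-card M _)))

dual-connected : (M : Matroid n) → Connected 3 M → Connected 3 (dual M)
dual-connected M conn = connected-intro (dual M) λ k 1≤k k<3 X X⊑ kX kY →
  linear 12
    (λ k e x y ρ cx cy ce rx ry r0 ry′ →
       ρ :+ k :≤ rx :+ ry ⟹ cx :+ ry := x :+ ρ ⟹ cy :+ ry′ := y :+ ρ ⟹ e :+ ρ := ce :+ r0 ⟹
       r0 := con 0 ⟹ ce :≤ cx :+ cy ⟹ rx :≤ ry′ ⟹ e :+ k :≤ x :+ y)
    k (r (dual M) (E M)) (r (dual M) X) (r (dual M) (E M ─ X)) (r M (E M))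
    (∣ X ∩ E M ∣) (∣ (E M ─ X) ∩ E M ∣) (∣ E M ∩ E M ∣)
    (r M X) (r M (E M ─ X)) (r M (E M ─ E M)) (r M (E M ─ (E M ─ X)))
    (separation-bound M conn k 1≤k k<3 {A = X} {E M ─ X}
      (sets 2 (λ X E → X :⊑ E ⇒ X :⊑ X :∩ E) X⊑) (sets 2 (λ X E → E :─ X :⊑ (E :─ X) :∩ E))
      (sets 2 (λ X E → X :∩ (E :─ X) :⊑ :⊥)) (sets 2 (λ X E → E :⊑ X :∪ (E :─ X))) kX kY)
    (sym (dual-rank M X)) (sym (dual-rank M (E M ─ X))) (dual-rank M (E M))
    (rank-⊥ M (sets 1 (λ E → E :─ E :⊑ :⊥)))
    (card-cover (X ∩ E M) ((E M ─ X) ∩ E M)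
      (sets 2 (λ X E → E :∩ E :⊑ (X :∩ E) :∪ ((E :─ X) :∩ E))))
    (rank-⊑ M (sets 2 (λ X E → X :⊑ E ⇒ X :⊑ E :─ (E :─ X)) X⊑))

VerticalBound : ℕ → Matroid n → Set
VerticalBound k K = ∀ {P Q} → P ⊑ E K → Q ⊑ E K → E K ⊑ P ∪ Q → P ∩ Q ⊑ ⊥ →
                    k ≤ r K P → k ≤ r K Q → r K (E K) + k ≤ r K P + r K Q

redundant : Matroid n → Subset n
redundant K = tabulate (λ e → does (redundant? K e))

module Simplification {n} (K : Matroid n) where

  R Eₛ : Subset n
  R  = redundant K
  Eₛ = E K ─ R

  circuit-pair⁻ : ∀ {f e} → f ≢ e → Circuit K (⁅ f ⁆ ∪ ⁅ e ⁆) →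
                  ⁅ f ⁆ ⊑ E K × 1 ≤ r K ⁅ f ⁆ × r K (⁅ f ⁆ ∪ ⁅ e ⁆) ≤ 1
  circuit-pair⁻ {f} {e} f≢e circuit@(⊆E , _ , indep) =
    ⊑-trans (sets 2 (λ f e → f :⊑ f :∪ e)) (⊆⇒⊑ ⊆E) ,
    ≡-≤-trans (sym (∣⁅⁆∣ {x = f})) (ℕ.≤-reflexive (sym (proj₂ (indep ⁅ f ⁆
      (⊑⇒⊆ (sets 2 (λ f e → f :⊑ f :∪ e)) , e , ⊑⇒∈ (sets 2 (λ f e → e :⊑ f :∪ e)) ,
       x≢y⇒x∉⁅y⁆ (f≢e ∘ sym)))))) ,
    ℕ.≤-pred (ℕ.≤-trans (circuit-rank K circuit) (card-pair-≤ f e))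

  Represented : Fin n → Set
  Represented e = r K ⁅ e ⁆ ≤ 0 ⊎ ∃[ f ] (⁅ f ⁆ ⊑ Eₛ × r K (⁅ f ⁆ ∪ ⁅ e ⁆) ≤ r K ⁅ f ⁆)

  representative : ∀ {e} → ⁅ e ⁆ ⊑ R → Represented e
  representative {e} e∈ = go e (Fin.<-wellFounded e) (∈-comprehension⁻ (redundant? K) (⊑⇒∈ e∈))
    where
    go : ∀ e → Acc Fin._<_ e → Redundant K e → Represented e
    go e _ (inj₁ loop) = inj₁ (ℕ.≤-pred (≤-≡-trans (circuit-rank K loop) (∣⁅⁆∣ {x = e})))
    go e (acc rec) (inj₂ (f , f<e , f≢e , circuit)) = by-redundancy (circuit-pair⁻ f≢e circuit) (redundant? K f)
      where
      by-redundancy : ⁅ f ⁆ ⊑ E K × 1 ≤ r K ⁅ f ⁆ × r K (⁅ f ⁆ ∪ ⁅ e ⁆) ≤ 1 → Dec (Redundant K f) → Represented e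
      by-redundancy (f∈ , f≥1 , fe≤1) (no ¬red) = inj₂ (f
        , sets 3 (λ f E R → f :⊑ E ⇒ f :∩ R :⊑ :⊥ ⇒ f :⊑ E :─ R) f∈
            (∉⇒⊑ (¬red ∘ ∈-comprehension⁻ (redundant? K)))
        , ℕ.≤-trans fe≤1 f≥1)
      by-redundancy (_ , f≥1 , fe≤1) (yes red) =
        [ (λ f≤0 → ⊥-elim (ℕ.<⇒≱ f≥1 f≤0)) , further f≥1 fe≤1 ]′ (go f (rec f<e) red)
        where
        further : 1 ≤ r K ⁅ f ⁆ → r K (⁅ f ⁆ ∪ ⁅ e ⁆) ≤ 1 → ∃[ g ] (⁅ g ⁆ ⊑ Eₛ × r K (⁅ g ⁆ ∪ ⁅ f ⁆) ≤ r K ⁅ g ⁆) → Represented e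
        further f≥1 fe≤1 (g , g∈ , gf) = inj₂ (g , g∈ , linear 5
          (λ ge f gf fe g → ge :+ f :≤ gf :+ fe ⟹ fe :≤ con 1 ⟹ con 1 :≤ f ⟹ gf :≤ g ⟹ ge :≤ g)
          (r K (⁅ g ⁆ ∪ ⁅ e ⁆)) (r K ⁅ f ⁆) (r K (⁅ g ⁆ ∪ ⁅ f ⁆)) (r K (⁅ f ⁆ ∪ ⁅ e ⁆)) (r K ⁅ g ⁆)
          (submod K (⁅ g ⁆ ∪ ⁅ f ⁆) (⁅ f ⁆ ∪ ⁅ e ⁆) (sets 3 (λ g f e → g :∪ e :⊑ (g :∪ f) :∪ (f :∪ e)))
            (sets 3 (λ g f e → f :⊑ (g :∪ f) :∩ (f :∪ e)))) fe≤1 f≥1 gf)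

  irredundant : ∀ {e} → ⁅ e ⁆ ⊑ Eₛ → ¬ Redundant K e
  irredundant {e} e∈ red = ⁅⁆⋢⊥ {x = e} (sets 3 (λ e E R → e :⊑ E :─ R ⇒ e :⊑ R ⇒ e :⊑ :⊥) e∈
    (∈⇒⊑ (∈-comprehension⁺ (redundant? K) red)))

  Eₛ⊑E : Eₛ ⊑ E K
  Eₛ⊑E = sets 2 (λ E R → E :─ R :⊑ E)

  Eₛ-no-loops : ∀ {e} → ⁅ e ⁆ ⊑ Eₛ → 1 ≤ r K ⁅ e ⁆
  Eₛ-no-loops {e} e∈ = ℕ.≮⇒≥ λ e<1 → irredundant e∈ (inj₁ (circuit-intro K (⊑-trans e∈ Eₛ⊑E)
    (≤-≡-trans e<1 (sym (∣⁅⁆∣ {x = e})))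
    λ _ D< → ℕ.≤-trans (ℕ.≤-pred (≤-≡-trans D< (∣⁅⁆∣ {x = e}))) z≤n))

  Eₛ-no-parallel : ∀ {e f} → e ≢ f → ⁅ e ⁆ ⊑ Eₛ → ⁅ f ⁆ ⊑ Eₛ → 2 ≤ r K (⁅ e ⁆ ∪ ⁅ f ⁆)
  Eₛ-no-parallel {e} {f} e≢f e∈ f∈ = ℕ.≮⇒≥ λ small → by-order small (Fin.<-cmp e f)
    where
    parallel : ∀ {e f} → e ≢ f → ⁅ e ⁆ ⊑ Eₛ → ⁅ f ⁆ ⊑ Eₛ → r K (⁅ e ⁆ ∪ ⁅ f ⁆) ℕ.< 2 → Parallel K e f
    parallel {e} {f} e≢f e∈ f∈ small = e≢f , circuit-intro K
      (sets 3 (λ e f E → e :⊑ E ⇒ f :⊑ E ⇒ e :∪ f :⊑ E) (⊑-trans e∈ Eₛ⊑E) (⊑-trans f∈ Eₛ⊑E))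
      (ℕ.≤-trans small (card-≥2 e≢f (sets 2 (λ e f → e :⊑ e :∪ f)) (sets 2 (λ e f → f :⊑ e :∪ f))))
      λ D⊑ D< → small-independent K
        (λ d∈ → Eₛ-no-loops (sets 5 (λ d D e f E → d :⊑ D ⇒ D :⊑ e :∪ f ⇒ e :⊑ E ⇒ f :⊑ E ⇒ d :⊑ E)
                  d∈ D⊑ e∈ f∈))
        (ℕ.≤-pred (ℕ.≤-trans D< (card-pair-≤ e f)))

    by-order : r K (⁅ e ⁆ ∪ ⁅ f ⁆) ℕ.< 2 → Tri (e Fin.< f) (e ≡ f) (f Fin.< e) → Absurd
    by-order small (tri< e<f _ _) = irredundant f∈ (inj₂ (e , e<f , parallel e≢f e∈ f∈ small))
    by-order small (tri≈ _ e≡f _) = e≢f e≡f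
    by-order small (tri> _ _ f<e) = irredundant e∈ (inj₂ (f , f<e , parallel (e≢f ∘ sym) f∈ e∈
      (ℕ.≤-<-trans (rank-⊑ K (sets 2 (λ e f → f :∪ e :⊑ e :∪ f))) small)))

  rank≥card : ∀ {k U} → k ℕ.< 3 → U ⊑ Eₛ → k ≤ ∣ U ∣ → k ≤ r K U
  rank≥card {0} _ _ _ = z≤n
  rank≥card {1} {U} _ U⊑ U≥1 = let e , e∈ = ≥1⇒element U≥1 in
    ℕ.≤-trans (Eₛ-no-loops (⊑-trans e∈ U⊑)) (rank-⊑ K e∈)
  rank≥card {2} {U} _ U⊑ U≥2 =
    let e , e∈ = ≥1⇒element {X = U} (ℕ.≤-trans (s≤s z≤n) U≥2) in
    [ (λ (f , f∈) → ℕ.≤-trans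
         (Eₛ-no-parallel (separated⇒≢ f∈ (sets 2 (λ U e → e :∩ (U :─ e) :⊑ :⊥)))
            (⊑-trans f∈ (⊑-trans (sets 2 (λ U e → U :─ e :⊑ U)) U⊑)) (⊑-trans e∈ U⊑))
         (rank-⊑ K (sets 3 (λ U e f → e :⊑ U ⇒ f :⊑ U :─ e ⇒ f :∪ e :⊑ U) e∈ f∈)))
    , (λ empty → ⊥-elim (ℕ.<⇒≱ U≥2 (≤-≡-trans
         (card-mono (sets 2 (λ U e → U :─ e :⊑ :⊥ ⇒ U :⊑ e) empty)) (∣⁅⁆∣ {x = e})))) ]′
    (nonempty-or-⊑⊥ (U ─ ⁅ e ⁆))
  rank≥card {suc (suc (suc _))} (s≤s (s≤s (s≤s ())))

  -- Every redundant element joins the side of its representative.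
  record Extension (U V : Subset n) : Set where
    field
      {P Q}  : Subset n
      P⊑     : P ⊑ E K
      Q⊑     : Q ⊑ E K
      cover  : E K ⊑ P ∪ Q
      P∩Q    : P ∩ Q ⊑ ⊥
      U⊑P    : U ⊑ P
      V⊑Q    : V ⊑ Q
      rP     : r K P ≤ r K U
      rQ     : r K Q ≤ r K V

  extend : ∀ {U V} → U ⊑ Eₛ → V ⊑ Eₛ → Eₛ ⊑ U ∪ V → U ∩ V ⊑ ⊥ → Extension U V
  extend {U} {V} U⊑ V⊑ cover disj = record
    { P = P ; Q = Q
    ; P⊑ = sets 4 (λ U E R C → U :⊑ E :─ R ⇒ U :∪ ((E :∩ R) :∩ C) :⊑ E) U⊑
    ; Q⊑ = sets 4 (λ V E R C → V :⊑ E :─ R ⇒ V :∪ ((E :∩ R) :─ C) :⊑ E) V⊑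
    ; cover = sets 5 (λ U V E R C → E :─ R :⊑ U :∪ V ⇒
        E :⊑ (U :∪ ((E :∩ R) :∩ C)) :∪ (V :∪ ((E :∩ R) :─ C))) cover
    ; P∩Q = sets 5 (λ U V E R C → U :⊑ E :─ R ⇒ V :⊑ E :─ R ⇒ U :∩ V :⊑ :⊥ ⇒
        (U :∪ ((E :∩ R) :∩ C)) :∩ (V :∪ ((E :∩ R) :─ C)) :⊑ :⊥) U⊑ V⊑ disj
    ; U⊑P = sets 2 (λ U A → U :⊑ U :∪ A)
    ; V⊑Q = sets 2 (λ U A → U :⊑ U :∪ A)
    ; rP = spanned-all K U λ e∈ → ∈-comprehension⁻ spanned?
             (⊑⇒∈ (⊑-trans e∈ (sets 2 (λ A C → A :∩ C :⊑ C))))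
    ; rQ = spanned-all K V λ e∈ → spanned-by-V (⊑-trans e∈ (sets 3 (λ E R C → (E :∩ R) :─ C :⊑ R)))
             (sets 3 (λ e A C → e :⊑ A :─ C ⇒ e :∩ C :⊑ :⊥) e∈)
    }
    where
    spanned? : ∀ e → Dec (r K (U ∪ ⁅ e ⁆) ≤ r K U)
    spanned? e = _ ℕ.≤? _

    C P Q : Subset n
    C = comprehension spanned?
    P = U ∪ ((E K ∩ R) ∩ C)
    Q = V ∪ ((E K ∩ R) ─ C)

    spanned-by-V : ∀ {e} → ⁅ e ⁆ ⊑ R → ⁅ e ⁆ ∩ C ⊑ ⊥ → r K (V ∪ ⁅ e ⁆) ≤ r K V
    spanned-by-V {e} e∈R e∉C = [ (λ loop → ℕ.≤-trans (rank-cover K V ⁅ e ⁆ ⊑-refl)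
          (≤-≡-trans (ℕ.+-monoʳ-≤ (r K V) loop) (ℕ.+-identityʳ _))) , by-f ]′ (representative e∈R)
      where
      by-f : ∃[ f ] (⁅ f ⁆ ⊑ Eₛ × r K (⁅ f ⁆ ∪ ⁅ e ⁆) ≤ r K ⁅ f ⁆) → r K (V ∪ ⁅ e ⁆) ≤ r K V
      by-f (f , f∈ , sp) = spanned-mono K e sp (sets 4 (λ f S U V → f :⊑ S ⇒ S :⊑ U :∪ V ⇒ f :∩ U :⊑ :⊥ ⇒ f :⊑ V)
        f∈ cover f∉U)
        where
        f∉U : ⁅ f ⁆ ∩ U ⊑ ⊥
        f∉U = [ (λ f∈U → ⊥-elim (⁅⁆⋢⊥ {x = e} (sets 2 (λ e C → e :⊑ C ⇒ e :∩ C :⊑ :⊥ ⇒ e :⊑ :⊥)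
                  (∈⇒⊑ (∈-comprehension⁺ spanned? (spanned-mono K e sp f∈U))) e∉C)))
              , id ]′ (∈-or-∉ f U)

  si-rank : ∀ {U} → U ⊑ Eₛ → r (si K) U ≡ r K U
  si-rank U⊑ = cong (r K) (sets 2 (λ U E → U :⊑ E ⇒ U :∩ E :≡ U) U⊑)

  si-bound : ∀ {k} → k ℕ.< 3 → VerticalBound k K → ∀ {U V} → U ⊑ Eₛ → V ⊑ Eₛ → Eₛ ⊑ U ∪ V → U ∩ V ⊑ ⊥ →
             k ≤ ∣ U ∣ → k ≤ ∣ V ∣ → r K Eₛ + k ≤ r K U + r K V
  si-bound {k} k<3 bound {U} {V} U⊑ V⊑ cover disj kU kV = linear 7
    (λ k e s p q u v → e :+ k :≤ p :+ q ⟹ s :≤ e ⟹ p :≤ u ⟹ q :≤ v ⟹ s :+ k :≤ u :+ v)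
    k (r K (E K)) (r K Eₛ) (r K X.P) (r K X.Q) (r K U) (r K V)
    (bound X.P⊑ X.Q⊑ X.cover X.P∩Q
      (ℕ.≤-trans (rank≥card k<3 U⊑ kU) (rank-⊑ K X.U⊑P))
      (ℕ.≤-trans (rank≥card k<3 V⊑ kV) (rank-⊑ K X.V⊑Q)))
    (rank-⊑ K Eₛ⊑E) X.rP X.rQ
    where module X = Extension (extend U⊑ V⊑ cover disj)

si-3-connected : (K : Matroid n) → VerticalBound 1 K → VerticalBound 2 K → Connected 3 (si K)
si-3-connected K b₁ b₂ = connected-intro (si K) λ k 1≤k k<3 X X⊑ kX kY →
  subst₂ (λ a b → a + k ≤ b) (sym (si-rank ⊑-refl))
    (sym (cong₂ _+_ (si-rank X⊑) (si-rank (sets 2 (λ E X → E :─ X :⊑ E)))))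
    (si-bound k<3 (bound k 1≤k k<3) X⊑ (sets 2 (λ E X → E :─ X :⊑ E))
      (sets 2 (λ E X → E :⊑ X :∪ (E :─ X))) (sets 2 (λ E X → X :∩ (E :─ X) :⊑ :⊥)) kX kY)
  where
  open Simplification K
  bound : ∀ k → 1 ≤ k → k ℕ.< 3 → VerticalBound k K
  bound 1 _ _ = b₁
  bound 2 _ _ = b₂
  bound (suc (suc (suc _))) _ (s≤s (s≤s (s≤s ())))

-- If the simplification has at most two elements on one side of every
-- 2-separation, then these two elements are in series.
si-dual-si-3-connected : (K : Matroid n) {L : Subset n} → r K L ≤ 1 → VerticalBound 1 K →
  (∀ {P Q} → P ⊑ E K → Q ⊑ E K → E K ⊑ P ∪ Q → P ∩ Q ⊑ ⊥ → 2 ≤ r K P → 2 ≤ r K Q →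
     r K P + r K Q ≤ r K (E K) + 1 → ∣ P ─ L ∣ ≤ 1 ⊎ ∣ Q ─ L ∣ ≤ 1) →
  Connected 3 (si (dual (si K)))
si-dual-si-3-connected {n} K {L} rL b₁ near = si-3-connected (dual (si K))
  (λ U⊑ V⊑ cover disj U≥1 V≥1 → dual-bound U⊑ V⊑ cover disj
     (si-bound (s≤s (s≤s z≤n)) b₁ U⊑ V⊑ cover disj
       (ℕ.≤-trans U≥1 (rank-card (dual (si K)) _)) (ℕ.≤-trans V≥1 (rank-card (dual (si K)) _))))
  (λ U⊑ V⊑ cover disj U≥2 V≥2 → dual-bound U⊑ V⊑ cover disj (ℕ.≮⇒≥ λ small →
     [ two-elements U⊑ V⊑ cover disj U≥2 V≥2 small
     , two-elements V⊑ U⊑ (sets 3 (λ E U V → E :⊑ U :∪ V ⇒ E :⊑ V :∪ U) cover)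
         (sets 2 (λ U V → U :∩ V :⊑ :⊥ ⇒ V :∩ U :⊑ :⊥) disj) V≥2 U≥2
         (≡-≤-trans (cong suc (ℕ.+-comm (r K _) (r K _))) small) ]′
     (near-side U⊑ V⊑ cover disj U≥2 V≥2 small)))
  where
  open Simplification K
  J : Matroid n
  J = si K

  dual-si-rank : ∀ {U V} → U ⊑ Eₛ → V ⊑ Eₛ → Eₛ ⊑ U ∪ V → U ∩ V ⊑ ⊥ →
                 r (dual J) U + r K Eₛ ≡ ∣ U ∣ + r K V
  dual-si-rank {U} {V} U⊑ V⊑ cover disj = trans
    (cong (r (dual J) U +_) (sym (si-rank ⊑-refl)))
    (trans (dual-rank J U) (cong₂ _+_ (cong ∣_∣ (sets 2 (λ U E → U :⊑ E ⇒ U :∩ E :≡ U) U⊑))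
      (cong (r K) (sets 3 (λ U V E → U :⊑ E ⇒ V :⊑ E ⇒ E :⊑ U :∪ V ⇒ U :∩ V :⊑ :⊥ ⇒
         (E :─ U) :∩ E :≡ V) U⊑ V⊑ cover disj))))

  dual-bound : ∀ {k U V} → U ⊑ Eₛ → V ⊑ Eₛ → Eₛ ⊑ U ∪ V → U ∩ V ⊑ ⊥ →
               r K Eₛ + k ≤ r K U + r K V → r (dual J) Eₛ + k ≤ r (dual J) U + r (dual J) V
  dual-bound {k} {U} {V} U⊑ V⊑ cover disj bound = linear 11
    (λ k ρ u v e du dv cu cv ce o → ρ :+ k :≤ u :+ v ⟹ cu :+ v := du :+ ρ ⟹ cv :+ u := dv :+ ρ ⟹
       e :+ ρ := ce :+ o ⟹ o := con 0 ⟹ ce :≤ cu :+ cv ⟹ e :+ k :≤ du :+ dv)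
    k (r K Eₛ) (r K U) (r K V) (r (dual J) Eₛ) (r (dual J) U) (r (dual J) V) (∣ U ∣) (∣ V ∣) (∣ Eₛ ∣) (r K ⊥)
    bound (sym (dual-si-rank U⊑ V⊑ cover disj))
    (sym (dual-si-rank V⊑ U⊑ (sets 3 (λ E U V → E :⊑ U :∪ V ⇒ E :⊑ V :∪ U) cover)
         (sets 2 (λ U V → U :∩ V :⊑ :⊥ ⇒ V :∩ U :⊑ :⊥) disj)))
    (dual-si-rank {Eₛ} {⊥} ⊑-refl (sets 1 (λ E → :⊥ :⊑ E)) (sets 1 (λ E → E :⊑ E :∪ :⊥))
      (sets 1 (λ E → E :∩ :⊥ :⊑ :⊥)))
    (rank-⊥ K ⊑-refl) (card-cover U V cover)

  module _ {U V} (U⊑ : U ⊑ Eₛ) (V⊑ : V ⊑ Eₛ) (cover : Eₛ ⊑ U ∪ V) (disj : U ∩ V ⊑ ⊥)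
    (U≥2 : 2 ≤ r (dual J) U) (V≥2 : 2 ≤ r (dual J) V) (small : r K U + r K V ℕ.< r K Eₛ + 2) where

    rU : 2 ≤ r K U
    rU = rank≥card (s≤s (s≤s (s≤s z≤n))) U⊑ (ℕ.≤-trans U≥2 (rank-card (dual J) _))

    rV : 2 ≤ r K V
    rV = rank≥card (s≤s (s≤s (s≤s z≤n))) V⊑ (ℕ.≤-trans V≥2 (rank-card (dual J) _))

    near-side : ∣ U ─ L ∣ ≤ 1 ⊎ ∣ V ─ L ∣ ≤ 1
    near-side = [ (λ b → inj₁ (ℕ.≤-trans (card-mono (sets 3 (λ U P L → U :⊑ P ⇒ U :─ L :⊑ P :─ L) X.U⊑P)) b))
                , (λ b → inj₂ (ℕ.≤-trans (card-mono (sets 3 (λ U P L → U :⊑ P ⇒ U :─ L :⊑ P :─ L) X.V⊑Q)) b)) ]′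
      (near X.P⊑ X.Q⊑ X.cover X.P∩Q (ℕ.≤-trans rU (rank-⊑ K X.U⊑P)) (ℕ.≤-trans rV (rank-⊑ K X.V⊑Q))
        (linear 6 (λ p q u v s e → con 1 :+ (u :+ v) :≤ s :+ con 2 ⟹ p :≤ u ⟹ q :≤ v ⟹ s :≤ e ⟹
                      p :+ q :≤ e :+ con 1)
          (r K X.P) (r K X.Q) (r K U) (r K V) (r K Eₛ) (r K (E K)) small X.rP X.rQ (rank-⊑ K Eₛ⊑E)))
      where module X = Extension (extend U⊑ V⊑ cover disj)

    two-elements : ∣ U ─ L ∣ ≤ 1 → Absurd
    two-elements UL≤1 = linear 7
      (λ d ρ cu v u a b → con 2 :≤ d ⟹ d :+ ρ := cu :+ v ⟹ cu :≤ a :+ b ⟹ a :≤ con 1 ⟹ b :≤ con 1 ⟹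
         con 1 :+ (u :+ v) :≤ ρ :+ con 2 ⟹ con 2 :≤ u ⟹ :false)
      (r (dual J) U) (r K Eₛ) (∣ U ∣) (r K V) (r K U) (∣ U ─ L ∣) (∣ U ∩ L ∣)
      U≥2 (dual-si-rank U⊑ V⊑ cover disj)
      (card-cover (U ─ L) (U ∩ L) (sets 2 (λ U L → U :⊑ (U :─ L) :∪ (U :∩ L)))) UL≤1
      (ℕ.≮⇒≥ λ two → ℕ.<⇒≱ (rank≥card (s≤s (s≤s (s≤s z≤n))) (⊑-trans (sets 2 (λ U L → U :∩ L :⊑ U)) U⊑) two)
        (ℕ.≤-trans (rank-⊑ K (sets 2 (λ U L → U :∩ L :⊑ L))) rL))
      small rU

-- Isomorphisms

card-injection : (X : Subset m) (Y : Subset n) (f : ∀ {x} → x ∈ X → Fin n) →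
                 (∀ {x} (p : x ∈ X) → f p ∈ Y) → (∀ {x y} (p : x ∈ X) (q : y ∈ X) → f p ≡ f q → x ≡ y) →
                 ∣ X ∣ ≤ ∣ Y ∣
card-injection []          Y f f∈ inj = z≤n
card-injection (false ∷ X) Y f f∈ inj =
  card-injection X Y (f ∘ there) (f∈ ∘ there) (λ p q eq → Fin.suc-injective (inj (there p) (there q) eq))
card-injection (true ∷ X)  Y f f∈ inj = ℕ.≤-trans
  (s≤s (card-injection X (Y - f here) (f ∘ there)
    (λ p → x∈p∧x≢y⇒x∈p-y (f∈ (there p)) (λ eq → 0≢suc (inj here (there p) (sym eq))))
    (λ p q eq → Fin.suc-injective (inj (there p) (there q) eq))))
  (x∈p⇒∣p-x∣<∣p∣ (f∈ here))
  where
  0≢suc : ∀ {k} {x : Fin k} → ¬ (zero ≡ suc x)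
  0≢suc ()

∈-resp : {A B : Subset n} → A ≡ B → ∀ {x} → x ∈ A → x ∈ B
∈-resp refl p = p

ground-≡ : {E : Subset n} {e f : ∃[ x ] x ∈ E} → proj₁ e ≡ proj₁ f → e ≡ f
ground-≡ {e = x , p} {.x , q} refl = cong (x ,_) ([]=-irrelevant p q)

module Isomorphism {M : Matroid m} {N : Matroid n} (iso : M ≅ N) where
  open _≅_ iso public
  open Inverse bijection public using (to; from; strictlyInverseˡ; strictlyInverseʳ)

  Related : Subset m → Subset n → Set
  Related X Y = ∀ e → proj₁ e ∈ X ⇔ proj₁ (to e) ∈ Y

  card-related : ∀ {X Y} → X ⊆ E M → Y ⊆ E N → Related X Y → ∣ X ∣ ≡ ∣ Y ∣
  card-related {X} {Y} X⊆ Y⊆ rel = ℕ.≤-antisym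
    (card-injection X Y (λ p → proj₁ (to (_ , X⊆ p))) (λ p → Equivalence.to (rel (_ , X⊆ p)) p)
      (λ p q eq → cong proj₁ (trans (sym (strictlyInverseʳ _))
                    (trans (cong from (ground-≡ eq)) (strictlyInverseʳ _)))))
    (card-injection Y X (λ p → proj₁ (from (_ , Y⊆ p)))
      (λ {y} p → Equivalence.from (rel (from (y , Y⊆ p)))
              (subst (λ e → proj₁ e ∈ Y) (sym (strictlyInverseˡ (y , Y⊆ p))) p))
      (λ p q eq → cong proj₁ (trans (sym (strictlyInverseˡ _))
                    (trans (cong to (ground-≡ eq)) (strictlyInverseˡ _)))))

  related-ground : Related (E M) (E N)
  related-ground e = mk⇔ (λ _ → proj₂ (to e)) (λ _ → proj₂ e)

  related-complement : ∀ {X Y} → Related X Y → Related (E M ─ X) (E N ─ Y)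
  related-complement {X} {Y} rel e = mk⇔
    (λ p → x∈p∧x∉q⇒x∈p─q (proj₂ (to e)) (not-in p ∘ Equivalence.from (rel e)))
    (λ p → x∈p∧x∉q⇒x∈p─q (proj₂ e) (not-in p ∘ Equivalence.to (rel e)))
    where
    not-in : ∀ {k} {x} {A B : Subset k} → x ∈ A ─ B → x ∉ B
    not-in p q = ⁅⁆⋢⊥ (sets 3 (λ x A B → x :⊑ A :─ B ⇒ x :⊑ B ⇒ x :⊑ :⊥) (∈⇒⊑ p) (∈⇒⊑ q))

  module Image (X : Subset m) where

    in-image? : ∀ y → Dec (∃[ p ] proj₁ (from (y , p)) ∈ X)
    in-image? y with y ∈? E N
    ... | no ¬p = no (¬p ∘ proj₁)
    ... | yes p with proj₁ (from (y , p)) ∈? X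
    ...   | yes q = yes (p , q)
    ...   | no ¬q = no λ (p′ , q) → ¬q (subst (λ p → proj₁ (from (y , p)) ∈ X) ([]=-irrelevant p′ p) q)

    image : Subset n
    image = comprehension in-image?

    image⊆ : image ⊆ E N
    image⊆ = proj₁ ∘ ∈-comprehension⁻ in-image?

    related-image : Related X image
    related-image e = mk⇔
      (λ p → ∈-comprehension⁺ in-image?
        (proj₂ (to e) , subst (λ e → proj₁ e ∈ X) (sym (strictlyInverseʳ e)) p))
      (λ p → let q , r = ∈-comprehension⁻ in-image? p in
        subst (λ e → proj₁ e ∈ X) (trans (cong from (ground-≡ refl)) (strictlyInverseʳ e)) r)

  ground-card : ∣ E M ∣ ≡ ∣ E N ∣
  ground-card = card-related id id related-ground

≅-trans : {L : Matroid l} {M : Matroid m} {N : Matroid n} → L ≅ M → M ≅ N → L ≅ N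
≅-trans i j = record
  { bijection = J.bijection ↔-∘ I.bijection
  ; rank-≡ = λ {X} {Y} X⊆ Y⊆ rel → let open I.Image X in
      trans (I.rank-≡ X⊆ image⊆ related-image)
        (J.rank-≡ image⊆ Y⊆ λ e → mk⇔
          (λ p → let q , r = ∈-comprehension⁻ in-image? p in
             subst (λ e → proj₁ (J.to e) ∈ Y) (trans (I.strictlyInverseˡ _) (ground-≡ refl))
               (Equivalence.to (rel (I.from (proj₁ e , q))) r))
          (λ p → ∈-comprehension⁺ in-image? (proj₂ e ,
             Equivalence.from (rel (I.from e))
               (subst (λ e → proj₁ (J.to e) ∈ Y) (sym (I.strictlyInverseˡ e)) p))))
  }
  where
  module I = Isomorphism i
  module J = Isomorphism j

≅-dual : {M : Matroid m} {N : Matroid n} → M ≅ N → dual M ≅ dual N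
≅-dual {M = M} {N} i = record
  { bijection = bijection
  ; rank-≡ = λ {X} {Y} X⊆ Y⊆ rel → cong₂ _∸_
      (cong₂ _+_
        (trans (cong ∣_∣ (∩E X⊆)) (trans (card-related X⊆ Y⊆ rel) (cong ∣_∣ (sym (∩E Y⊆)))))
        (rank-≡ (p─q⊆p _ _) (p─q⊆p _ _) (related-complement rel)))
      (rank-≡ id id related-ground)
  }
  where
  open Isomorphism i
  ∩E : ∀ {k} {X E : Subset k} → X ⊆ E → X ∩ E ≡ X
  ∩E X⊆ = sets 2 (λ X E → X :⊑ E ⇒ X :∩ E :≡ X) (⊆⇒⊑ X⊆)

≅-connected : {M : Matroid m} {N : Matroid n} → M ≅ N → Connected 3 N → Connected 3 M
≅-connected {M = M} {N} i conn k 1≤k k<3 X (X⊆ , λ<k , kX , kY) = conn k 1≤k k<3 image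
  ( image⊆
  , subst (ℕ._< k) (cong₂ _∸_ (cong₂ _+_ (rank-≡ X⊆ image⊆ related-image)
      (rank-≡ (p─q⊆p _ _) (p─q⊆p _ _) (related-complement related-image))) (rank-≡ id id related-ground)) λ<k
  , subst (k ≤_) (card-related X⊆ image⊆ related-image) kX
  , subst (k ≤_) (card-related (p─q⊆p _ _) (p─q⊆p _ _) (related-complement related-image)) kY )
  where
  open Isomorphism i
  open Image X

≅-intro : {M N : Matroid n} (f g : Fin n → Fin n) →
          (∀ {x} → x ∈ E M → f x ∈ E N) → (∀ {y} → y ∈ E N → g y ∈ E M) →
          (∀ {x} → x ∈ E M → g (f x) ≡ x) → (∀ {y} → y ∈ E N → f (g y) ≡ y) →
          (∀ {X Y} → X ⊆ E M → Y ⊆ E N → (∀ {x} → x ∈ E M → x ∈ X ⇔ f x ∈ Y) → r M X ≡ r N Y) →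
          M ≅ N
≅-intro f g f∈ g∈ gf fg rank = record
  { bijection = mk↔ₛ′ (λ (x , p) → f x , f∈ p) (λ (y , q) → g y , g∈ q)
      (λ (y , q) → ground-≡ (fg q)) (λ (x , p) → ground-≡ (gf p))
  ; rank-≡ = λ X⊆ Y⊆ rel → rank X⊆ Y⊆ (λ p → rel (_ , p)) }

≅-same : {M N : Matroid n} → E M ≡ E N → (∀ {X} → X ⊑ E M → r M X ≡ r N X) → M ≅ N
≅-same {M = M} {N} eq rank = ≅-intro id id (∈-resp eq) (∈-resp (sym eq)) (λ _ → refl) (λ _ → refl)
  λ {X} {Y} X⊆ Y⊆ rel → trans (rank (⊆⇒⊑ X⊆)) (cong (r N) (⊆-antisym
    (λ p → Equivalence.to (rel (X⊆ p)) p)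
    (λ p → Equivalence.from (rel (∈-resp (sym eq) (Y⊆ p))) p)))

renamed-≅ : {L L′ : Matroid n} {F : Subset n} {e e′ : Fin n} → Renamed L L′ F e e′ → L′ ≅ L
renamed-≅ {n} {L} {L′} {F} {e} {e′} ren = ≅-intro (move e′ e) (move e e′)
  (λ p → ∈-resp (sym ground) (move-∈ e′ e (∈-resp ground′ p)))
  (λ p → ∈-resp (sym ground′) (move-∈ e e′ (∈-resp ground p)))
  (λ p → move-move e∉F′ (∈-resp ground′ p))
  (λ p → move-move e′∉F′ (∈-resp ground p))
  λ {X} {Y} X⊆ Y⊆ rel → same-rank (subst (X ⊑_) ground′ (⊆⇒⊑ X⊆)) (subst (Y ⊑_) ground (⊆⇒⊑ Y⊆))
    (λ p → rel (∈-resp (sym ground′) p)) (e′ ∈? X)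
  where
  open Renamed ren
  e∉F′ : e ∉ F
  e∉F′ p = ⁅⁆⋢⊥ {x = e} (sets 2 (λ e F → e :⊑ F ⇒ e :∩ F :⊑ :⊥ ⇒ e :⊑ :⊥) (∈⇒⊑ p) e∉F)
  e′∉F′ : e′ ∉ F
  e′∉F′ p = ⁅⁆⋢⊥ {x = e′} (sets 2 (λ e F → e :⊑ F ⇒ e :∩ F :⊑ :⊥ ⇒ e :⊑ :⊥) (∈⇒⊑ p) e′∉F)

  move : Fin n → Fin n → Fin n → Fin n
  move a b x with x Fin.≟ a
  ... | yes _ = b
  ... | no _  = x

  move-hit : ∀ a b → move a b a ≡ b
  move-hit a b with a Fin.≟ a
  ... | yes _ = refl
  ... | no ¬p = ⊥-elim (¬p refl)

  move-miss : ∀ {a b x} → x ≢ a → move a b x ≡ x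
  move-miss {a} {b} {x} ¬p with x Fin.≟ a
  ... | yes p = ⊥-elim (¬p p)
  ... | no _  = refl

  cases : ∀ a {x} → x ∈ F ∪ ⁅ a ⁆ → x ∈ F ⊎ x ≡ a
  cases a p = [ inj₁ , inj₂ ∘ x∈⁅y⁆⇒x≡y a ]′ (x∈p∪q⁻ F ⁅ a ⁆ p)

  move-∈ : ∀ a b {x} → x ∈ F ∪ ⁅ a ⁆ → move a b x ∈ F ∪ ⁅ b ⁆
  move-∈ a b {x} p with x Fin.≟ a
  ... | yes _ = x∈p∪q⁺ (inj₂ (x∈⁅x⁆ b))
  ... | no ¬q = x∈p∪q⁺ (inj₁ ([ id , (λ q → ⊥-elim (¬q q)) ]′ (cases a p)))

  move-move : ∀ {a b} → b ∉ F → ∀ {x} → x ∈ F ∪ ⁅ a ⁆ → move b a (move a b x) ≡ x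
  move-move {a} {b} b∉ {x} p with x Fin.≟ a
  ... | yes refl = move-hit b a
  ... | no ¬q    = move-miss λ { refl → [ b∉ , ¬q ]′ (cases a p) }

  same-rank : ∀ {X Y} → X ⊑ F ∪ ⁅ e′ ⁆ → Y ⊑ F ∪ ⁅ e ⁆ →
              (∀ {x} → x ∈ F ∪ ⁅ e′ ⁆ → x ∈ X ⇔ move e′ e x ∈ Y) → Dec (e′ ∈ X) → r L′ X ≡ r L Y
  same-rank {X} {Y} X⊑ Y⊑ rel = by-e′
    where
    on-F⇒ : ∀ {x} → x ∈ F → x ∈ X → x ∈ Y
    on-F⇒ p q = subst (_∈ Y) (move-miss λ { refl → e′∉F′ p })
      (Equivalence.to (rel (x∈p∪q⁺ (inj₁ p))) q)
    on-F⇐ : ∀ {x} → x ∈ F → x ∈ Y → x ∈ X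
    on-F⇐ p q = Equivalence.from (rel (x∈p∪q⁺ (inj₁ p)))
      (subst (_∈ Y) (sym (move-miss λ { refl → e′∉F′ p })) q)

    same : X ∩ F ≡ Y ∩ F
    same = ⊆-antisym
      (λ p → let q , s = x∈p∩q⁻ X F p in x∈p∩q⁺ (on-F⇒ s q , s))
      (λ p → let q , s = x∈p∩q⁻ Y F p in x∈p∩q⁺ (on-F⇐ s q , s))

    e⇔ : e′ ∈ X ⇔ e ∈ Y
    e⇔ = subst (λ x → e′ ∈ X ⇔ x ∈ Y) (move-hit e′ e) (rel (x∈p∪q⁺ (inj₂ (x∈⁅x⁆ e′))))

    ∩F⊑ : X ∩ F ⊑ F
    ∩F⊑ = sets 2 (λ X F → X :∩ F :⊑ F)

    by-e′ : Dec (e′ ∈ X) → r L′ X ≡ r L Y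
    by-e′ (yes p) = begin
      r L′ X                    ≡⟨ cong (r L′) (sets 3 (λ X F e → X :⊑ F :∪ e ⇒ e :⊑ X ⇒ X :≡ (X :∩ F) :∪ e) X⊑ (∈⇒⊑ p)) ⟩
      r L′ ((X ∩ F) ∪ ⁅ e′ ⁆)   ≡⟨ sym (with-e ∩F⊑) ⟩
      r L ((X ∩ F) ∪ ⁅ e ⁆)     ≡⟨ cong (λ Z → r L (Z ∪ ⁅ e ⁆)) same ⟩
      r L ((Y ∩ F) ∪ ⁅ e ⁆)     ≡⟨ cong (r L) (sets 3 (λ X F e → X :⊑ F :∪ e ⇒ e :⊑ X ⇒ (X :∩ F) :∪ e :≡ X) Y⊑ (∈⇒⊑ (Equivalence.to e⇔ p))) ⟩
      r L Y                     ∎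
      where open ≡-Reasoning
    by-e′ (no ¬p) = begin
      r L′ X         ≡⟨ cong (r L′) (sets 3 (λ X F e → X :⊑ F :∪ e ⇒ e :∩ X :⊑ :⊥ ⇒ X :≡ X :∩ F) X⊑ (∉⇒⊑ ¬p)) ⟩
      r L′ (X ∩ F)   ≡⟨ sym (without ∩F⊑) ⟩
      r L (X ∩ F)    ≡⟨ cong (r L) same ⟩
      r L (Y ∩ F)    ≡⟨ cong (r L) (sets 3 (λ X F e → X :⊑ F :∪ e ⇒ e :∩ X :⊑ :⊥ ⇒ X :∩ F :≡ X) Y⊑ (∉⇒⊑ (¬p ∘ Equivalence.from e⇔))) ⟩
      r L Y          ∎
      where open ≡-Reasoning

isomorphic-to : (N : Matroid n) → Connected 3 N → 4 ≤ ∣ E N ∣ → MinorClass m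
isomorphic-to N conn large = record
  { Member        = _≅ N
  ; connected     = λ i → ≅-connected i conn
  ; four-elements = λ i → ≤-≡-trans large (sym (Isomorphism.ground-card i))
  ; rename        = λ ren i → ≅-trans (renamed-≅ ren) i }

dual-dual : (M : Matroid n) → dual (dual M) ≅ M
dual-dual M = ≅-same {M = dual (dual M)} {N = M} refl λ {X} X⊑ → linear 9
  (λ d c dd de ρ cE r0 r c′ → d :+ de := c :+ dd ⟹ dd :+ ρ := c′ :+ r ⟹ cE :+ r0 := de :+ ρ ⟹ con 0 := r0 ⟹
     c :+ c′ := cE ⟹ d := r)
  (r (dual (dual M)) X) (∣ X ∩ E M ∣) (r (dual M) (E M ─ X)) (r (dual M) (E M)) (r M (E M))
  (∣ E M ∩ E M ∣) (r M (E M ─ E M)) (r M X) (∣ (E M ─ X) ∩ E M ∣)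
  (dual-rank (dual M) X)
  (trans (dual-rank M (E M ─ X)) (cong (λ U → ∣ (E M ─ X) ∩ E M ∣ + r M U)
    (sets 2 (λ E X → X :⊑ E ⇒ E :─ (E :─ X) :≡ X) X⊑)))
  (sym (dual-rank M (E M))) (sym (rank-⊥ M (sets 1 (λ E → E :─ E :⊑ :⊥))))
  (trans (sym (∣∪∣+∣∩∣ (X ∩ E M) ((E M ─ X) ∩ E M))) (trans (cong₂ _+_
    (cong ∣_∣ (sets 2 (λ E X → X :⊑ E ⇒ (X :∩ E) :∪ ((E :─ X) :∩ E) :≡ E :∩ E) X⊑))
    (ℕ.n≤0⇒n≡0 (∣⊑⊥∣ (sets 2 (λ E X → (X :∩ E) :∩ ((E :─ X) :∩ E) :⊑ :⊥) {_} {E M} {X}))))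
    (ℕ.+-identityʳ _)))

-- Minors

hasMinor⇒isMinor : {K : Matroid m} {N : Matroid n} → HasMinor K N →
                   ∃[ L ] ∃[ T ] (IsMinor K L T × L ≅ N)
hasMinor⇒isMinor {K = K} (T , D , iso) = K ／ T ＼ D , T ∩ E K , record
  { ground   = sets 3 (λ E T D → (E :─ T) :─ D :⊑ E)
  ; contract = sets 2 (λ E T → T :∩ E :⊑ E)
  ; disjoint = sets 3 (λ E T D → ((E :─ T) :─ D) :∩ (T :∩ E) :⊑ :⊥)
  ; rank     = λ {Z} Z⊑ → begin
      (r K ((Z ∩ ((E K ─ T) ─ D)) ∪ T) ∸ r K T) + r K (T ∩ E K)
        ≡⟨ cong₂ _+_ (cong (λ U → r K (U ∪ T) ∸ r K T) (sets 2 (λ Z E → Z :⊑ E ⇒ Z :∩ E :≡ Z) Z⊑))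
                     (rank-ground K T) ⟩
      (r K (Z ∪ T) ∸ r K T) + r K T
        ≡⟨ ℕ.m∸n+n≡m (rank-⊑ K (sets 2 (λ Z T → T :⊑ Z :∪ T))) ⟩
      r K (Z ∪ T)
        ≡⟨ sym (rank-ground K _) ⟩
      r K ((Z ∪ T) ∩ E K)
        ≡⟨ cong (r K) (sets 3 (λ Z T E → (Z :∪ T) :∩ E :≡ (Z :∪ (T :∩ E)) :∩ E)) ⟩
      r K ((Z ∪ (T ∩ E K)) ∩ E K)
        ≡⟨ rank-ground K _ ⟩
      r K (Z ∪ (T ∩ E K)) ∎
  } , iso
  where open ≡-Reasoning

isMinor⇒hasMinor : {K L : Matroid m} {N : Matroid n} {T : Subset m} → IsMinor K L T → L ≅ N → HasMinor K N
isMinor⇒hasMinor {K = K} {L} {T = T} minor iso = T , E K ─ E L , ≅-trans (≅-same eq λ {X} X⊑ →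
    trans (cong (λ U → r K (U ∪ T) ∸ r K T) (sets 2 (λ Z E → Z :⊑ E ⇒ Z :∩ E :≡ Z) X⊑))
      (trans (cong (_∸ r K T) (sym (rank (subst (X ⊑_) eq X⊑)))) (ℕ.m+n∸n≡m (r L X) (r K T)))) iso
  where
  open IsMinor minor
  eq : (E K ─ T) ─ (E K ─ E L) ≡ E L
  eq = sets 3 (λ F T E → F :⊑ E ⇒ F :∩ T :⊑ :⊥ ⇒ (E :─ T) :─ (E :─ F) :≡ F) ground disjoint

isMinor-dual : {K L : Matroid n} {T : Subset n} → IsMinor K L T →
               IsMinor (dual K) (dual L) ((E K ─ T) ─ E L)
isMinor-dual {K = K} {L} {T} minor = record
  { ground   = ground
  ; contract = sets 3 (λ E T F → (E :─ T) :─ F :⊑ E)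
  ; disjoint = sets 3 (λ E T F → F :∩ ((E :─ T) :─ F) :⊑ :⊥)
  ; rank     = λ {Z} Z⊑ → linear 14
      (λ l d lF z lFZ dc edr ρ u uc eur t ft fzt →
         l :+ lF := z :+ lFZ ⟹ d :+ ρ := dc :+ edr ⟹ uc :+ eur := u :+ ρ ⟹
         ft := lF :+ t ⟹ lFZ :+ t := fzt ⟹ edr := ft ⟹ fzt := eur ⟹ z :+ dc := uc ⟹ l :+ d := u)
      (r (dual L) Z) (r (dual K) D) (r L F) (∣ Z ∩ F ∣) (r L (F ─ Z)) (∣ D ∩ E K ∣) (r K (E K ─ D))
      (r K (E K)) (r (dual K) (Z ∪ D)) (∣ (Z ∪ D) ∩ E K ∣) (r K (E K ─ (Z ∪ D))) (r K T)
      (r K (F ∪ T)) (r K ((F ─ Z) ∪ T))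
      (dual-rank L Z) (dual-rank K D) (sym (dual-rank K (Z ∪ D)))
      (sym (rank ⊑-refl)) (rank (sets 2 (λ F Z → F :─ Z :⊑ F)))
      (cong (r K) (sets 3 (λ E T F → F :⊑ E ⇒ T :⊑ E ⇒ F :∩ T :⊑ :⊥ ⇒ E :─ ((E :─ T) :─ F) :≡ F :∪ T)
        ground contract disjoint))
      (cong (r K) (sets 4 (λ E T F Z → F :⊑ E ⇒ T :⊑ E ⇒ F :∩ T :⊑ :⊥ ⇒ Z :⊑ F ⇒
        (F :─ Z) :∪ T :≡ E :─ (Z :∪ ((E :─ T) :─ F))) ground contract disjoint Z⊑))
      (trans (sym (∣∪∣+∣∩∣ (Z ∩ F) (D ∩ E K))) (trans (cong₂ _+_
        (cong ∣_∣ (sets 4 (λ E T F Z → F :⊑ E ⇒ Z :⊑ F ⇒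
          (Z :∩ F) :∪ (((E :─ T) :─ F) :∩ E) :≡ (Z :∪ ((E :─ T) :─ F)) :∩ E) ground Z⊑))
        (ℕ.n≤0⇒n≡0 (∣⊑⊥∣ (sets 4 (λ E T F Z → (Z :∩ F) :∩ (((E :─ T) :─ F) :∩ E) :⊑ :⊥)
          {_} {E K} {T} {F} {Z})))) (ℕ.+-identityʳ _)))
  }
  where
  open IsMinor minor
  F D : Subset _
  F = E L
  D = (E K ─ T) ─ F

module SimplifiedMinor {m} (K : Matroid m) (𝓝 : MinorClass m) where
  open MinorClass 𝓝
  open Simplification K

  rank-swap-≤ : ∀ S {e f} → r K (⁅ f ⁆ ∪ ⁅ e ⁆) ≤ r K ⁅ f ⁆ → ⁅ f ⁆ ⊑ S → r K (S ∪ ⁅ e ⁆) ≤ r K S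
  rank-swap-≤ S {e} sp f∈ = spanned-mono K e sp f∈

  rank-swap : ∀ S {e f} → r K (⁅ f ⁆ ∪ ⁅ e ⁆) ≤ r K ⁅ f ⁆ → 1 ≤ r K ⁅ e ⁆ →
              r K (S ∪ ⁅ e ⁆) ≡ r K (S ∪ ⁅ f ⁆)
  rank-swap S {e} {f} sp e≥1 = ℕ.≤-antisym
    (ℕ.≤-trans (rank-⊑ K (sets 3 (λ S e f → S :∪ e :⊑ (S :∪ f) :∪ e)))
      (rank-swap-≤ (S ∪ ⁅ f ⁆) sp (sets 2 (λ S f → f :⊑ S :∪ f))))
    (ℕ.≤-trans (rank-⊑ K (sets 3 (λ S e f → S :∪ f :⊑ (S :∪ e) :∪ f)))
      (rank-swap-≤ (S ∪ ⁅ e ⁆) (ℕ.≤-trans (rank-⊑ K (sets 2 (λ e f → e :∪ f :⊑ f :∪ e)))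
          (ℕ.≤-trans sp (ℕ.≤-trans (rank-⁅⁆ K f) e≥1)))
        (sets 2 (λ S f → f :⊑ S :∪ f))))

  module _ {L T} (minor : IsMinor K L T) (member : Member L) where
    open IsMinor minor
    module 3L = ThreeConnected L (connected member) (four-elements member)

    not-spanned : ∀ {e} → ⁅ e ⁆ ⊑ E L → ¬ (r K (⁅ e ⁆ ∪ T) ≤ r K T)
    not-spanned {e} e∈ = linear 3 (λ l t et → con 1 :≤ l ⟹ l :+ t :≤ et ⟹ et :≤ t ⟹ :false)
      (r L ⁅ e ⁆) (r K T) (r K (⁅ e ⁆ ∪ T)) (3L.rank-≥1 e∈) (ℕ.≤-reflexive (rank e∈))

    not-parallel : ∀ {e f} → e ≢ f → ⁅ e ⁆ ⊑ E L → ⁅ f ⁆ ⊑ E L → ¬ (r K (⁅ f ⁆ ∪ ⁅ e ⁆) ≤ r K ⁅ f ⁆)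
    not-parallel {e} {f} e≢f e∈ f∈ sp = linear 5
      (λ l lf t fet ft → con 2 :≤ l ⟹ l :+ t :≤ fet ⟹ fet :≤ ft ⟹ ft :≤ lf :+ t ⟹ lf :≤ con 1 ⟹ :false)
      (r L (⁅ e ⁆ ∪ ⁅ f ⁆)) (r L ⁅ f ⁆) (r K T) (r K ((⁅ f ⁆ ∪ T) ∪ ⁅ e ⁆)) (r K (⁅ f ⁆ ∪ T))
      (3L.rank-≥2 e≢f e∈ f∈)
      (≡-≤-trans (rank (sets 3 (λ e f F → e :⊑ F ⇒ f :⊑ F ⇒ e :∪ f :⊑ F) e∈ f∈))
        (rank-⊑ K (sets 3 (λ e f T → (e :∪ f) :∪ T :⊑ (f :∪ T) :∪ e))))
      (rank-swap-≤ (⁅ f ⁆ ∪ T) sp (sets 2 (λ f T → f :⊑ f :∪ T)))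
      (ℕ.≤-reflexive (sym (rank f∈))) (rank-⁅⁆ L f)

  Result : Set
  Result = ∃[ L ] ∃[ T ] (IsMinor (si K) L T × Member L)

  finish : ∀ {L T} → IsMinor K L T → Member L → (E L ∪ T) ∩ R ⊑ ⊥ → Result
  finish {L} {T} minor member clean = L , T , record
    { ground   = F⊑
    ; contract = T⊑
    ; disjoint = disjoint
    ; rank     = λ {Z} Z⊑ → trans (cong (r L Z +_) (si-rank T⊑)) (trans (rank Z⊑)
        (sym (si-rank (sets 4 (λ Z F T S → Z :⊑ F ⇒ F :⊑ S ⇒ T :⊑ S ⇒ Z :∪ T :⊑ S) Z⊑ F⊑ T⊑))))
    } , member
    where
    open IsMinor minor
    F⊑ : E L ⊑ Eₛ
    F⊑ = sets 4 (λ F T R E → (F :∪ T) :∩ R :⊑ :⊥ ⇒ F :⊑ E ⇒ F :⊑ E :─ R) clean ground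
    T⊑ : T ⊑ Eₛ
    T⊑ = sets 4 (λ F T R E → (F :∪ T) :∩ R :⊑ :⊥ ⇒ T :⊑ E ⇒ T :⊑ E :─ R) clean contract

  clean-up : ∀ k {L T} → ∣ (E L ∪ T) ∩ R ∣ ≤ k → IsMinor K L T → Member L → Result
  clean-up k {L} {T} bound minor member =
    [ (λ (e , e∈) → step k bound e∈) , finish minor member ]′ (nonempty-or-⊑⊥ ((E L ∪ T) ∩ R))
    where
    open IsMinor minor

    step : ∀ k → ∣ (E L ∪ T) ∩ R ∣ ≤ k → ∀ {e} → ⁅ e ⁆ ⊑ (E L ∪ T) ∩ R → Result
    step zero bound e∈ = ⊥-elim (ℕ.<⇒≱ (card-≥1 e∈) bound)
    step (suc k) bound {e} e∈ = by-loop (r K ⁅ e ⁆ ℕ.≤? 0)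
      where
      e∈R : ⁅ e ⁆ ⊑ R
      e∈R = sets 3 (λ e A R → e :⊑ A :∩ R ⇒ e :⊑ R) e∈

      next : ∀ {L′ T′} → (E L′ ∪ T′) ∩ R ⊑ (E L ∪ T) ∩ R → ⁅ e ⁆ ∩ (E L′ ∪ T′) ⊑ ⊥ →
             IsMinor K L′ T′ → Member L′ → Result
      next {L′} {T′} sub e∉ = clean-up k (ℕ.≤-pred (ℕ.≤-trans (card-strict {X = (E L′ ∪ T′) ∩ R} sub e∈
        (sets 3 (λ e A R → e :∩ A :⊑ :⊥ ⇒ e :∩ (A :∩ R) :⊑ :⊥) e∉)) bound))

      loop : r K ⁅ e ⁆ ≤ 0 → Result
      loop e≤0 = by-place (∈-or-∉ e (E L))
        where
        drop-e : ∀ S → r K (S ∪ ⁅ e ⁆) ≤ r K S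
        drop-e S = ℕ.≤-trans (rank-cover K S ⁅ e ⁆ ⊑-refl)
          (≤-≡-trans (ℕ.+-monoʳ-≤ (r K S) e≤0) (ℕ.+-identityʳ _))

        drop-≡ : ∀ S → r K (S ∪ T) ≡ r K (S ∪ (T ─ ⁅ e ⁆))
        drop-≡ S = ℕ.≤-antisym
          (ℕ.≤-trans (rank-⊑ K (sets 3 (λ S T e → S :∪ T :⊑ (S :∪ (T :─ e)) :∪ e))) (drop-e _))
          (rank-⊑ K (sets 3 (λ S T e → S :∪ (T :─ e) :⊑ S :∪ T)))

        by-place : ⁅ e ⁆ ⊑ E L ⊎ ⁅ e ⁆ ∩ E L ⊑ ⊥ → Result
        by-place (inj₁ e∈L) = ⊥-elim (not-spanned minor member e∈L
          (ℕ.≤-trans (rank-⊑ K (sets 2 (λ e T → e :∪ T :⊑ T :∪ e))) (drop-e T)))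
        by-place (inj₂ e∉L) = next {L} {T ─ ⁅ e ⁆}
          (sets 4 (λ L T e R → (L :∪ (T :─ e)) :∩ R :⊑ (L :∪ T) :∩ R))
          (sets 3 (λ L T e → e :∩ L :⊑ :⊥ ⇒ e :∩ (L :∪ (T :─ e)) :⊑ :⊥) e∉L)
          record
            { ground = ground
            ; contract = sets 3 (λ T e E → T :⊑ E ⇒ T :─ e :⊑ E) contract
            ; disjoint = sets 3 (λ F T e → F :∩ T :⊑ :⊥ ⇒ F :∩ (T :─ e) :⊑ :⊥) disjoint
            ; rank = λ {Z} Z⊑ → trans
                (cong (r L Z +_) (trans (cong (r K) (sets 2 (λ T e → T :─ e :≡ :⊥ :∪ (T :─ e))))
                  (trans (sym (drop-≡ ⊥)) (cong (r K) (sets 1 (λ T → :⊥ :∪ T :≡ T))))))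
                (trans (rank Z⊑) (drop-≡ Z)) }
          member

      module _ (e≥1 : 1 ≤ r K ⁅ e ⁆) {f} (f∈ : ⁅ f ⁆ ⊑ Eₛ) (sp : r K (⁅ f ⁆ ∪ ⁅ e ⁆) ≤ r K ⁅ f ⁆) where

        f∉R : ⁅ f ⁆ ∩ R ⊑ ⊥
        f∉R = sets 3 (λ f E R → f :⊑ E :─ R ⇒ f :∩ R :⊑ :⊥) f∈

        f∈E : ⁅ f ⁆ ⊑ E K
        f∈E = sets 3 (λ f E R → f :⊑ E :─ R ⇒ f :⊑ E) f∈

        e≢f : e ≢ f
        e≢f = separated⇒≢ e∈R f∉R

        e∩f : ⁅ e ⁆ ∩ ⁅ f ⁆ ⊑ ⊥
        e∩f = ≢⇒disjoint e≢f

        contracted : ⁅ e ⁆ ⊑ T → Result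
        contracted e∈T = next {L} {(T ─ ⁅ e ⁆) ∪ ⁅ f ⁆}
          (sets 5 (λ L T e f R → f :∩ R :⊑ :⊥ ⇒ (L :∪ ((T :─ e) :∪ f)) :∩ R :⊑ (L :∪ T) :∩ R) f∉R)
          (sets 4 (λ L T e f → L :∩ T :⊑ :⊥ ⇒ e :⊑ T ⇒ e :∩ f :⊑ :⊥ ⇒ e :∩ (L :∪ ((T :─ e) :∪ f)) :⊑ :⊥)
            disjoint e∈T e∩f)
          record
            { ground = ground
            ; contract = sets 4 (λ T e f E → T :⊑ E ⇒ f :⊑ E ⇒ (T :─ e) :∪ f :⊑ E) contract f∈E
            ; disjoint = sets 4 (λ F T e f → F :∩ T :⊑ :⊥ ⇒ f :∩ F :⊑ :⊥ ⇒ F :∩ ((T :─ e) :∪ f) :⊑ :⊥) disjoint f∉L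
            ; rank = λ {Z} Z⊑ → trans
                (cong (r L Z +_) (trans (cong (r K) (sets 2 (λ A e → A :≡ :⊥ :∪ A) {_} {_} {⁅ e ⁆}))
                  (trans (sym (change ⊥)) (cong (r K) (sets 1 (λ T → :⊥ :∪ T :≡ T))))))
                (trans (rank Z⊑) (change Z)) }
          member
          where
          change : ∀ S → r K (S ∪ T) ≡ r K (S ∪ ((T ─ ⁅ e ⁆) ∪ ⁅ f ⁆))
          change S = trans (cong (r K) (sets 3 (λ S T e → e :⊑ T ⇒ S :∪ T :≡ (S :∪ (T :─ e)) :∪ e) e∈T))
            (trans (rank-swap (S ∪ (T ─ ⁅ e ⁆)) sp e≥1)
              (cong (r K) (sets 4 (λ S T e f → (S :∪ (T :─ e)) :∪ f :≡ S :∪ ((T :─ e) :∪ f)))))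

          f∉L : ⁅ f ⁆ ∩ E L ⊑ ⊥
          f∉L = [ (λ f∈L → ⊥-elim (not-spanned minor member f∈L (≡-≤-trans
                    (cong (r K) (sets 2 (λ f T → f :∪ T :≡ T :∪ f)))
                    (≡-≤-trans (sym (rank-swap T sp e≥1)) (rank-⊑ K (sets 2 (λ T e → e :⊑ T ⇒ T :∪ e :⊑ T) e∈T))))))
                , id ]′ (∈-or-∉ f (E L))

        kept : ⁅ e ⁆ ⊑ E L → Result
        kept e∈L = replace (minor-exists K T (F ∪ ⁅ f ⁆)
          (sets 4 (λ L e f E → L :⊑ E ⇒ f :⊑ E ⇒ (L :─ e) :∪ f :⊑ E) ground f∈E) contract
          (sets 4 (λ L e f T → L :∩ T :⊑ :⊥ ⇒ f :∩ T :⊑ :⊥ ⇒ ((L :─ e) :∪ f) :∩ T :⊑ :⊥) disjoint f∉T))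
          where
          F : Subset m
          F = E L ─ ⁅ e ⁆

          f∉T : ⁅ f ⁆ ∩ T ⊑ ⊥
          f∉T = [ (λ f∈T → ⊥-elim (not-spanned minor member e∈L (≡-≤-trans
                    (cong (r K) (sets 2 (λ e T → e :∪ T :≡ T :∪ e)))
                    (≡-≤-trans (rank-swap T sp e≥1) (rank-⊑ K (sets 2 (λ T e → e :⊑ T ⇒ T :∪ e :⊑ T) f∈T))))))
                , id ]′ (∈-or-∉ f T)

          f∉L : ⁅ f ⁆ ∩ E L ⊑ ⊥
          f∉L = [ (λ f∈L → ⊥-elim (not-parallel minor member e≢f e∈L f∈L sp)) , id ]′ (∈-or-∉ f (E L))

          replace : ∃[ L′ ] (E L′ ≡ F ∪ ⁅ f ⁆ × IsMinor K L′ T) → Result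
          replace (L′ , L′-ground , minor′) = next {L′} {T}
            (subst (λ U → (U ∪ T) ∩ R ⊑ (E L ∪ T) ∩ R) (sym L′-ground)
              (sets 5 (λ L T e f R → f :∩ R :⊑ :⊥ ⇒ (((L :─ e) :∪ f) :∪ T) :∩ R :⊑ (L :∪ T) :∩ R) f∉R))
            (subst (λ U → ⁅ e ⁆ ∩ (U ∪ T) ⊑ ⊥) (sym L′-ground)
              (sets 4 (λ L T e f → L :∩ T :⊑ :⊥ ⇒ e :⊑ L ⇒ e :∩ f :⊑ :⊥ ⇒ e :∩ (((L :─ e) :∪ f) :∪ T) :⊑ :⊥)
                disjoint e∈L e∩f))
            minor′ (rename renamed member)
            where
            renamed : Renamed L L′ F e f
            renamed = record
              { ground = sets 2 (λ L e → e :⊑ L ⇒ L :≡ (L :─ e) :∪ e) e∈L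
              ; ground′ = L′-ground
              ; e∉F = sets 2 (λ L e → e :∩ (L :─ e) :⊑ :⊥)
              ; e′∉F = sets 3 (λ L e f → f :∩ L :⊑ :⊥ ⇒ f :∩ (L :─ e) :⊑ :⊥) f∉L
              ; without = λ {Z} Z⊑ → ℕ.+-cancelʳ-≡ (r K T) _ _ (trans
                  (rank (sets 3 (λ Z L e → Z :⊑ L :─ e ⇒ Z :⊑ L) Z⊑))
                  (sym (IsMinor.rank minor′ (subst (Z ⊑_) (sym L′-ground)
                    (sets 3 (λ Z F f → Z :⊑ F ⇒ Z :⊑ F :∪ f) Z⊑)))))
              ; with-e = λ {Z} Z⊑ → ℕ.+-cancelʳ-≡ (r K T) _ _ (trans
                  (rank (sets 3 (λ Z L e → Z :⊑ L :─ e ⇒ e :⊑ L ⇒ Z :∪ e :⊑ L) Z⊑ e∈L))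
                  (trans (trans (cong (r K) (sets 3 (λ Z T e → (Z :∪ e) :∪ T :≡ (Z :∪ T) :∪ e)))
                    (trans (rank-swap (Z ∪ T) sp e≥1)
                      (cong (r K) (sets 3 (λ Z T e → (Z :∪ T) :∪ e :≡ (Z :∪ e) :∪ T)))))
                  (sym (IsMinor.rank minor′ (subst (Z ∪ ⁅ f ⁆ ⊑_) (sym L′-ground)
                    (sets 3 (λ Z F f → Z :⊑ F ⇒ Z :∪ f :⊑ F :∪ f) Z⊑)))))) }

      by-loop : Dec (r K ⁅ e ⁆ ≤ 0) → Result
      by-loop (yes e≤0) = loop e≤0
      by-loop (no e≰0)  = [ (λ e≤0 → ⊥-elim (e≰0 e≤0)) , by-representative ]′ (representative e∈R)
        where
        by-representative : ∃[ f ] (⁅ f ⁆ ⊑ Eₛ × r K (⁅ f ⁆ ∪ ⁅ e ⁆) ≤ r K ⁅ f ⁆) → Result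
        by-representative (f , f∈ , sp) = [ kept (ℕ.≰⇒> e≰0) f∈ sp
          , (λ e∉L → contracted (ℕ.≰⇒> e≰0) f∈ sp (sets 4 (λ e L T R → e :⊑ (L :∪ T) :∩ R ⇒ e :∩ L :⊑ :⊥ ⇒
               e :⊑ T) e∈ e∉L)) ]′ (∈-or-∉ e (E L))

  si-minor : ∀ {L T} → IsMinor K L T → Member L → Result
  si-minor {L} {T} = clean-up (∣ (E L ∪ T) ∩ R ∣) ℕ.≤-refl

-- Deletion and the dual

module Deletion {m} (M : Matroid m) (conn : Connected 3 M) (large : 4 ≤ ∣ E M ∣)
  {x : Fin m} (x∈E : ⁅ x ⁆ ⊑ E M) where

  M* K : Matroid m
  M* = dual M
  K  = dual (M ＼ ⁅ x ⁆)

  module 3C = ThreeConnected M* (dual-connected M conn) large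

  E′ : Subset m
  E′ = E M ─ ⁅ x ⁆

  no-coloop : r M (E M) ≤ r M (E′ ∩ E′)
  no-coloop = linear 5 (λ d ρ c r r′ → con 1 :≤ d ⟹ d :+ ρ := c :+ r ⟹ c :≤ con 1 ⟹ r :≤ r′ ⟹ ρ :≤ r′)
    (r M* ⁅ x ⁆) (r M (E M)) (∣ ⁅ x ⁆ ∩ E M ∣) (r M E′) (r M (E′ ∩ E′))
    (3C.rank-≥1 x∈E) (dual-rank M ⁅ x ⁆)
    (≤-≡-trans (card-mono {X = ⁅ x ⁆ ∩ E M} {Y = ⁅ x ⁆} (sets 2 (λ x E → x :∩ E :⊑ x))) (∣⁅⁆∣ {x = x}))
    (rank-⊑ M (sets 1 (λ E → E :⊑ E :∩ E)))

  -- K is M* ／ ⁅ x ⁆.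
  rank-K : ∀ S → r K S + 1 ≡ r M* (S ∪ ⁅ x ⁆)
  rank-K S = linear 8
    (λ k ρ′ c r d ρ cx rx → k :+ ρ′ := c :+ r ⟹ cx :+ rx := d :+ ρ ⟹ ρ := ρ′ ⟹ r := rx ⟹ c :+ con 1 := cx ⟹
       k :+ con 1 := d)
    (r K S) (r M (E′ ∩ E′)) (∣ S ∩ E′ ∣) (r M ((E′ ─ S) ∩ E′)) (r M* (S ∪ ⁅ x ⁆)) (r M (E M))
    (∣ (S ∪ ⁅ x ⁆) ∩ E M ∣) (r M (E M ─ (S ∪ ⁅ x ⁆)))
    (dual-rank (M ＼ ⁅ x ⁆) S) (sym (dual-rank M (S ∪ ⁅ x ⁆)))
    (ℕ.≤-antisym no-coloop (rank-≤ρ M _))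
    (cong (r M) (sets 3 (λ E x S → ((E :─ x) :─ S) :∩ (E :─ x) :≡ E :─ (S :∪ x))))
    (begin
      ∣ S ∩ E′ ∣ + 1                              ≡⟨ cong (∣ S ∩ E′ ∣ +_) (sym (∣⁅⁆∣ {x = x})) ⟩
      ∣ S ∩ E′ ∣ + ∣ ⁅ x ⁆ ∣                      ≡⟨ sym (∣∪∣+∣∩∣ (S ∩ E′) ⁅ x ⁆) ⟩
      ∣ (S ∩ E′) ∪ ⁅ x ⁆ ∣ + ∣ (S ∩ E′) ∩ ⁅ x ⁆ ∣  ≡⟨ cong₂ (λ A b → ∣ A ∣ + b)
          (sets 3 (λ E x S → x :⊑ E ⇒ (S :∩ (E :─ x)) :∪ x :≡ (S :∪ x) :∩ E) {_} {E M} {⁅ x ⁆} {S} x∈E)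
          (ℕ.n≤0⇒n≡0 (∣⊑⊥∣ (sets 3 (λ E x S → (S :∩ (E :─ x)) :∩ x :⊑ :⊥) {_} {E M} {⁅ x ⁆} {S}))) ⟩
      ∣ (S ∪ ⁅ x ⁆) ∩ E M ∣ + 0                   ≡⟨ ℕ.+-identityʳ _ ⟩
      ∣ (S ∪ ⁅ x ⁆) ∩ E M ∣                       ∎)
    where open ≡-Reasoning

  module _ {P Q} (P⊑ : P ⊑ E′) (Q⊑ : Q ⊑ E′) (cover : E′ ⊑ P ∪ Q) (disj : P ∩ Q ⊑ ⊥) where

    cover-x : E M ⊑ P ∪ ⁅ x ⁆ ∪ Q
    cover-x = sets 4 (λ E x P Q → E :─ x :⊑ P :∪ Q ⇒ E :⊑ P :∪ x :∪ Q) cover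

    K-bound : ∀ {k} → 3C.ρ + 1 + k ≤ r M* (P ∪ ⁅ x ⁆) + r M* (Q ∪ ⁅ x ⁆) → r K E′ + k ≤ r K P + r K Q
    K-bound {k} bound = linear 8
      (λ k ρ px qx p q e ex → ρ :+ con 1 :+ k :≤ px :+ qx ⟹ px := p :+ con 1 ⟹ qx := q :+ con 1 ⟹
         e :+ con 1 := ex ⟹ ex :≤ ρ ⟹ e :+ k :≤ p :+ q)
      k 3C.ρ (r M* (P ∪ ⁅ x ⁆)) (r M* (Q ∪ ⁅ x ⁆)) (r K P) (r K Q) (r K E′) (r M* (E′ ∪ ⁅ x ⁆))
      bound (sym (rank-K P)) (sym (rank-K Q)) (rank-K E′) (rank-≤ρ M* _)

    lift-rank : ∀ {k} S → k ≤ r K S → k + 1 ≤ r M* (S ∪ ⁅ x ⁆)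
    lift-rank S kS = ≤-≡-trans (ℕ.+-monoˡ-≤ 1 kS) (rank-K S)

    vertical : 2 ≤ r K P → 2 ≤ r K Q → r M* (P ∪ ⁅ x ⁆) + r M* (Q ∪ ⁅ x ⁆) ≤ 3C.ρ + 2 → Vertical M* x P Q
    vertical P≥2 Q≥2 sum = record
      { x∈ = x∈E
      ; P⊑ = sets 3 (λ P E x → P :⊑ E :─ x ⇒ P :⊑ E) P⊑ ; Q⊑ = sets 3 (λ P E x → P :⊑ E :─ x ⇒ P :⊑ E) Q⊑
      ; cover = cover-x ; P∩Q = disj
      ; x∉P = sets 3 (λ P E x → P :⊑ E :─ x ⇒ x :∩ P :⊑ :⊥) P⊑
      ; x∉Q = sets 3 (λ P E x → P :⊑ E :─ x ⇒ x :∩ P :⊑ :⊥) Q⊑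
      ; rP = lift-rank P P≥2 ; rQ = lift-rank Q Q≥2 ; sum = sum }

    one-side : 2 ≤ ∣ Q ∣ → 1 ≤ r K P → 3C.ρ + 2 ≤ r M* (P ∪ ⁅ x ⁆) + r M* (Q ∪ ⁅ x ⁆)
    one-side Q≥2 P≥1 = 3C.separation-bound₂ {A = P ∪ ⁅ x ⁆} {Q}
      (sets 3 (λ P E x → P :⊑ E :─ x ⇒ x :⊑ E ⇒ P :∪ x :⊑ (P :∪ x) :∩ E) P⊑ x∈E)
      (sets 3 (λ Q E x → Q :⊑ E :─ x ⇒ Q :⊑ (Q :∪ x) :∩ E) Q⊑)
      (sets 4 (λ P Q E x → Q :⊑ E :─ x ⇒ P :∩ Q :⊑ :⊥ ⇒ (P :∪ x) :∩ Q :⊑ :⊥) Q⊑ disj)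
      (sets 4 (λ E P x Q → E :⊑ P :∪ x :∪ Q ⇒ E :⊑ (P :∪ x) :∪ (Q :∪ x)) cover-x)
      (ℕ.≤-trans (lift-rank P P≥1) (rank-card M* _)) Q≥2

  bound₁ : VerticalBound 1 K
  bound₁ {P} {Q} P⊑ Q⊑ cover disj P≥1 Q≥1 = K-bound P⊑ Q⊑ cover disj
    (≡-≤-trans (ℕ.+-assoc 3C.ρ 1 1) (by-size (2 ℕ.≤? ∣ Q ∣) (2 ℕ.≤? ∣ P ∣)))
    where
    by-size : Dec (2 ≤ ∣ Q ∣) → Dec (2 ≤ ∣ P ∣) → 3C.ρ + 2 ≤ r M* (P ∪ ⁅ x ⁆) + r M* (Q ∪ ⁅ x ⁆)
    by-size (yes Q≥2) _ = one-side P⊑ Q⊑ cover disj Q≥2 P≥1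
    by-size (no _) (yes P≥2) = ≤-≡-trans
      (one-side Q⊑ P⊑ (sets 3 (λ E P Q → E :⊑ P :∪ Q ⇒ E :⊑ Q :∪ P) cover)
        (sets 2 (λ P Q → P :∩ Q :⊑ :⊥ ⇒ Q :∩ P :⊑ :⊥) disj) P≥2 Q≥1)
      (ℕ.+-comm (r M* (Q ∪ ⁅ x ⁆)) _)
    by-size (no Q≱2) (no P≱2) = ⊥-elim (linear 5
      (λ e p u q o → con 4 :≤ e ⟹ e :≤ p :+ u ⟹ u :≤ o :+ q ⟹ p :≤ con 1 ⟹ q :≤ con 1 ⟹ o :≤ con 1 ⟹ :false)
      (∣ E M ∣) (∣ P ∣) (∣ ⁅ x ⁆ ∪ Q ∣) (∣ Q ∣) (∣ ⁅ x ⁆ ∣) large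
      (card-cover P (⁅ x ⁆ ∪ Q) (cover-x P⊑ Q⊑ cover disj)) (card-cover ⁅ x ⁆ Q ⊑-refl)
      (ℕ.≤-pred (ℕ.≰⇒> P≱2)) (ℕ.≤-pred (ℕ.≰⇒> Q≱2)) (ℕ.≤-reflexive (∣⁅⁆∣ {x = x})))

  co-3-connected : (∀ {P Q} → ¬ Vertical M* x P Q) → Connected 3 (co (M ＼ ⁅ x ⁆))
  co-3-connected none = dual-connected (si K) (si-3-connected K bound₁
    λ {P} {Q} P⊑ Q⊑ cover disj P≥2 Q≥2 → K-bound P⊑ Q⊑ cover disj
      (ℕ.≮⇒≥ λ small → none (vertical P⊑ Q⊑ cover disj P≥2 Q≥2
        (linear 2 (λ s ρ → con 1 :+ s :≤ ρ :+ con 1 :+ con 2 ⟹ s :≤ ρ :+ con 2)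
          (r M* (P ∪ ⁅ x ⁆) + r M* (Q ∪ ⁅ x ⁆)) 3C.ρ small))))

  si-co-3-connected : ∀ {L} → r M* (L ∪ ⁅ x ⁆) ≤ 2 →
    (∀ {P Q} → Vertical M* x P Q → ∣ P ─ L ∣ ≤ 1 ⊎ ∣ Q ─ L ∣ ≤ 1) → Connected 3 (si (co (M ＼ ⁅ x ⁆)))
  si-co-3-connected {L} line near = si-dual-si-3-connected K
    (ℕ.+-cancelʳ-≤ 1 _ 1 (≡-≤-trans (rank-K L) line)) bound₁
    λ {P} {Q} P⊑ Q⊑ cover disj P≥2 Q≥2 small → near (vertical P⊑ Q⊑ cover disj P≥2 Q≥2
      (linear 7 (λ ρ p q px qx e ex → p :+ q :≤ e :+ con 1 ⟹ px :≤ p :+ con 1 ⟹ qx :≤ q :+ con 1 ⟹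
           e :+ con 1 :≤ ex ⟹ ex :≤ ρ ⟹ px :+ qx :≤ ρ :+ con 2)
        3C.ρ (r K P) (r K Q) (r M* (P ∪ ⁅ x ⁆)) (r M* (Q ∪ ⁅ x ⁆)) (r K E′) (r M* (E′ ∪ ⁅ x ⁆))
        small (ℕ.≤-reflexive (sym (rank-K P))) (ℕ.≤-reflexive (sym (rank-K Q)))
        (ℕ.≤-reflexive (rank-K E′)) (rank-≤ρ M* _)))

  minor-K : ∀ {L T} → IsMinor M* L T → ⁅ x ⁆ ⊑ T → IsMinor K L (T ─ ⁅ x ⁆)
  minor-K {L} {T} minor x∈T = record
    { ground   = sets 4 (λ F T x E → F :⊑ E ⇒ F :∩ T :⊑ :⊥ ⇒ x :⊑ T ⇒ F :⊑ E :─ x) ground disjoint x∈T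
    ; contract = sets 3 (λ T x E → T :⊑ E ⇒ T :─ x :⊑ E :─ x) contract
    ; disjoint = sets 3 (λ F T x → F :∩ T :⊑ :⊥ ⇒ F :∩ (T :─ x) :⊑ :⊥) disjoint
    ; rank     = λ {Z} Z⊑ → linear 5
        (λ l k t zk zt → l :+ t := zt ⟹ k :+ con 1 := t ⟹ zt := zk :+ con 1 ⟹ l :+ k := zk)
        (r L Z) (r K (T ─ ⁅ x ⁆)) (r M* T) (r K (Z ∪ (T ─ ⁅ x ⁆))) (r M* (Z ∪ T))
        (rank Z⊑)
        (trans (rank-K _) (cong (r M*) (sets 2 (λ T x → x :⊑ T ⇒ (T :─ x) :∪ x :≡ T) x∈T)))
        (sym (trans (rank-K _) (cong (r M*) (sets 3 (λ Z T x → x :⊑ T ⇒ (Z :∪ (T :─ x)) :∪ x :≡ Z :∪ T) x∈T))))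
    }
    where open IsMinor minor

deletion-minor : (M : Matroid m) {D : Subset m} {L : Matroid m} {T : Subset m} →
                 IsMinor (M ＼ D) L T → IsMinor M L T
deletion-minor M {D} {L} {T} minor = record
  { ground   = ⊑-trans ground (sets 2 (λ E D → E :─ D :⊑ E))
  ; contract = ⊑-trans contract (sets 2 (λ E D → E :─ D :⊑ E))
  ; disjoint = disjoint
  ; rank     = λ {Z} Z⊑ → trans
      (cong (λ U → r L Z + r M U) (sets 2 (λ T E → T :⊑ E ⇒ T :≡ T :∩ E) contract))
      (trans (rank Z⊑) (cong (r M) (sets 4 (λ Z T F E → Z :⊑ F ⇒ F :⊑ E ⇒ T :⊑ E ⇒ (Z :∪ T) :∩ E :≡ Z :∪ T)
        Z⊑ ground contract)))
  }
  where open IsMinor minor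

-- The complement of a circuit is a hyperplane of the dual.
circuit-coclosed : (M : Matroid m) {C : Subset m} → Circuit M C → ∀ {x} → ⁅ x ⁆ ⊑ C →
                   ¬ (r (dual M) ((E M ─ C) ∪ ⁅ x ⁆) ≤ r (dual M) (E M ─ C))
circuit-coclosed M {C} circuit@(C⊆ , _ , indep) {x} x∈ = linear 12
  (λ hx h ρ chx ch rx rc c cx o c′ rc′ →
     chx :+ rx := hx :+ ρ ⟹ h :+ ρ := ch :+ rc ⟹ ch :+ o :≤ chx ⟹ con 1 :≤ o ⟹ rc :≤ rc′ ⟹ con 1 :+ rc′ :≤ c ⟹
     c :≤ cx :+ o ⟹ o :≤ con 1 ⟹ cx :≤ c′ ⟹ c′ :≤ rx ⟹ hx :≤ h ⟹ :false)
  (r (dual M) ((E M ─ C) ∪ ⁅ x ⁆)) (r (dual M) (E M ─ C)) (r M (E M))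
  (∣ ((E M ─ C) ∪ ⁅ x ⁆) ∩ E M ∣) (∣ (E M ─ C) ∩ E M ∣)
  (r M (E M ─ ((E M ─ C) ∪ ⁅ x ⁆))) (r M (E M ─ (E M ─ C))) (∣ C ∣) (∣ C ─ ⁅ x ⁆ ∣) (∣ ⁅ x ⁆ ∣)
  (r M (C ─ ⁅ x ⁆)) (r M C)
  (sym (dual-rank M ((E M ─ C) ∪ ⁅ x ⁆))) (dual-rank M (E M ─ C))
  (card-disjoint (sets 3 (λ E C x → x :⊑ C ⇒ C :⊑ E ⇒ ((E :─ C) :∩ E) :∪ x :⊑ ((E :─ C) :∪ x) :∩ E) x∈ C⊑)
    (sets 3 (λ E C x → x :⊑ C ⇒ ((E :─ C) :∩ E) :∩ x :⊑ :⊥) x∈))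
  (ℕ.≤-reflexive (sym (∣⁅⁆∣ {x = x})))
  (rank-⊑ M (sets 2 (λ E C → E :─ (E :─ C) :⊑ C)))
  (circuit-rank M circuit)
  (card-cover (C ─ ⁅ x ⁆) ⁅ x ⁆ (sets 2 (λ C x → C :⊑ (C :─ x) :∪ x)))
  (ℕ.≤-reflexive (∣⁅⁆∣ {x = x}))
  (ℕ.≤-reflexive (sym (proj₂ (indep (C ─ ⁅ x ⁆)
    (⊑⇒⊆ (sets 2 (λ C x → C :─ x :⊑ C)) , x , ⊑⇒∈ x∈ ,
      λ x∈′ → ⁅⁆⋢⊥ {x = x} (sets 2 (λ C x → x :⊑ C :─ x ⇒ x :⊑ :⊥) (∈⇒⊑ x∈′)))))))
  (rank-⊑ M (sets 3 (λ E C x → C :⊑ E ⇒ C :─ x :⊑ E :─ ((E :─ C) :∪ x)) C⊑))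
  where
  C⊑ : C ⊑ E M
  C⊑ = ⊆⇒⊑ C⊆

∣triple∣ : ∀ {x y z : Fin m} → x ≢ y → x ≢ z → y ≢ z → ∣ ⁅ x ⁆ ∪ ⁅ y ⁆ ∪ ⁅ z ⁆ ∣ ≡ 3
∣triple∣ {x = x} {y} {z} x≢y x≢z y≢z = ℕ.≤-antisym
  (ℕ.≤-trans (card-cover ⁅ x ⁆ (⁅ y ⁆ ∪ ⁅ z ⁆) ⊑-refl)
    (ℕ.+-mono-≤ (ℕ.≤-reflexive (∣⁅⁆∣ {x = x})) (card-pair-≤ y z)))
  (ℕ.≤-trans (ℕ.+-mono-≤ (ℕ.≤-reflexive (sym (∣⁅⁆∣ {x = x})))
      (card-≥2 {X = ⁅ y ⁆ ∪ ⁅ z ⁆} y≢z (sets 2 (λ y z → y :⊑ y :∪ z)) (sets 2 (λ y z → z :⊑ y :∪ z))))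
    (card-disjoint {Y = ⁅ x ⁆} {⁅ y ⁆ ∪ ⁅ z ⁆} ⊑-refl (sets 3 (λ x y z → x :∩ y :⊑ :⊥ ⇒ x :∩ z :⊑ :⊥ ⇒ x :∩ (y :∪ z) :⊑ :⊥)
      (≢⇒disjoint x≢y) (≢⇒disjoint x≢z))))

triangle-intro : (M : Matroid m) → Connected 3 M → 4 ≤ ∣ E M ∣ → ∀ {x y z} → x ≢ y → x ≢ z → y ≢ z →
  ⁅ x ⁆ ⊑ E M → ⁅ y ⁆ ⊑ E M → ⁅ z ⁆ ⊑ E M → r M (⁅ x ⁆ ∪ ⁅ y ⁆ ∪ ⁅ z ⁆) ≤ 2 → Triangle M (⁅ x ⁆ ∪ ⁅ y ⁆ ∪ ⁅ z ⁆)
triangle-intro M conn large {x} {y} {z} x≢y x≢z y≢z x∈ y∈ z∈ r≤2 =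
  circuit-intro M X⊑ (≤-≡-trans (s≤s r≤2) (sym card)) indep , card
  where
  open ThreeConnected M conn large
  card = ∣triple∣ x≢y x≢z y≢z
  X⊑ : ⁅ x ⁆ ∪ ⁅ y ⁆ ∪ ⁅ z ⁆ ⊑ E M
  X⊑ = sets 4 (λ x y z E → x :⊑ E ⇒ y :⊑ E ⇒ z :⊑ E ⇒ x :∪ y :∪ z :⊑ E) x∈ y∈ z∈

  indep : ∀ {D} → D ⊑ ⁅ x ⁆ ∪ ⁅ y ⁆ ∪ ⁅ z ⁆ → ∣ D ∣ ℕ.< ∣ ⁅ x ⁆ ∪ ⁅ y ⁆ ∪ ⁅ z ⁆ ∣ → ∣ D ∣ ≤ r M D
  indep {D} D⊑ D< = by-size (∣ D ∣ ℕ.≤? 1)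
    where
    D⊑E : D ⊑ E M
    D⊑E = ⊑-trans D⊑ X⊑
    by-size : Dec (∣ D ∣ ≤ 1) → ∣ D ∣ ≤ r M D
    by-size (yes D≤1) = small-independent M (λ d∈ → rank-≥1 (⊑-trans d∈ D⊑E)) D≤1
    by-size (no D≰1) = first (≥1⇒element {X = D} (ℕ.≤-trans (s≤s z≤n) (ℕ.≰⇒> D≰1)))
      where
      first : ∃[ d ] ⁅ d ⁆ ⊑ D → ∣ D ∣ ≤ r M D
      first (d , d∈) = [ second , (λ empty → ⊥-elim (D≰1 (≤-≡-trans
          (card-mono (sets 2 (λ D d → D :─ d :⊑ :⊥ ⇒ D :⊑ d) empty)) (∣⁅⁆∣ {x = d})))) ]′
        (nonempty-or-⊑⊥ (D ─ ⁅ d ⁆))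
        where
        second : ∃[ e ] ⁅ e ⁆ ⊑ D ─ ⁅ d ⁆ → ∣ D ∣ ≤ r M D
        second (e , e∈) = ℕ.≤-trans (ℕ.≤-pred (≤-≡-trans D< card)) (ℕ.≤-trans
          (rank-≥2 (separated⇒≢ e∈ (sets 2 (λ D d → d :∩ (D :─ d) :⊑ :⊥)))
            (⊑-trans e∈ (⊑-trans (sets 2 (λ D d → D :─ d :⊑ D)) D⊑E)) (⊑-trans d∈ D⊑E))
          (rank-⊑ M (sets 3 (λ D d e → d :⊑ D ⇒ e :⊑ D :─ d ⇒ e :∪ d :⊑ D) d∈ e∈)))

non-cospanning⇒rank : (M : Matroid m) {X : Subset m} → X ⊑ E M → ∣ X ∣ ≡ 3 →
  r (dual M) (E M ─ X) + 1 ≤ r (dual M) (E M) → r M X ≤ 2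
non-cospanning⇒rank M {X} X⊑ card gap = linear 9
  (λ h e ρ ch rx ce r0 rX c → h :+ con 1 :≤ e ⟹ ch :+ rx :≤ h :+ ρ ⟹ e :+ ρ := ce :+ r0 ⟹ r0 := con 0 ⟹
     ce :≤ c :+ ch ⟹ c :≤ con 3 ⟹ rX :≤ rx ⟹ rX :≤ con 2)
  (r (dual M) (E M ─ X)) (r (dual M) (E M)) (r M (E M)) (∣ (E M ─ X) ∩ E M ∣) (r M (E M ─ (E M ─ X)))
  (∣ E M ∩ E M ∣) (r M (E M ─ E M)) (r M X) (∣ X ∣)
  gap (ℕ.≤-reflexive (sym (dual-rank M (E M ─ X)))) (dual-rank M (E M))
  (rank-⊥ M (sets 1 (λ E → E :─ E :⊑ :⊥)))
  (card-cover X ((E M ─ X) ∩ E M) (sets 2 (λ E X → E :∩ E :⊑ X :∪ ((E :─ X) :∩ E))))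
  (ℕ.≤-reflexive card) (rank-⊑ M (sets 2 (λ E X → X :⊑ E ⇒ X :⊑ E :─ (E :─ X)) X⊑))

si-hasMinor : (K : Matroid m) (N : Matroid n) → Connected 3 N → 4 ≤ ∣ E N ∣ →
              HasMinor K N → HasMinor (si K) N
si-hasMinor K N connN largeN hasMinor = from-si
  (let L , T , minor , L≅N = hasMinor⇒isMinor {K = K} {N = N} hasMinor
   in SimplifiedMinor.si-minor K (isomorphic-to N connN largeN) minor L≅N)
  where
  from-si : ∃[ L ] ∃[ T ] (IsMinor (si K) L T × L ≅ N) → HasMinor (si K) N
  from-si (L , T , minor , L≅N) = isMinor⇒hasMinor {K = si K} minor L≅N

dual-hasMinor : (K : Matroid m) (N : Matroid n) → HasMinor K (dual N) → HasMinor (dual K) N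
dual-hasMinor K N hasMinor =
  let L , T , minor , L≅N = hasMinor⇒isMinor {K = K} {N = dual N} hasMinor
  in isMinor⇒hasMinor {K = dual K} (isMinor-dual {K = K} minor)
       (≅-trans (≅-dual {M = L} {N = dual N} L≅N) (dual-dual N))

module Conclusion {m n} (M : Matroid m) (N : Matroid n) (conn : Connected 3 M) (connN : Connected 3 N)
  (largeN : 4 ≤ ∣ E N ∣) (large : 4 ≤ ∣ E M ∣) (conn* : Connected 3 (dual M)) {C : Subset m} (C⊑ : C ⊑ E M)
  (coclosed : ∀ {x} → ⁅ x ⁆ ⊑ C → ¬ (r (dual M) ((E M ─ C) ∪ ⁅ x ⁆) ≤ r (dual M) (E M ─ C))) where

  M* : Matroid m
  M* = dual M

  𝓝* : MinorClass m
  𝓝* = isomorphic-to (dual N) (dual-connected N connN) largeN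

  in-E : ∀ {x} → ⁅ x ⁆ ⊑ C → ⁅ x ⁆ ⊑ E M
  in-E x∈ = ⊑-trans x∈ C⊑

  co-minor : ∀ {x} → ⁅ x ⁆ ⊑ E M → SmallMinor M* 𝓝* x ⊥ → HasMinor (co (M ＼ ⁅ x ⁆)) N
  co-minor {x} x∈ sm = dual-hasMinor (si (dual (M ＼ ⁅ x ⁆))) N
    (si-hasMinor (dual (M ＼ ⁅ x ⁆)) (dual N) (dual-connected N connN) largeN
      (isMinor⇒hasMinor {K = dual (M ＼ ⁅ x ⁆)} {N = dual N} (Deletion.minor-K M conn large x∈ minor x∈T) member))
    where open SmallMinor sm

  si-co-minor : ∀ {x} → ⁅ x ⁆ ⊑ E M → SmallMinor M* 𝓝* x ⊥ → HasMinor (si (co (M ＼ ⁅ x ⁆))) N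
  si-co-minor {x} x∈ sm = si-hasMinor (co (M ＼ ⁅ x ⁆)) N connN largeN (co-minor x∈ sm)

  conclusion : Outcome M* C 𝓝* →
    (∃[ x ] x ∈ C × Connected 3 (co (M ＼ ⁅ x ⁆)) × HasMinor (co (M ＼ ⁅ x ⁆)) N)
    ⊎
    (∃[ x ] x ∈ C × Connected 3 (si (co (M ＼ ⁅ x ⁆))) × HasMinor (si (co (M ＼ ⁅ x ⁆))) N)
    ⊎
    (∃[ x₁ ] ∃[ x₂ ] ∃[ x₃ ] ∃[ x₄ ] FourFan M x₁ x₂ x₃ x₄ × x₂ ∈ C × x₄ ∈ C ×
      Connected 3 (co (M ＼ ⁅ x₃ ⁆)) × HasMinor (co (M ＼ ⁅ x₃ ⁆)) N)
  conclusion (si-connected {x} x∈C sm none) = inj₁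
    (x , ⊑⇒∈ x∈C , Deletion.co-3-connected M conn large (in-E x∈C) none , co-minor (in-E x∈C) sm)
  conclusion (co-si-connected {x} x∈C sm line near) = inj₂ (inj₁
    (x , ⊑⇒∈ x∈C , Deletion.si-co-3-connected M conn large (in-E x∈C) line near , si-co-minor (in-E x∈C) sm))
  conclusion (fan {x₁} {x₂} {x₃} {x₄} x₂∈C x₄∈C x₁∈E x₃∈E distinct@(≢₁₂ , ≢₁₃ , ≢₁₄ , ≢₂₃ , ≢₂₄ , ≢₃₄)
           gap line sm none) = inj₂ (inj₂
    (x₁ , x₂ , x₃ , x₄
    , ( distinct
      , triangle-intro M conn large ≢₁₂ ≢₁₃ ≢₂₃ x₁∈E (in-E x₂∈C) x₃∈E
          (non-cospanning⇒rank M
            (sets 4 (λ x y z E → x :⊑ E ⇒ y :⊑ E ⇒ z :⊑ E ⇒ x :∪ y :∪ z :⊑ E) x₁∈E (in-E x₂∈C) x₃∈E)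
            (∣triple∣ ≢₁₂ ≢₁₃ ≢₂₃) gap)
      , triangle-intro M* conn* large ≢₂₃ ≢₂₄ ≢₃₄ (in-E x₂∈C) x₃∈E (in-E x₄∈C) line )
    , ⊑⇒∈ x₂∈C , ⊑⇒∈ x₄∈C
    , Deletion.co-3-connected M conn large x₃∈E none , co-minor x₃∈E sm))

  from-minor : ∀ {x₀ L T} → ⁅ x₀ ⁆ ⊑ C → IsMinor (M ＼ ⁅ x₀ ⁆) L T → L ≅ N → Outcome M* C 𝓝*
  from-minor {x₀} {L} {T} x₀∈C minor L≅N = Descent.outcome M* conn* large C⊑ coclosed 𝓝*
    {x₀} {dual L} {(E M ─ T) ─ E L} x₀∈C
    (isMinor-dual {K = M} {L} {T} (deletion-minor M minor)) (≅-dual {M = L} {N = N} L≅N)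
    (sets 4 (λ x E F T → x :⊑ E ⇒ F :⊑ E :─ x ⇒ T :⊑ E :─ x ⇒ x :⊑ (E :─ T) :─ F)
      (in-E x₀∈C) (IsMinor.ground minor) (IsMinor.contract minor))

theorem1p3 : ∀ {m n : ℕ} (M : Matroid m) (N : Matroid n) →
    Connected 3 M → Connected 3 N → 4 ≤ ∣ E N ∣ →
    (C : Subset m) → Circuit M C →
    (∃[ x₀ ] x₀ ∈ C × HasMinor (M ＼ ⁅ x₀ ⁆) N) →
    (∃[ x ] x ∈ C ×
    Connected 3 (co (M ＼ ⁅ x ⁆)) × HasMinor (co (M ＼ ⁅ x ⁆)) N)
    ⊎
    (∃[ x ] x ∈ C ×
    Connected 3 (si (co (M ＼ ⁅ x ⁆))) × HasMinor (si (co (M ＼ ⁅ x ⁆))) N)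
    ⊎
    (∃[ x₁ ] ∃[ x₂ ] ∃[ x₃ ] ∃[ x₄ ] FourFan M x₁ x₂ x₃ x₄ ×
    x₂ ∈ C × x₄ ∈ C ×
    Connected 3 (co (M ＼ ⁅ x₃ ⁆)) × HasMinor (co (M ＼ ⁅ x₃ ⁆)) N)
theorem1p3 M N conn connN largeN C circuit (x₀ , x₀∈C , minor₀) =
  let L , T , minor , L≅N = hasMinor⇒isMinor {K = M ＼ ⁅ x₀ ⁆} {N = N} minor₀
      large = ℕ.≤-trans (MinorClass.four-elements (isomorphic-to N connN largeN) L≅N)
                (card-mono (⊑-trans (IsMinor.ground minor) (sets 2 (λ E x → E :─ x :⊑ E))))
      open Conclusion M N conn connN largeN large (dual-connected M conn)
             (⊆⇒⊑ (proj₁ circuit)) (circuit-coclosed M circuit)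
  in conclusion (from-minor (∈⇒⊑ x₀∈C) minor L≅N)
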